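{- Let $K_4^-$ be the $3$-graph with edges $\{abc,abd,acd\}$ on vertex set $\{a,b,c,d\}$, let $F^\star$ be the $3$-graph with edges $\{123,124,345,156,257\}$ on vertex set $\{1,\dots,7\}$, and let $F=K_4^-\times F^\star$ be their categorical product. Then $\pi(F)=\frac29$ and $\xi(F)=\infty$.
   Context: A $3$-graph $H$ is a set of $3$-element subsets (edges) of a finite vertex set $V(H)$; $|H|$ denotes its number of edges. For a family $\mathcal F$ of $3$-graphs, $\mathrm{ex}(n,\mathcal F)$ is the maximum number of edges in an $n$-vertex $3$-graph containing no member of $\mathcal F$ as a subgraph ($\mathcal F$-free), and $\pi(\mathcal F)=\lim_{n\to\infty}\mathrm{ex}(n,\mathcal F)/\binom n3$; for a single graph write $\pi(F)$, $\mathrm{ex}(n,F)$. The categorical product $G\times H$ of $3$-graphs has vertex set $V(G)\times V(H)$, and a triple $\{(x_1,y_1),(x_2,y_2),(x_3,y_3)\}$ is an edge iff $\{x_1,x_2,x_3\}\in G$ and $\{y_1,y_2,y_3\}\in H$ (so $F$ has $28$ vertices and $90$ edges). Stability number: $\mathcal F$ is $t$-stable if for every $m\in\mathbb N$ there exist $3$-graphs $G_1(m),\dots,G_t(m)$ on $m$ vertices such that for every $\delta>0$ there exist $\epsilon>0$ and $N_0$ such that whenever $n\ge N_0$ and $H$ is an $n$-vertex $\mathcal F$-free $3$-graph with $|H|>(1-\epsilon)\mathrm{ex}(n,\mathcal F)$, after relabelling vertices $H$ can be transformed into some $G_i(n)$ by adding and deleting at most $\delta n^3$ edges. The stability number $\xi(\mathcal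 F)$ is the least such $t$, and $\xi(\mathcal F)=\infty$ if no such $t$ exists. -}

module Defs where

open import Data.Bool using (Bool; true; false; _∧_; _∨_; not; _xor_; if_then_else_)
open import Data.Nat as ℕ using (ℕ; _≥_; _^_; _≡ᵇ_)
open import Data.Nat.Combinatorics using (_C_)
open import Data.Fin using (Fin; toℕ)
open import Data.Fin.Properties using (_≟_; _<?_)
open import Data.List using (List; []; _∷_; map; allFin)
open import Data.Nat.ListAction using (sum)
open import Data.Bool.ListAction using (any)
open import Data.Product using (_×_; _,_; Σ; ∃; ∃-syntax)
open import Data.Integer using (+_)
open import Data.Rational using (ℚ; _/_; _*_; _-_; ∣_∣; _≤_; _<_; 0ℚ; 1ℚ)
open import Relation.Nullary using (¬_)
open import Relation.Nullary.Decidable using (⌊_⌋)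
open import Relation.Binary.PropositionalEquality using (_≡_)
open import Function.Definitions using (Injective)

-- A 3-graph on the vertex set Fin n is given by a Boolean function on
-- triples; the edge {x,y,z} is present iff x,y,z are pairwise distinct and
-- the function is true on some ordering of (x,y,z) (symmetric closure).
Graph3 : ℕ → Set
Graph3 n = Fin n → Fin n → Fin n → Bool

edge : ∀ {n} → Graph3 n → Fin n → Fin n → Fin n → Bool
edge H x y z =
  not ⌊ x ≟ y ⌋ ∧ not ⌊ y ≟ z ⌋ ∧ not ⌊ x ≟ z ⌋ ∧
  (H x y z ∨ H x z y ∨ H y x z ∨ H y z x ∨ H z x y ∨ H z y x)

ind : Bool → ℕ
ind b = if b then 1 else 0

countTriples : ∀ {n} → (Fin n → Fin n → Fin n → Bool) → ℕ
countTriples {n} P =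
  sum (map (λ i → sum (map (λ j → sum (map (λ k →
    ind (⌊ i <? j ⌋ ∧ ⌊ j <? k ⌋ ∧ P i j k)) (allFin n))) (allFin n))) (allFin n))

size : ∀ {n} → Graph3 n → ℕ
size H = countTriples (edge H)

dist : ∀ {n} → Graph3 n → Graph3 n → ℕ
dist G H = countTriples (λ x y z → edge G x y z xor edge H x y z)

relabel : ∀ {n} → (Fin n → Fin n) → Graph3 n → Graph3 n
relabel σ H x y z = H (σ x) (σ y) (σ z)

listed : ∀ {m} → List (ℕ × ℕ × ℕ) → Fin m → Fin m → Fin m → Bool
listed ts x y z =
  any (λ { (a , b , c) → (toℕ x ≡ᵇ a) ∧ (toℕ y ≡ᵇ b) ∧ (toℕ z ≡ᵇ c) }) ts

-- K4^- on {a,b,c,d} = {0,1,2,3}: edges abc, abd, acd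
K4m : Graph3 4
K4m = listed ((0 , 1 , 2) ∷ (0 , 1 , 3) ∷ (0 , 2 , 3) ∷ [])

-- F* on {1,...,7} = {0,...,6}: edges 123,124,345,156,257
Fstar : Graph3 7
Fstar = listed ((0 , 1 , 2) ∷ (0 , 1 , 3) ∷ (2 , 3 , 4) ∷ (0 , 4 , 5) ∷ (1 , 4 , 6) ∷ [])

VF : Set
VF = Fin 4 × Fin 7

edgeF : VF → VF → VF → Bool
edgeF (x₁ , y₁) (x₂ , y₂) (x₃ , y₃) = edge K4m x₁ x₂ x₃ ∧ edge Fstar y₁ y₂ y₃

ContainsF : ∀ {n} → Graph3 n → Set
ContainsF {n} H =
  Σ (VF → Fin n) λ φ → Injective _≡_ _≡_ φ ×
    (∀ u v w → edgeF u v w ≡ true → edge H (φ u) (φ v) (φ w) ≡ true)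

FFree : ∀ {n} → Graph3 n → Set
FFree H = ¬ ContainsF H

IsEx : ℕ → ℕ → Set
IsEx n e = (Σ (Graph3 n) λ H → FFree H × size H ≡ e) ×
           (∀ (H : Graph3 n) → FFree H → size H ℕ.≤ e)

ℕtoℚ : ℕ → ℚ
ℕtoℚ k = + k / 1

-- π(F) = r : ex(n,F) / C(n,3) → r (denominator cleared)
TuranDensityIs : ℚ → Set
TuranDensityIs r =
  ∀ (ε : ℚ) → 0ℚ < ε → ∃[ N ] ∀ n → n ≥ N → ∀ e → IsEx n e →
    ∣ ℕtoℚ e - r * ℕtoℚ (n C 3) ∣ ≤ ε * ℕtoℚ (n C 3)

Stable : ℕ → Set
Stable t =
  Σ ((m : ℕ) → Fin t → Graph3 m) λ G →
    ∀ (δ : ℚ) → 0ℚ < δ → Σ ℚ λ ε → 0ℚ < ε × ∃[ N₀ ] ∀ n → n ≥ N₀ →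
      ∀ (H : Graph3 n) → FFree H →
      (∀ e → IsEx n e → (1ℚ - ε) * ℕtoℚ e < ℕtoℚ (size H)) →
      ∃[ i ] Σ (Fin n → Fin n) λ σ → Injective _≡_ _≡_ σ ×
        ℕtoℚ (dist (relabel σ H) (G n i)) ≤ δ * ℕtoℚ (n ^ 3)

StabilityInfinite : Set
StabilityInfinite = ∀ t → ¬ Stable t

{-# OPTIONS --safe #-}
module Submission where

-- Upper bound: F maps to K₄⁻ and to F* by the projections, and by Erdős' box theorem a 3-graph with a positive
-- proportion of m-sets whose induced 3-graph receives a homomorphism from F contains F.  So it is enough that
-- 3-graphs without homomorphic images of K₄⁻ and F* have Lagrangian at most 1/27.  By symmetrization the
-- support of the weighting may be assumed to have all pairs covered; then two edges sharing a pair would give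
-- K₄⁻ or F*, so every link is a matching, and the degree of a heaviest vertex is at most 2s²/9 for total weight s.
--
-- Stability: Γ consists of the triples {P, x, y} with x, y ∈ {0,1}² differing in the first bit and {Q, x, y}
-- with x, y differing in the second bit.  It receives no homomorphism from F, and giving {P, Q} weight 1/6 each
-- and the weights a/3, b/3, b/3, a/3 to {0,1}², a + b = 1, yields density 2/9 for all a.  The sum of the squared
-- codegrees, which is Lipschitz in the edit distance, depends on ab, so these blow-ups are pairwise far apart.

open import Defs
open import Data.Bool using (Bool; true; false; _∧_; _∨_; not; if_then_else_; T; _xor_)
open import Data.Bool.ListAction using (any; all)
import Data.Bool.Properties as Bool
open import Data.Empty using (⊥; ⊥-elim)
open import Data.Fin using (Fin; #_; zero; suc; toℕ; punchOut; combine; remQuot; _↑ˡ_; _↑ʳ_; splitAt)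
  renaming (_<_ to _<ᶠ_)
open import Data.Fin.Properties as Fin using (_≟_; any?; all?; punchIn-punchOut; pigeonhole)
open import Data.List as List using (List; []; _∷_; _++_; length; allFin)
import Data.List.Membership.DecPropositional as Membership
open import Data.List.Membership.Propositional using (_∈_; _∉_)
open import Data.List.Membership.Propositional.Properties using (∈-++⁺ˡ; ∈-++⁺ʳ; ∈-tabulate⁺; ∈-allFin)
import Data.List.Properties as List
open import Data.List.Relation.Unary.All using (All; []; _∷_)
open import Data.List.Relation.Unary.Any using (here; there)
open import Data.Maybe using (Maybe; just; nothing)
open import Data.Nat using (ℕ; zero; suc; _+_; _*_; _∸_; _^_; _≤_; _<_; z≤n; s≤s; s≤s⁻¹; _≤?_; _<?_; >-nonZero; _≡ᵇ_)
  renaming (_≟_ to _≟ℕ_; _/_ to _div_; _%_ to _mod_)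
open import Data.Nat.Combinatorics using (_C_; nCk+nC[k+1]≡[n+1]C[k+1]; nC1≡n)
open import Data.Nat.DivMod using (m≡m%n+[m/n]*n; m%n<n)
import Data.Nat.ListAction as ListAction
open import Data.Nat.Properties hiding (_≟_)
open import Data.Nat.Tactic.RingSolver using (solve-∀)
open import Data.Product using (Σ; ∃-syntax; _×_; _,_; proj₁; proj₂)
open import Data.Sum using (_⊎_; inj₁; inj₂; [_,_]′)
open import Data.Vec as Vec using (Vec; []; _∷_; lookup; tabulate; insertAt)
import Data.Vec.Properties as Vec
open import Function using (_∘_; id)
open import Function.Definitions using (Injective)
open import Relation.Binary.Definitions using (tri<; tri≈; tri>)
open import Relation.Binary.PropositionalEquality hiding (J)
open import Relation.Nullary using (¬_; Dec; yes; no)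
open import Relation.Nullary.Decidable using (⌊_⌋; _×-dec_; _→-dec_; ¬?; decidable-stable; from-yes)
import Algebra.Properties.Semiring.Sum +-*-semiring as Sum

-- Finite sums

-- The Lagrangian bound is proved with natural-number weights instead of a maximizing real
-- weighting. After symmetrization, taking one unit off a heaviest vertex at total weight `s` costs
-- at most `3 * 2s²/9`. Adding up these losses gives the discrete primitive `cubic N / 9`, which
-- exceeds `2N³/9` only in lower order terms. This excess is harmless, because the bound is applied
-- to samples of `m` vertices with `m` as large as wanted. That neither K₄⁻ nor F* maps to Γ would
-- not settle whether their product does: a homomorphism from a categorical product need not come
-- from one of its factors. Hence the exhaustive search over colourings of a part of F. Against `T`
-- proposed limit graphs, `T + 1` blow-ups of Γ with `a : b = i : (D - i)` are played. They have the
-- same number of edges, and their sums of squared codegrees differ by multiples of a fixed positive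
-- fraction of n⁴, so two of them cannot lie close to the same proposed graph. All estimates are
-- cleared of denominators; `1/k` stands for the error in a density.

opaque
  ∑ : ∀ {n} → (Fin n → ℕ) → ℕ
  ∑ = Sum.sum

opaque
  unfolding ∑

  ∑-empty : (f : Fin 0 → ℕ) → ∑ f ≡ 0
  ∑-empty f = refl

  ∑-suc : ∀ {n} (f : Fin (suc n) → ℕ) → ∑ f ≡ f zero + ∑ (f ∘ suc)
  ∑-suc f = refl

  ∑-cong : ∀ {n} {f g : Fin n → ℕ} → (∀ i → f i ≡ g i) → ∑ f ≡ ∑ g
  ∑-cong = Sum.sum-cong-≗

  ∑-+ : ∀ {n} (f g : Fin n → ℕ) → ∑ (λ i → f i + g i) ≡ ∑ f + ∑ g
  ∑-+ = Sum.∑-distrib-+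

  ∑-comm : ∀ {m n} (f : Fin m → Fin n → ℕ) → ∑ (λ i → ∑ (f i)) ≡ ∑ (λ j → ∑ λ i → f i j)
  ∑-comm = Sum.∑-comm

  ∑-*ˡ : ∀ {n} c (f : Fin n → ℕ) → ∑ (λ i → c * f i) ≡ c * ∑ f
  ∑-*ˡ c f = sym (Sum.*-distribˡ-sum c f)

  ∑-*ʳ : ∀ {n} c (f : Fin n → ℕ) → ∑ (λ i → f i * c) ≡ ∑ f * c
  ∑-*ʳ c f = sym (Sum.*-distribʳ-sum c f)

  ∑-mono : ∀ {n} {f g : Fin n → ℕ} → (∀ i → f i ≤ g i) → ∑ f ≤ ∑ g
  ∑-mono {zero} h = z≤n
  ∑-mono {suc n} h = +-mono-≤ (h zero) (∑-mono (h ∘ suc))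

  ∑-const : ∀ n c → ∑ {n} (λ _ → c) ≡ n * c
  ∑-const zero c = refl
  ∑-const (suc n) c = cong (c +_) (∑-const n c)

  ∑-bounded : ∀ {n} {f : Fin n → ℕ} {c} → (∀ i → f i ≤ c) → ∑ f ≤ n * c
  ∑-bounded {n} {c = c} h = ≤-trans (∑-mono h) (≤-reflexive (∑-const n c))

  term≤∑ : ∀ {n} (f : Fin n → ℕ) i → f i ≤ ∑ f
  term≤∑ f zero = m≤m+n _ _
  term≤∑ f (suc i) = ≤-trans (term≤∑ (f ∘ suc) i) (m≤n+m _ _)

  ∑-zero : ∀ {n} {f : Fin n → ℕ} → (∀ i → f i ≡ 0) → ∑ f ≡ 0
  ∑-zero {n} h = trans (∑-cong h) (trans (∑-const n 0) (*-zeroʳ n))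

  ∑≡0⇒≡0 : ∀ {n} (f : Fin n → ℕ) → ∑ f ≡ 0 → ∀ i → f i ≡ 0
  ∑≡0⇒≡0 f eq i = n≤0⇒n≡0 (subst (f i ≤_) eq (term≤∑ f i))

  ∑-mono-< : ∀ {n} {f g : Fin n → ℕ} → (∀ i → f i ≤ g i) → ∀ i → f i < g i → ∑ f < ∑ g
  ∑-mono-< h zero lt = +-mono-<-≤ lt (∑-mono (h ∘ suc))
  ∑-mono-< h (suc i) lt = +-mono-≤-< (h zero) (∑-mono-< (h ∘ suc) i lt)

average : ∀ {n} (f : Fin n → ℕ) c → 0 < n → n * c ≤ ∑ f → ∃[ i ] c ≤ f i
average {n} f c n>0 h with any? (λ i → c ≤? f i)
... | yes p = p
... | no ¬p = ⊥-elim (<⇒≱ (begin-strict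
    ∑ f         <⟨ m<m+n (∑ f) n>0 ⟩
    ∑ f + n     ≡⟨ cong (∑ f +_) (sym (trans (∑-const n 1) (*-identityʳ n))) ⟩
    ∑ f + ∑ {n} (λ _ → 1) ≡⟨ ∑-+ f (λ _ → 1) ⟨
    ∑ (λ i → f i + 1) ≤⟨ ∑-bounded (λ i → subst (_≤ c) (+-comm 1 (f i)) (≰⇒> (λ le → ¬p (i , le)))) ⟩
    n * c ∎) h)
  where open ≤-Reasoning

opaque
  unfolding ∑

  ∑-unique : ∀ {n} {f : Fin n → ℕ} {c} → (∀ i → f i ≤ c) →
             (∀ i j → 0 < f i → 0 < f j → i ≡ j) → ∑ f ≤ c
  ∑-unique {zero} _ _ = z≤n
  ∑-unique {suc n} {f} {c} ub uniq with f zero in eq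
  ... | zero = ∑-unique (ub ∘ suc) (λ i j p q → Fin.suc-injective (uniq _ _ p q))
  ... | suc x = ≤-trans (≤-reflexive (trans (cong (suc x +_) (∑-zero rest)) (+-identityʳ _)))
                        (subst (_≤ c) eq (ub zero))
    where
    rest : ∀ i → f (suc i) ≡ 0
    rest i with f (suc i) in eq′
    ... | zero = refl
    ... | suc y with () ← uniq zero (suc i) (subst (0 <_) (sym eq) (s≤s z≤n)) (subst (0 <_) (sym eq′) (s≤s z≤n))

  ∑-supported : ∀ {n} (f : Fin n → ℕ) i → (∀ j → i ≢ j → f j ≡ 0) → ∑ f ≡ f i
  ∑-supported {suc n} f zero h =
    trans (cong (f zero +_) (∑-zero (λ j → h (suc j) λ ()))) (+-identityʳ _)
  ∑-supported {suc n} f (suc i) h =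
    trans (cong (_+ ∑ (f ∘ suc)) (h zero λ ()))
          (∑-supported (f ∘ suc) i (λ j ne → h (suc j) (ne ∘ Fin.suc-injective)))

  listSum≡∑ : ∀ {n} (f : Fin n → ℕ) → ListAction.sum (List.map f (allFin n)) ≡ ∑ f
  listSum≡∑ {n} f = trans (cong ListAction.sum (List.map-tabulate id f)) (go f)
    where
    go : ∀ {n} (f : Fin n → ℕ) → ListAction.sum (List.tabulate f) ≡ ∑ f
    go {zero} f = refl
    go {suc n} f = cong (f zero +_) (go (f ∘ suc))

δ : ∀ {n} → Fin n → Fin n → ℕ
δ i j = ind ⌊ i ≟ j ⌋

δ-refl : ∀ {n} (i : Fin n) → δ i i ≡ 1
δ-refl i with i ≟ i
... | yes _ = refl
... | no ne = ⊥-elim (ne refl)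

δ-≢ : ∀ {n} {i j : Fin n} → i ≢ j → δ i j ≡ 0
δ-≢ {i = i} {j} ne with i ≟ j
... | yes e = ⊥-elim (ne e)
... | no _ = refl

∑-δ : ∀ {n} i (f : Fin n → ℕ) → ∑ (λ j → δ i j * f j) ≡ f i
∑-δ i f = trans (∑-supported _ i (λ j ne → cong (_* f j) (δ-≢ ne)))
                (trans (cong (_* f i) (δ-refl i)) (*-identityˡ _))

ind≤1 : ∀ b → ind b ≤ 1
ind≤1 true = s≤s z≤n
ind≤1 false = z≤n

argmax : ∀ {n} (f : Fin n → ℕ) → 0 < ∑ f → ∃[ i ] 0 < f i × ∀ j → f j ≤ f i
argmax {zero} f p = ⊥-elim (<-irrefl (sym (∑-empty f)) p)
argmax {suc n} f p = let i , h = go f in i , n≢0⇒n>0 (λ eq → <-irrefl (sym (∑-zero λ j → n≤0⇒n≡0 (subst (f j ≤_) eq (h j)))) p) , h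
  where
  go : ∀ {n} (f : Fin (suc n) → ℕ) → ∃[ i ] ∀ j → f j ≤ f i
  go {zero} f = zero , λ { zero → ≤-refl }
  go {suc n} f with go (f ∘ suc)
  ... | i , h with ≤-total (f zero) (f (suc i))
  ... | inj₁ le = suc i , λ { zero → le ; (suc j) → h j }
  ... | inj₂ ge = zero , λ { zero → ≤-refl ; (suc j) → ≤-trans (h j) ge }

-- The weighted edge count of a 3-graph

-- Since `2(m+q)² - 9mq = (q-2m)(2q-m)`, the bound `d ≤ mq` suffices when `2m ≤ q`. When `q ≤ 2m`,
-- the other bound suffices because `3q ≤ 2(m+q)`. Both are tight at `q = 2m`, the case of a single
-- edge with three equal weights.
bounded-quadratic : ∀ m q d → d ≤ m * q → 2 * d ≤ q * q → 9 * d ≤ 2 * ((m + q) * (m + q))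
bounded-quadratic m q d d≤mq 2d≤qq with ≤-total (2 * m) q
... | inj₁ 2m≤q = begin
    9 * d        ≤⟨ *-monoʳ-≤ 9 d≤mq ⟩
    9 * (m * q)  ≡⟨ cong (λ z → 9 * (m * z)) q≡ ⟩
    9 * (m * (2 * m + x)) ≤⟨ m≤m+n _ (3 * m * x + 2 * (x * x)) ⟩
    9 * (m * (2 * m + x)) + (3 * m * x + 2 * (x * x)) ≡⟨ expand m x ⟩
    2 * ((m + (2 * m + x)) * (m + (2 * m + x))) ≡⟨ cong (λ z → 2 * ((m + z) * (m + z))) q≡ ⟨
    2 * ((m + q) * (m + q)) ∎
  where
  open ≤-Reasoning
  x = q ∸ 2 * m
  q≡ : q ≡ 2 * m + x
  q≡ = sym (m+[n∸m]≡n 2m≤q)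
  expand : ∀ m x → 9 * (m * (2 * m + x)) + (3 * m * x + 2 * (x * x)) ≡ 2 * ((m + (2 * m + x)) * (m + (2 * m + x)))
  expand = solve-∀
... | inj₂ q≤2m = *-cancelˡ-≤ 2 (begin
    2 * (9 * d)  ≡⟨ eq₁ d ⟩
    9 * (2 * d)  ≤⟨ *-monoʳ-≤ 9 2d≤qq ⟩
    9 * (q * q)  ≡⟨ eq₂ q ⟩
    (q + 2 * q) * (q + 2 * q) ≤⟨ *-mono-≤ le le ⟩
    (2 * m + 2 * q) * (2 * m + 2 * q) ≡⟨ eq₃ m q ⟩
    2 * (2 * ((m + q) * (m + q))) ∎)
  where
  open ≤-Reasoning
  le = +-monoˡ-≤ (2 * q) q≤2m
  eq₁ : ∀ d → 2 * (9 * d) ≡ 9 * (2 * d)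
  eq₁ = solve-∀
  eq₂ : ∀ q → 9 * (q * q) ≡ (q + 2 * q) * (q + 2 * q)
  eq₂ = solve-∀
  eq₃ : ∀ m q → (2 * m + 2 * q) * (2 * m + 2 * q) ≡ 2 * (2 * ((m + q) * (m + q)))
  eq₃ = solve-∀

Ternary : Set → Set
Ternary A = A → A → A → Bool

-- Two adjacent transpositions generate all permutations of a triple, so the other symmetries are
-- derived. The carrier is arbitrary because relations are later pulled back along sampling and
-- colouring maps.
record IsLoopless3 {A : Set} (E : Ternary A) : Set where
  field
    swap₁₂ : ∀ {x y z} → E x y z ≡ true → E y x z ≡ true
    swap₂₃ : ∀ {x y z} → E x y z ≡ true → E x z y ≡ true
    loopless : ∀ {x z} → E x x z ≡ true → ⊥

  cycle : ∀ {x y z} → E x y z ≡ true → E y z x ≡ true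
  cycle = swap₂₃ ∘ swap₁₂

  swap₁₃ : ∀ {x y z} → E x y z ≡ true → E z y x ≡ true
  swap₁₃ = swap₁₂ ∘ cycle

  ≢₁₂ : ∀ {x y z} → E x y z ≡ true → x ≢ y
  ≢₁₂ e refl = loopless e

  ≢₂₃ : ∀ {x y z} → E x y z ≡ true → y ≢ z
  ≢₂₃ e refl = loopless (cycle e)

  ≢₁₃ : ∀ {x y z} → E x y z ≡ true → x ≢ z
  ≢₁₃ e refl = loopless (swap₂₃ e)

HomK4m : ∀ {A : Set} → Ternary A → Set
HomK4m E = ∃[ a ] ∃[ b ] ∃[ c ] ∃[ d ] E a b c ≡ true × E a b d ≡ true × E a c d ≡ true

HomFstar : ∀ {A : Set} → Ternary A → Set
HomFstar E = ∃[ v₁ ] ∃[ v₂ ] ∃[ v₃ ] ∃[ v₄ ] ∃[ v₅ ] ∃[ v₆ ] ∃[ v₇ ]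
  E v₁ v₂ v₃ ≡ true × E v₁ v₂ v₄ ≡ true × E v₃ v₄ v₅ ≡ true × E v₁ v₅ v₆ ≡ true × E v₂ v₅ v₇ ≡ true

≡true-cong : ∀ {b c} → (b ≡ true → c ≡ true) → (c ≡ true → b ≡ true) → b ≡ c
≡true-cong {true} f g = sym (f refl)
≡true-cong {false} {true} f g = g refl
≡true-cong {false} {false} f g = refl

ind-positive : ∀ {b} → 0 < ind b → b ≡ true
ind-positive {true} _ = refl

module Weighted {k : ℕ} (E : Ternary (Fin k)) (E-3 : IsLoopless3 E) where
  open IsLoopless3 E-3

  e : Fin k → Fin k → Fin k → ℕ
  e i j l = ind (E i j l)

  e-swap₁₂ : ∀ i j l → e i j l ≡ e j i l
  e-swap₁₂ i j l = cong ind (≡true-cong swap₁₂ swap₁₂)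

  e-swap₂₃ : ∀ i j l → e i j l ≡ e i l j
  e-swap₂₃ i j l = cong ind (≡true-cong swap₂₃ swap₂₃)

  e-loop : ∀ i l → e i i l ≡ 0
  e-loop i l with E i i l in eq
  ... | true = ⊥-elim (loopless eq)
  ... | false = refl

  Weight : Set
  Weight = Fin k → ℕ

  link : Fin k → Weight → Weight → ℕ
  link i u v = ∑ λ j → ∑ λ l → u j * v l * e i j l

  form : Weight → Weight → Weight → ℕ
  form u v w = ∑ λ i → u i * link i v w

  link-cong : ∀ i {u u′ v v′} → u ≗ u′ → v ≗ v′ → link i u v ≡ link i u′ v′
  link-cong i p q = ∑-cong λ j → ∑-cong λ l → cong₂ (λ x y → x * y * e i j l) (p j) (q l)

  form-cong : ∀ {u u′} → u ≗ u′ → form u u u ≡ form u′ u′ u′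
  form-cong p = ∑-cong λ i → cong₂ _*_ (p i) (link-cong i p p)

  link-sym : ∀ i u v → link i u v ≡ link i v u
  link-sym i u v = trans (∑-comm (λ j l → u j * v l * e i j l))
    (∑-cong λ l → ∑-cong λ j → cong₂ _*_ (*-comm (u j) (v l)) (e-swap₂₃ i j l))

  link-+ˡ : ∀ i u u′ v → link i (λ j → u j + u′ j) v ≡ link i u v + link i u′ v
  link-+ˡ i u u′ v = trans
    (∑-cong λ j → trans (∑-cong λ l → distrib (u j) (u′ j) (v l) (e i j l)) (∑-+ _ _))
    (∑-+ _ _)
    where
    distrib : ∀ a b c d → (a + b) * c * d ≡ a * c * d + b * c * d
    distrib = solve-∀

  link-+ʳ : ∀ i u v v′ → link i u (λ j → v j + v′ j) ≡ link i u v + link i u v′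
  link-+ʳ i u v v′ = trans (link-sym i u _) (trans (link-+ˡ i v v′ u) (cong₂ _+_ (link-sym i v u) (link-sym i v′ u)))

  form-swap₂₃ : ∀ u v w → form u v w ≡ form u w v
  form-swap₂₃ u v w = ∑-cong λ i → cong (u i *_) (link-sym i v w)

  form-flat : ∀ u v w → form u v w ≡ ∑ λ i → ∑ λ j → ∑ λ l → u i * v j * w l * e i j l
  form-flat u v w = ∑-cong λ i → trans (sym (∑-*ˡ (u i) _)) (∑-cong λ j → trans (sym (∑-*ˡ (u i) _))
    (∑-cong λ l → assoc (u i) (v j) (w l) (e i j l)))
    where
    assoc : ∀ a b c d → a * (b * c * d) ≡ a * b * c * d
    assoc = solve-∀

  form-swap₁₂ : ∀ u v w → form u v w ≡ form v u w
  form-swap₁₂ u v w = trans (form-flat u v w) (trans (∑-comm (λ i j → ∑ λ l → u i * v j * w l * e i j l)) (trans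
    (∑-cong λ j → ∑-cong λ i → ∑-cong λ l →
      cong₂ _*_ (cong (_* w l) (*-comm (u i) (v j))) (e-swap₁₂ i j l)) (sym (form-flat v u w))))

  form-+₁ : ∀ u u′ v w → form (λ j → u j + u′ j) v w ≡ form u v w + form u′ v w
  form-+₁ u u′ v w = trans (∑-cong λ i → *-distribʳ-+ (link i v w) (u i) (u′ i)) (∑-+ _ _)

  form-+₂ : ∀ u v v′ w → form u (λ j → v j + v′ j) w ≡ form u v w + form u v′ w
  form-+₂ u v v′ w = trans (form-swap₁₂ u (λ j → v j + v′ j) w) (trans (form-+₁ v v′ u w)
    (cong₂ _+_ (form-swap₁₂ v u w) (form-swap₁₂ v′ u w)))

  form-+₃ : ∀ u v w w′ → form u v (λ j → w j + w′ j) ≡ form u v w + form u v w′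
  form-+₃ u v w w′ = trans (form-swap₂₃ u v _) (trans (form-+₂ u w w′ v)
    (cong₂ _+_ (form-swap₂₃ u w v) (form-swap₂₃ u w′ v)))

  point : ℕ → Fin k → Weight
  point x i j = δ i j * x

  form-point : ∀ x i v w → form (point x i) v w ≡ x * link i v w
  form-point x i v w = trans (∑-cong λ j → *-assoc (δ i j) x (link j v w)) (∑-δ i _)

  link-pointˡ : ∀ i x v → link i (point x i) v ≡ 0
  link-pointˡ i x v = ∑-zero λ j → ∑-zero λ l → vanish j l
    where
    vanish : ∀ j l → δ i j * x * v l * e i j l ≡ 0
    vanish j l with i ≟ j
    ... | yes refl = trans (cong ((x + 0) * v l *_) (e-loop i l)) (*-zeroʳ ((x + 0) * v l))
    ... | no _ = refl

  link-pointʳ : ∀ i x v → link i v (point x i) ≡ 0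
  link-pointʳ i x v = trans (link-sym i v _) (link-pointˡ i x v)

  -- Ordered triples are summed, so this is six times the Lagrangian polynomial: a Lagrangian of at
  -- most 1/27 becomes `density w ≤ 2s³/9` for total weight `s`.
  density : Weight → ℕ
  density w = form w w w

  link-+point : ∀ w x i → link i (λ j → w j + point x i j) (λ j → w j + point x i j) ≡ link i w w
  link-+point w x i = begin
    link i (λ j → w j + point x i j) (λ j → w j + point x i j)
      ≡⟨ link-+ˡ i w (point x i) _ ⟩
    link i w (λ j → w j + point x i j) + link i (point x i) (λ j → w j + point x i j)
      ≡⟨ cong₂ _+_ (link-+ʳ i w w (point x i)) (link-pointˡ i x _) ⟩
    link i w w + link i w (point x i) + 0
      ≡⟨ cong (λ z → link i w w + z + 0) (link-pointʳ i x w) ⟩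
    link i w w + 0 + 0
      ≡⟨ trans (+-identityʳ _) (+-identityʳ _) ⟩
    link i w w ∎
    where open ≡-Reasoning

  -- Terms with two factors at `i` vanish by looplessness, so the polynomial is exactly linear in
  -- the weight of `i`. The 3 counts the positions of `i` in an ordered triple.
  density-+point : ∀ w x i → density (λ j → w j + point x i j) ≡ density w + 3 * (x * link i w w)
  density-+point w x i = begin
    form w′ w′ w′
      ≡⟨ form-+₁ w p w′ w′ ⟩
    form w w′ w′ + form p w′ w′
      ≡⟨ cong₂ _+_ (form-+₂ w w p w′) (trans (form-point x i w′ w′) (cong (x *_) (link-+point w x i))) ⟩
    form w w w′ + form w p w′ + a
      ≡⟨ cong₂ (λ y z → y + z + a) (form-+₃ w w w p) (form-swap₁₂ w p w′) ⟩
    form w w w + form w w p + form p w w′ + a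
      ≡⟨ cong₂ (λ y z → form w w w + y + z + a) wwp pww′ ⟩
    form w w w + a + a + a
      ≡⟨ collect (form w w w) a ⟩
    form w w w + 3 * a ∎
    where
    open ≡-Reasoning
    p = point x i
    w′ : Weight
    w′ j = w j + p j
    a = x * link i w w
    collect : ∀ b a → b + a + a + a ≡ b + 3 * a
    collect = solve-∀
    wwp : form w w p ≡ a
    wwp = trans (form-swap₂₃ w w p) (trans (form-swap₁₂ w p w) (form-point x i w w))
    pww′ : form p w w′ ≡ a
    pww′ = trans (form-point x i w w′) (cong (x *_) (trans (link-+ʳ i w w p)
      (trans (cong (link i w w +_) (link-pointʳ i x w)) (+-identityʳ _))))

2mn≤m²+n² : ∀ m n → m * n + m * n ≤ m * m + n * n
2mn≤m²+n² m n with ≤-total m n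
... | inj₁ m≤n = subst (λ n → m * n + m * n ≤ m * m + n * n) (m+[n∸m]≡n m≤n) (lemma m (n ∸ m))
  where
  lemma : ∀ m d → m * (m + d) + m * (m + d) ≤ m * m + (m + d) * (m + d)
  lemma m d = ≤-trans (m≤m+n _ (d * d)) (≤-reflexive (eq m d))
    where
    eq : ∀ m d → m * (m + d) + m * (m + d) + d * d ≡ m * m + (m + d) * (m + d)
    eq = solve-∀
... | inj₂ n≤m = subst (λ m → m * n + m * n ≤ m * m + n * n) (m+[n∸m]≡n n≤m) (lemma n (m ∸ n))
  where
  lemma : ∀ n d → (n + d) * n + (n + d) * n ≤ (n + d) * (n + d) + n * n
  lemma n d = ≤-trans (m≤m+n _ (d * d)) (≤-reflexive (eq n d))
    where
    eq : ∀ n d → (n + d) * n + (n + d) * n + d * d ≡ (n + d) * (n + d) + n * n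
    eq = solve-∀

positive-factorˡ : ∀ {m n} → 0 < m * n → 0 < m
positive-factorˡ {suc m} _ = s≤s z≤n

positive-factorʳ : ∀ {m n} → 0 < m * n → 0 < n
positive-factorʳ {m} {n} p = positive-factorˡ {n} {m} (subst (0 <_) (*-comm m n) p)

signum : ℕ → ℕ
signum zero = 0
signum (suc _) = 1

*-signum : ∀ a → a * signum a ≡ a
*-signum zero = refl
*-signum (suc a) = *-identityʳ _

signum≤1 : ∀ a → signum a ≤ 1
signum≤1 zero = z≤n
signum≤1 (suc _) = ≤-refl

signum-positive : ∀ {a} → 0 < signum a → 0 < a
signum-positive {suc a} _ = s≤s z≤n

-- Lagrangian bound for 3-graphs without homomorphic images of K₄⁻ and F*

module _ {k : ℕ} (E : Ternary (Fin k)) (E-3 : IsLoopless3 E)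
         (noK4m : ¬ HomK4m E) (noFstar : ¬ HomFstar E) where
  open IsLoopless3 E-3
  open Weighted E E-3

  Covered : Weight → Fin k → Fin k → Set
  Covered w i j = ∃[ x ] 0 < w x × E i j x ≡ true

  AllCovered : Weight → Set
  AllCovered w = ∀ i j → i ≢ j → 0 < w i → 0 < w j → Covered w i j

  -- Two edges sharing a pair {i,j} would, through the edge covering their other two vertices,
  -- give a copy of {123,124,345}, and the pairs 15 and 25 are covered as well.
  codegree≤1 : ∀ w → AllCovered w →
    ∀ {i j l l′} → 0 < w i → 0 < w j → 0 < w l → 0 < w l′ →
    E i j l ≡ true → E i j l′ ≡ true → l ≡ l′
  codegree≤1 w cov {i} {j} {l} {l′} wi wj wl wl′ e₁ e₂ with l ≟ l′
  ... | yes l≡l′ = l≡l′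
  ... | no l≢l′ with cov l l′ l≢l′ wl wl′
  ... | x , wx , e₃ with i ≟ x
  ... | yes refl = ⊥-elim (noK4m (i , j , l , l′ , e₁ , e₂ , swap₁₂ (swap₂₃ e₃)))
  ... | no i≢x with j ≟ x
  ... | yes refl = ⊥-elim (noK4m (j , i , l , l′ , swap₁₂ e₁ , swap₁₂ e₂ , swap₁₂ (swap₂₃ e₃)))
  ... | no j≢x with cov i x i≢x wi wx | cov j x j≢x wj wx
  ... | y , _ , e₄ | z , _ , e₅ = ⊥-elim (noFstar (i , j , l , l′ , x , y , z , e₁ , e₂ , e₃ , e₄ , e₅))

  off : Fin k → Weight → Weight
  off i w j = if ⌊ i ≟ j ⌋ then 0 else w j

  off-self : ∀ i w → off i w i ≡ 0
  off-self i w with i ≟ i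
  ... | yes _ = refl
  ... | no i≢i = ⊥-elim (i≢i refl)

  off≤ : ∀ i w j → off i w j ≤ w j
  off≤ i w j with i ≟ j
  ... | yes _ = z≤n
  ... | no _ = ≤-refl

  split-off : ∀ i w j → w j ≡ off i w j + point (w i) i j
  split-off i w j with i ≟ j
  ... | yes refl = sym (+-identityʳ (w i))
  ... | no _ = sym (+-identityʳ (w j))

  ∑-+point : ∀ (w : Weight) x i → ∑ (λ j → w j + point x i j) ≡ ∑ w + x
  ∑-+point w x i = trans (∑-+ w (point x i)) (cong (∑ w +_) (∑-δ i (λ _ → x)))

  link-off : ∀ w i → link i w w ≡ link i (off i w) (off i w)
  link-off w i = trans (link-cong i (split-off i w) (split-off i w)) (link-+point (off i w) (w i) i)

  density-off : ∀ w i → density w ≡ density (off i w) + 3 * (w i * link i w w)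
  density-off w i = trans (form-cong (split-off i w)) (trans (density-+point (off i w) (w i) i)
    (cong (λ z → density (off i w) + 3 * (w i * z)) (sym (link-off w i))))

  -- By `codegree≤1` the link of `i` is a matching on the rest of the support, of weight `q`.
  -- Replacing each partner's weight by the maximum `m` bounds its weight `d` by `mq`; the
  -- inequality between arithmetic and geometric mean gives `2d ≤ q²`. These are the inputs of
  -- `bounded-quadratic`.
  link-bound : ∀ w → AllCovered w →
    ∀ i → 0 < w i → (∀ j → w j ≤ w i) → 9 * link i w w ≤ 2 * (∑ w * ∑ w)
  link-bound w cov i wi>0 max = begin
    9 * link i w w        ≡⟨ cong (9 *_) (link-off w i) ⟩
    9 * d                 ≤⟨ bounded-quadratic m q d d≤mq 2d≤qq ⟩
    2 * ((m + q) * (m + q)) ≡⟨ cong (λ z → 2 * (z * z)) total ⟨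
    2 * (∑ w * ∑ w) ∎
    where
    open ≤-Reasoning
    w₀ : Weight
    w₀ = off i w
    m = w i
    q = ∑ w₀
    d = link i w₀ w₀

    total : ∑ w ≡ m + q
    total = trans (trans (∑-cong (split-off i w)) (∑-+point w₀ m i)) (+-comm q m)

    w₀>0 : ∀ {j} → 0 < w₀ j → 0 < w j
    w₀>0 {j} p = ≤-trans p (off≤ i w j)

    linear : ∀ {j l l′} → 0 < w₀ j → 0 < w₀ l → 0 < w₀ l′ → E i j l ≡ true → E i j l′ ≡ true → l ≡ l′
    linear p q r = codegree≤1 w cov wi>0 (w₀>0 p) (w₀>0 q) (w₀>0 r)

    d≤mq : d ≤ m * q
    d≤mq = ≤-trans (∑-mono row) (≤-reflexive (trans (∑-*ʳ m w₀) (*-comm q m)))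
      where
      row : ∀ j → ∑ (λ l → w₀ j * w₀ l * e i j l) ≤ w₀ j * m
      row j with w₀ j in eq
      ... | zero = ≤-reflexive (∑-zero {k} λ _ → refl)
      ... | a@(suc _) = ∑-unique bound unique
        where
        bound : ∀ l → a * w₀ l * e i j l ≤ a * m
        bound l = ≤-trans (*-monoʳ-≤ (a * w₀ l) (ind≤1 (E i j l)))
          (≤-trans (≤-reflexive (*-identityʳ _)) (*-monoʳ-≤ a (≤-trans (off≤ i w l) (max l))))
        pos : 0 < w₀ j
        pos = subst (0 <_) (sym eq) (s≤s z≤n)
        unique : ∀ l l′ → 0 < a * w₀ l * e i j l → 0 < a * w₀ l′ * e i j l′ → l ≡ l′
        unique l l′ p p′ = linear pos
          (positive-factorʳ {a} (positive-factorˡ {a * w₀ l} p)) (positive-factorʳ {a} (positive-factorˡ {a * w₀ l′} p′))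
          (ind-positive (positive-factorʳ {a * w₀ l} p)) (ind-positive (positive-factorʳ {a * w₀ l′} p′))

    -- The link is known to be a matching only on the support, so its indicator is cut down to the
    -- support; all rows of `r` then sum to at most 1, and `d` does not change.
    r : Fin k → Fin k → ℕ
    r j l = signum (w₀ j) * signum (w₀ l) * e i j l

    r≤1 : ∀ j l → r j l ≤ 1
    r≤1 j l = *-mono-≤ (*-mono-≤ (signum≤1 (w₀ j)) (signum≤1 (w₀ l))) (ind≤1 (E i j l))

    r-row : ∀ j → ∑ (r j) ≤ 1
    r-row j = ∑-unique (r≤1 j) λ l l′ p p′ →
      linear (signum-positive (positive-factorˡ (positive-factorˡ {signum (w₀ j) * signum (w₀ l)} p)))
             (signum-positive (positive-factorʳ {signum (w₀ j)} (positive-factorˡ {signum (w₀ j) * signum (w₀ l)} p)))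
             (signum-positive (positive-factorʳ {signum (w₀ j)} (positive-factorˡ {signum (w₀ j) * signum (w₀ l′)} p′)))
             (ind-positive (positive-factorʳ {signum (w₀ j) * signum (w₀ l)} p))
             (ind-positive (positive-factorʳ {signum (w₀ j) * signum (w₀ l′)} p′))

    r-sym : ∀ j l → r j l ≡ r l j
    r-sym j l = cong₂ _*_ (*-comm (signum (w₀ j)) (signum (w₀ l))) (e-swap₂₃ i j l)

    squares = ∑ λ j → w₀ j * w₀ j

    d≡ : d ≡ ∑ λ j → ∑ λ l → w₀ j * w₀ l * r j l
    d≡ = ∑-cong λ j → ∑-cong λ l → trans
      (cong₂ (λ x y → x * y * e i j l) (sym (*-signum (w₀ j))) (sym (*-signum (w₀ l))))
      (regroup (w₀ j) (signum (w₀ j)) (w₀ l) (signum (w₀ l)) (e i j l))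
      where
      regroup : ∀ a b c d e → a * b * (c * d) * e ≡ a * c * (b * d * e)
      regroup = solve-∀

    half : ∑ (λ j → ∑ λ l → w₀ j * w₀ j * r j l) ≤ squares
    half = ∑-mono λ j → ≤-trans (≤-reflexive (∑-*ˡ (w₀ j * w₀ j) (r j)))
      (≤-trans (*-monoʳ-≤ (w₀ j * w₀ j) (r-row j)) (≤-reflexive (*-identityʳ _)))

    half′ : ∑ (λ j → ∑ λ l → w₀ l * w₀ l * r j l) ≤ squares
    half′ = ≤-trans (≤-reflexive (trans (∑-comm (λ j l → w₀ l * w₀ l * r j l))
      (∑-cong λ l → ∑-cong λ j → cong (w₀ l * w₀ l *_) (r-sym j l)))) half

    d≤squares : d ≤ squares
    d≤squares = *-cancelˡ-≤ 2 (begin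
      2 * d    ≡⟨ double d ⟩
      d + d    ≡⟨ cong₂ _+_ d≡ d≡ ⟩
      s + s    ≡⟨ trans (∑-cong λ j → ∑-+ _ _) (∑-+ _ _) ⟨
      ∑ (λ j → ∑ λ l → w₀ j * w₀ l * r j l + w₀ j * w₀ l * r j l)
        ≤⟨ ∑-mono (λ j → ∑-mono λ l → amgm (w₀ j) (w₀ l) (r j l)) ⟩
      ∑ (λ j → ∑ λ l → w₀ j * w₀ j * r j l + w₀ l * w₀ l * r j l)
        ≡⟨ trans (∑-cong λ j → ∑-+ _ _) (∑-+ _ _) ⟩
      ∑ (λ j → ∑ λ l → w₀ j * w₀ j * r j l) + ∑ (λ j → ∑ λ l → w₀ l * w₀ l * r j l)
        ≤⟨ +-mono-≤ half half′ ⟩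
      squares + squares ≡⟨ double squares ⟨
      2 * squares ∎)
      where
      s = ∑ λ j → ∑ λ l → w₀ j * w₀ l * r j l
      double : ∀ a → 2 * a ≡ a + a
      double = solve-∀
      amgm : ∀ a b r → a * b * r + a * b * r ≤ a * a * r + b * b * r
      amgm a b r = begin
        a * b * r + a * b * r ≡⟨ *-distribʳ-+ r (a * b) (a * b) ⟨
        (a * b + a * b) * r   ≤⟨ *-monoˡ-≤ r (2mn≤m²+n² a b) ⟩
        (a * a + b * b) * r   ≡⟨ *-distribʳ-+ r (a * a) (b * b) ⟩
        a * a * r + b * b * r ∎

    -- One copy of `d` is traded for the diagonal `squares`. The diagonal and the pairs of the link
    -- are disjoint sets of ordered pairs, and all ordered pairs together weigh `q²`.
    2d≤qq : 2 * d ≤ q * q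
    2d≤qq = begin
      2 * d        ≡⟨ cong (d +_) (+-identityʳ d) ⟩
      d + d        ≤⟨ +-monoˡ-≤ d d≤squares ⟩
      squares + d  ≡⟨ cong (_+ d) (∑-cong λ j → sym (∑-δ j (λ l → w₀ j * w₀ l))) ⟩
      ∑ (λ j → ∑ λ l → δ j l * (w₀ j * w₀ l)) + d ≡⟨ trans (∑-cong λ j → ∑-+ _ _) (∑-+ _ _) ⟨
      ∑ (λ j → ∑ λ l → δ j l * (w₀ j * w₀ l) + w₀ j * w₀ l * e i j l)
        ≤⟨ ∑-mono (λ j → ∑-mono λ l → disjoint j l) ⟩
      ∑ (λ j → ∑ λ l → w₀ j * w₀ l) ≡⟨ trans (∑-cong λ j → ∑-*ˡ (w₀ j) w₀) (∑-*ʳ q w₀) ⟩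
      q * q ∎
      where
      disjoint : ∀ j l → δ j l * (w₀ j * w₀ l) + w₀ j * w₀ l * e i j l ≤ w₀ j * w₀ l
      disjoint j l with j ≟ l
      ... | yes refl = ≤-reflexive (trans (cong₂ _+_ (+-identityʳ _)
              (trans (cong (w₀ j * w₀ j *_) (trans (e-swap₁₂ i j j) (trans (e-swap₂₃ j i j) (e-loop j i)))) (*-zeroʳ (w₀ j * w₀ j))))
              (+-identityʳ _))
      ... | no _ = ≤-trans (*-monoʳ-≤ (w₀ j * w₀ l) (ind≤1 (E i j l))) (≤-reflexive (*-identityʳ _))

  support : Weight → ℕ
  support w = ∑ λ i → signum (w i)

  covered? : ∀ w i j → Dec (Covered w i j)
  covered? w i j = any? λ x → (0 <? w x) ×-dec (E i j x Bool.≟ true)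

  shift : Fin k → Fin k → Weight → Weight
  shift i j w a = off j w a + point (w j) i a

  ∑-shift : ∀ i j w → ∑ (shift i j w) ≡ ∑ w
  ∑-shift i j w = trans (∑-+point (off j w) (w j) i)
    (sym (trans (∑-cong (split-off j w)) (∑-+point (off j w) (w j) j)))

  support-shift : ∀ i j w → i ≢ j → 0 < w i → 0 < w j → support (shift i j w) < support w
  support-shift i j w i≢j wi wj = ∑-mono-< smaller j strict
    where
    signum-≤1 : ∀ {a b} → 0 < b → signum a ≤ signum b
    signum-≤1 {a} {suc b} _ = signum≤1 a
    smaller : ∀ a → signum (shift i j w a) ≤ signum (w a)
    smaller a with i ≟ a
    ... | yes refl = signum-≤1 wi
    ... | no _ with j ≟ a
    ... | yes refl = z≤n
    ... | no _ = ≤-reflexive (cong signum (+-identityʳ (w a)))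
    strict : signum (shift i j w j) < signum (w j)
    strict = subst (λ z → signum z < signum (w j))
      (sym (cong₂ _+_ (off-self j w) (cong (_* w j) (δ-≢ i≢j)))) (signum-≤1 {1} wj)

  link-uncovered : ∀ i j w → ¬ Covered w i j → link i w w ≤ link i (off j w) (off j w)
  link-uncovered i j w unc = ∑-mono λ a → ∑-mono λ l → termwise a l
    where
    vanish : ∀ l → w l * e i j l ≡ 0
    vanish l with w l in eq
    ... | zero = refl
    ... | suc x with E i j l in eq′
    ... | true = ⊥-elim (unc (l , subst (0 <_) (sym eq) (s≤s z≤n) , eq′))
    ... | false = *-zeroʳ x
    termwise : ∀ a l → w a * w l * e i a l ≤ off j w a * off j w l * e i a l
    termwise a l with j ≟ a
    ... | yes refl = ≤-reflexive (trans (*-assoc (w j) (w l) (e i j l))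
                       (trans (cong (w j *_) (vanish l)) (*-zeroʳ (w j))))
    ... | no _ with j ≟ l
    ... | yes refl = ≤-trans (≤-reflexive (trans (cong₂ _*_ (*-comm (w a) (w j)) (e-swap₂₃ i a j))
                       (trans (*-assoc (w j) (w a) (e i j a)) (trans (cong (w j *_) (vanish a)) (*-zeroʳ (w j)))))) z≤n
    ... | no _ = ≤-refl

  -- Deleting `j` gives up `3 * (w j * link j w w)`. Its weight, moved to `i`, earns the link of `i`
  -- instead, and that link has lost nothing by the deletion: no edge through `i` and `j` has a
  -- third vertex of positive weight.
  density-shift : ∀ i j w → ¬ Covered w i j → link j w w ≤ link i w w → density w ≤ density (shift i j w)
  density-shift i j w unc le = begin
    density w ≡⟨ density-off w j ⟩
    density (off j w) + 3 * (w j * link j w w)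
      ≤⟨ +-monoʳ-≤ (density (off j w)) (*-monoʳ-≤ 3 (*-monoʳ-≤ (w j) (≤-trans le (link-uncovered i j w unc)))) ⟩
    density (off j w) + 3 * (w j * link i (off j w) (off j w))
      ≡⟨ density-+point (off j w) (w j) i ⟨
    density (shift i j w) ∎
    where open ≤-Reasoning

  -- Six times `1² + ... + n²`: the unit step from total weight `s - 1` to `s` adds at most `6s²` to
  -- `9 * density`.
  cubic : ℕ → ℕ
  cubic n = n * suc n * suc (2 * n)

  symmetrize : ∀ w → AllCovered w ⊎ ∃[ w′ ] ∑ w′ ≡ ∑ w × support w′ < support w × density w ≤ density w′
  symmetrize w with any? (λ i → any? λ j → ¬? (i ≟ j) ×-dec (0 <? w i) ×-dec (0 <? w j) ×-dec ¬? (covered? w i j))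
  ... | no none = inj₁ λ i j i≢j wi wj →
    decidable-stable (covered? w i j) λ unc → none (i , j , i≢j , wi , wj , unc)
  ... | yes (i , j , i≢j , wi , wj , unc) with ≤-total (link j w w) (link i w w)
  ... | inj₁ le = inj₂ (shift i j w , ∑-shift i j w , support-shift i j w i≢j wi wj , density-shift i j w unc le)
  ... | inj₂ ge = inj₂ (shift j i w , ∑-shift j i w , support-shift j i w (i≢j ∘ sym) wj wi ,
                        density-shift j i w (λ (x , p , q) → unc (x , p , swap₁₂ q)) ge)

  -- The link of `i` ignores the weight of `i`, so lowering that weight by one loses exactly
  -- `3 * link i w w`, which `link-bound` controls at a heaviest vertex.
  remove-unit : ∀ N w → AllCovered w → ∑ w ≡ suc N →
    ∃[ w⁻ ] ∑ w⁻ ≡ N × 9 * density w ≤ 9 * density w⁻ + 6 * (suc N * suc N)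
  remove-unit N w cov eq with argmax w (subst (0 <_) (sym eq) (s≤s z≤n))
  ... | i , wi , max with w i in wi≡
  ... | suc x = w⁻ , total⁻ , (begin
    9 * density w ≡⟨ cong (9 *_) step ⟩
    9 * (density w⁻ + 3 * link i w w) ≡⟨ arrange (density w⁻) (link i w w) ⟩
    9 * density w⁻ + 3 * (9 * link i w w)
      ≤⟨ +-monoʳ-≤ (9 * density w⁻) (*-monoʳ-≤ 3
           (link-bound w cov i (subst (0 <_) (sym wi≡) wi) (λ j → subst (w j ≤_) (sym wi≡) (max j)))) ⟩
    9 * density w⁻ + 3 * (2 * (∑ w * ∑ w)) ≡⟨ cong₂ _+_ refl (trans (sym (*-assoc 3 2 (∑ w * ∑ w))) (cong (λ z → 6 * (z * z)) eq)) ⟩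
    9 * density w⁻ + 6 * (suc N * suc N) ∎)
    where
    open ≤-Reasoning
    w⁻ : Weight
    w⁻ j = off i w j + point x i j
    total⁻ : ∑ w⁻ ≡ N
    total⁻ = suc-injective (trans (trans (cong suc (∑-+point (off i w) x i)) (sym (+-suc (∑ (off i w)) x)))
      (trans (cong (∑ (off i w) +_) (sym wi≡)) (trans (sym (trans (∑-cong (split-off i w)) (∑-+point (off i w) (w i) i))) eq)))
    step : density w ≡ density w⁻ + 3 * link i w w
    step = trans (density-off w i) (trans (cong (λ z → density (off i w) + 3 * (z * link i w w)) wi≡)
      (trans (regroup (density (off i w)) x (link i w w))
        (cong (_+ 3 * link i w w) (sym (trans (density-+point (off i w) x i)
          (cong (λ z → density (off i w) + 3 * (x * z)) (sym (link-off w i))))))))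
      where
      regroup : ∀ a x l → a + 3 * (suc x * l) ≡ a + 3 * (x * l) + 3 * l
      regroup = solve-∀
    arrange : ∀ a l → 9 * (a + 3 * l) ≡ 9 * a + 3 * (9 * l)
    arrange = solve-∀

  Bounded : ℕ → Set
  Bounded N = ∀ w → ∑ w ≡ N → 9 * density w ≤ cubic N

  -- Zykov symmetrization: as long as some pair of the support is uncovered, one of its two vertices
  -- takes over the whole weight of the other; afterwards a unit is removed from a heaviest vertex.
  bounded-suc : ∀ N → Bounded N → ∀ s w → support w ≤ s → ∑ w ≡ suc N → 9 * density w ≤ cubic (suc N)
  bounded-suc N ih s w supp eq with symmetrize w
  bounded-suc N ih zero w supp eq | inj₂ (_ , _ , lt , _) = ⊥-elim (<⇒≱ (≤-<-trans z≤n lt) supp)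
  bounded-suc N ih (suc s) w supp eq | inj₂ (w′ , eq′ , lt , le) = ≤-trans (*-monoʳ-≤ 9 le)
    (bounded-suc N ih s w′ (s≤s⁻¹ (≤-trans lt supp)) (trans eq′ eq))
  bounded-suc N ih s w supp eq | inj₁ cov = let w⁻ , eq⁻ , le = remove-unit N w cov eq in
    ≤-trans le (≤-trans (+-monoˡ-≤ (6 * (suc N * suc N)) (ih w⁻ eq⁻)) (≤-reflexive (cubic-suc N)))
    where
    cubic-suc : ∀ n → n * suc n * suc (2 * n) + 6 * (suc n * suc n) ≡ suc n * suc (suc n) * suc (2 * suc n)
    cubic-suc = solve-∀

  density-bound : ∀ N → Bounded N
  density-bound zero w eq = ≤-reflexive (cong (9 *_) (∑-zero λ i → cong (_* link i w w) (∑≡0⇒≡0 w eq i)))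
  density-bound (suc N) w eq = bounded-suc N (density-bound N) (support w) w ≤-refl eq

  edges-bound : 9 * (∑ λ i → ∑ λ j → ∑ λ l → e i j l) ≤ cubic k
  edges-bound = subst (λ z → 9 * z ≤ cubic k)
    (trans (form-flat one one one) (∑-cong λ i → ∑-cong λ j → ∑-cong λ l → *-identityˡ (e i j l)))
    (density-bound k one (trans (∑-const k 1) (*-identityʳ k)))
    where
    one : Weight
    one _ = 1

-- Box theorem

∑ᵛ : ∀ {n} m → (Vec (Fin n) m → ℕ) → ℕ
∑ᵛ zero f = f []
∑ᵛ (suc m) f = ∑ λ x → ∑ᵛ m λ v → f (x ∷ v)

∑ᵛ-cong : ∀ {n} m {f g : Vec (Fin n) m → ℕ} → (∀ v → f v ≡ g v) → ∑ᵛ m f ≡ ∑ᵛ m g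
∑ᵛ-cong zero h = h []
∑ᵛ-cong (suc m) h = ∑-cong λ x → ∑ᵛ-cong m λ v → h (x ∷ v)

∑ᵛ-mono : ∀ {n} m {f g : Vec (Fin n) m → ℕ} → (∀ v → f v ≤ g v) → ∑ᵛ m f ≤ ∑ᵛ m g
∑ᵛ-mono zero h = h []
∑ᵛ-mono (suc m) h = ∑-mono λ x → ∑ᵛ-mono m λ v → h (x ∷ v)

∑ᵛ-+ : ∀ {n} m (f g : Vec (Fin n) m → ℕ) → ∑ᵛ m (λ v → f v + g v) ≡ ∑ᵛ m f + ∑ᵛ m g
∑ᵛ-+ zero f g = refl
∑ᵛ-+ (suc m) f g = trans (∑-cong λ x → ∑ᵛ-+ m _ _) (∑-+ _ _)

∑ᵛ-*ˡ : ∀ {n} m c (f : Vec (Fin n) m → ℕ) → ∑ᵛ m (λ v → c * f v) ≡ c * ∑ᵛ m f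
∑ᵛ-*ˡ zero c f = refl
∑ᵛ-*ˡ (suc m) c f = trans (∑-cong λ x → ∑ᵛ-*ˡ m c _) (∑-*ˡ c _)

∑ᵛ-const : ∀ {n} m c → ∑ᵛ {n} m (λ _ → c) ≡ n ^ m * c
∑ᵛ-const zero c = sym (*-identityˡ c)
∑ᵛ-const {n} (suc m) c = trans (∑-cong {n} λ x → ∑ᵛ-const m c) (trans (∑-const n _) (sym (*-assoc n (n ^ m) c)))

∑ᵛ-∑-comm : ∀ {n k} m (f : Vec (Fin n) m → Fin k → ℕ) → ∑ᵛ m (λ v → ∑ (f v)) ≡ ∑ λ i → ∑ᵛ m λ v → f v i
∑ᵛ-∑-comm zero f = refl
∑ᵛ-∑-comm (suc m) f = trans (∑-cong λ x → ∑ᵛ-∑-comm m λ v → f (x ∷ v)) (∑-comm λ x i → ∑ᵛ m λ v → f (x ∷ v) i)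

∑ᵛ-comm : ∀ {n k} m l (f : Vec (Fin n) m → Vec (Fin k) l → ℕ) →
          ∑ᵛ m (λ v → ∑ᵛ l (f v)) ≡ ∑ᵛ l λ u → ∑ᵛ m λ v → f v u
∑ᵛ-comm m zero f = refl
∑ᵛ-comm m (suc l) f = trans (∑ᵛ-∑-comm m λ v x → ∑ᵛ l λ u → f v (x ∷ u)) (∑-cong λ x → ∑ᵛ-comm m l λ v u → f v (x ∷ u))

averageᵛ : ∀ {n} m (f : Vec (Fin n) m → ℕ) c → 0 < n → n ^ m * c ≤ ∑ᵛ m f → ∃[ v ] c ≤ f v
averageᵛ zero f c n>0 h = [] , subst (_≤ f []) (*-identityˡ c) h
averageᵛ {n} (suc m) f c n>0 h =
  let x , p = average (λ x → ∑ᵛ m λ v → f (x ∷ v)) (n ^ m * c) n>0 (subst (_≤ ∑ᵛ (suc m) f) (*-assoc n (n ^ m) c) h)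
      v , q = averageᵛ m (λ v → f (x ∷ v)) c n>0 p
  in x ∷ v , q

termᵛ≤∑ᵛ : ∀ {n} m (f : Vec (Fin n) m → ℕ) v → f v ≤ ∑ᵛ m f
termᵛ≤∑ᵛ zero f [] = ≤-refl
termᵛ≤∑ᵛ (suc m) f (x ∷ v) = ≤-trans (termᵛ≤∑ᵛ m (λ v → f (x ∷ v)) v) (term≤∑ (λ x → ∑ᵛ m λ v → f (x ∷ v)) x)

∑ᵛ-insertAt : ∀ {n} m (i : Fin (suc m)) (f : Vec (Fin n) (suc m) → ℕ) →
              ∑ᵛ (suc m) f ≡ ∑ λ x → ∑ᵛ m λ v → f (insertAt v i x)
∑ᵛ-insertAt m zero f = refl
∑ᵛ-insertAt (suc m) (suc i) f =
  trans (∑-cong λ y → ∑ᵛ-insertAt m i λ v → f (y ∷ v)) (∑-comm λ y x → ∑ᵛ m λ v → f (y ∷ insertAt v i x))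

module _ {n : ℕ} where
  open Membership (_≟_ {n}) using (_∈?_)

  member : List (Fin n) → Fin n → ℕ
  member L x = ind ⌊ x ∈? L ⌋

  ∑-member : ∀ L → ∑ (member L) ≤ length L
  ∑-member [] = ≤-reflexive (∑-zero {n} λ _ → refl)
  ∑-member (y ∷ L) = begin
    ∑ (member (y ∷ L)) ≤⟨ ∑-mono step ⟩
    ∑ (λ x → δ y x * 1 + member L x) ≡⟨ trans (∑-+ _ _) (cong (_+ ∑ (member L)) (∑-δ y λ _ → 1)) ⟩
    suc (∑ (member L)) ≤⟨ s≤s (∑-member L) ⟩
    suc (length L) ∎
    where
    open ≤-Reasoning
    step : ∀ x → member (y ∷ L) x ≤ δ y x * 1 + member L x
    step x with y ≟ x | x ∈? L | x ∈? (y ∷ L)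
    ... | yes _ | _ | z = ≤-trans (ind≤1 ⌊ z ⌋) (s≤s z≤n)
    ... | no _ | yes _ | z = ind≤1 ⌊ z ⌋
    ... | no ne | no _ | yes (here eq) = ⊥-elim (ne (sym eq))
    ... | no _ | no ∉L | yes (there ∈L) = ⊥-elim (∉L ∈L)
    ... | no _ | no _ | no _ = z≤n

  module _ {m : ℕ} (T : Vec (Fin n) (suc m) → Bool) (q : ℕ) (n>0 : 0 < n) where

    count : (Vec (Fin n) m → Bool) → ℕ
    count P = ∑ᵛ m (ind ∘ P)

    degree : Vec (Fin n) m → ℕ
    degree v = ∑ λ x → ind (T (x ∷ v))

    rich : Vec (Fin n) m → Bool
    rich v = ⌊ n ≤? 2 * q * degree v ⌋

    rich-degree : ∀ v → rich v ≡ true → n ≤ 2 * q * degree v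
    rich-degree v eq with n ≤? 2 * q * degree v
    ... | yes p = p

    -- Tuples that are not rich have fewer than `n/(2q)` extensions each, so they carry at most half
    -- of the density `1/q` of `T`; the other half must come from rich tuples, with at most `n`
    -- extensions each.
    many-rich : n ^ suc m ≤ q * ∑ᵛ (suc m) (ind ∘ T) → n ^ m ≤ 2 * q * count rich
    many-rich h = *-cancelˡ-≤ n {{>-nonZero n>0}} (+-cancelˡ-≤ (n * n ^ m) _ _ (begin
      n * n ^ m + n * n ^ m ≡⟨ cong (n * n ^ m +_) (+-identityʳ _) ⟨
      2 * (n * n ^ m) ≤⟨ *-monoʳ-≤ 2 h ⟩
      2 * (q * ∑ᵛ (suc m) (ind ∘ T)) ≡⟨ *-assoc 2 q _ ⟨
      2 * q * ∑ᵛ (suc m) (ind ∘ T) ≡⟨ cong (2 * q *_) (∑ᵛ-∑-comm m λ v x → ind (T (x ∷ v))) ⟨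
      2 * q * ∑ᵛ m degree ≡⟨ ∑ᵛ-*ˡ m (2 * q) degree ⟨
      ∑ᵛ m (λ v → 2 * q * degree v) ≤⟨ ∑ᵛ-mono m pointwise ⟩
      ∑ᵛ m (λ v → n + 2 * q * n * ind (rich v)) ≡⟨ trans (∑ᵛ-+ m _ _) (cong₂ _+_ (∑ᵛ-const m n) (∑ᵛ-*ˡ m (2 * q * n) _)) ⟩
      n ^ m * n + 2 * q * n * count rich ≡⟨ cong₂ _+_ (*-comm (n ^ m) n) (regroup q n (count rich)) ⟩
      n * n ^ m + n * (2 * q * count rich) ∎))
      where
      open ≤-Reasoning
      regroup : ∀ q n c → 2 * q * n * c ≡ n * (2 * q * c)
      regroup = solve-∀
      pointwise : ∀ v → 2 * q * degree v ≤ n + 2 * q * n * ind (rich v)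
      pointwise v with n ≤? 2 * q * degree v
      ... | no ¬p = ≤-trans (<⇒≤ (≰⇒> ¬p)) (m≤m+n n _)
      ... | yes _ = ≤-trans (≤-trans (*-monoʳ-≤ (2 * q) degree≤n) (≤-reflexive (sym (*-identityʳ _)))) (m≤n+m _ n)
        where
        degree≤n : degree v ≤ n
        degree≤n = ≤-trans (∑-bounded λ x → ind≤1 (T (x ∷ v))) (≤-reflexive (*-identityʳ n))

    Rich : (Vec (Fin n) m → Bool) → Set
    Rich P = ∀ v → P v ≡ true → n ≤ 2 * q * degree v

    -- Each tuple of `P` has at least `n/(2q)` extensions, and at most `n/(4q)` of them lie in `L`.
    -- Averaging over the remaining vertices finds one that extends at least a `1/(4q)` fraction of
    -- `P`.
    pick : ∀ P L → Rich P → 4 * q * length L ≤ n → 0 < count P →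
           ∃[ x ] x ∉ L × count P ≤ 4 * q * count (λ v → P v ∧ T (x ∷ v))
    pick P L richP small P>0 = x , x∉L , ≤-trans x-good (*-monoʳ-≤ (4 * q) fx≤)
      where
      open ≤-Reasoning
      fresh : Fin n → ℕ
      fresh x = ind (not ⌊ x ∈? L ⌋)

      f : Fin n → ℕ
      f x = ∑ᵛ m λ v → ind (P v) * (fresh x * ind (T (x ∷ v)))

      split : ∀ v x → ind (T (x ∷ v)) ≤ fresh x * ind (T (x ∷ v)) + member L x
      split v x with x ∈? L
      ... | yes _ = ind≤1 (T (x ∷ v))
      ... | no _ = ≤-reflexive (sym (trans (+-identityʳ _) (+-identityʳ _)))

      row : ∀ v → n * ind (P v) ≤ 4 * q * (ind (P v) * ∑ λ x → fresh x * ind (T (x ∷ v)))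
      row v with P v in eq
      ... | false = ≤-trans (≤-reflexive (*-zeroʳ n)) z≤n
      ... | true = +-cancelʳ-≤ n _ _ (begin
        n * 1 + n ≡⟨ double n ⟩
        2 * n ≤⟨ *-monoʳ-≤ 2 (richP v eq) ⟩
        2 * (2 * q * degree v) ≡⟨ regroup q (degree v) ⟩
        4 * q * degree v ≤⟨ *-monoʳ-≤ (4 * q) (≤-trans (∑-mono (split v)) (≤-reflexive (∑-+ _ _))) ⟩
        4 * q * (d + ∑ (member L)) ≤⟨ *-monoʳ-≤ (4 * q) (+-monoʳ-≤ d (∑-member L)) ⟩
        4 * q * (d + length L) ≡⟨ *-distribˡ-+ (4 * q) d (length L) ⟩
        4 * q * d + 4 * q * length L ≤⟨ +-mono-≤ (≤-reflexive (cong (4 * q *_) (sym (+-identityʳ d)))) small ⟩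
        4 * q * (1 * d) + n ∎)
        where
        d = ∑ λ x → fresh x * ind (T (x ∷ v))
        double : ∀ n → n * 1 + n ≡ 2 * n
        double = solve-∀
        regroup : ∀ q d → 2 * (2 * q * d) ≡ 4 * q * d
        regroup = solve-∀

      total : n * count P ≤ ∑ λ x → 4 * q * f x
      total = begin
        n * count P ≡⟨ ∑ᵛ-*ˡ m n _ ⟨
        ∑ᵛ m (λ v → n * ind (P v)) ≤⟨ ∑ᵛ-mono m row ⟩
        ∑ᵛ m (λ v → 4 * q * (ind (P v) * ∑ λ x → fresh x * ind (T (x ∷ v)))) ≡⟨ ∑ᵛ-*ˡ m (4 * q) _ ⟩
        4 * q * ∑ᵛ m (λ v → ind (P v) * ∑ λ x → fresh x * ind (T (x ∷ v)))
          ≡⟨ cong (4 * q *_) (trans (∑ᵛ-cong m λ v → sym (∑-*ˡ (ind (P v)) _)) (∑ᵛ-∑-comm m _)) ⟩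
        4 * q * ∑ f ≡⟨ ∑-*ˡ (4 * q) f ⟨
        ∑ (λ x → 4 * q * f x) ∎

      chosen = average (λ x → 4 * q * f x) (count P) n>0 total
      x = proj₁ chosen
      x-good = proj₂ chosen

      fx≤ : f x ≤ count (λ v → P v ∧ T (x ∷ v))
      fx≤ = ∑ᵛ-mono m λ v → pointwise (P v) (not ⌊ x ∈? L ⌋) (T (x ∷ v))
        where
        pointwise : ∀ a b c → ind a * (ind b * ind c) ≤ ind (a ∧ c)
        pointwise false b c = z≤n
        pointwise true false c = z≤n
        pointwise true true c = ≤-reflexive (trans (+-identityʳ _) (+-identityʳ _))

      -- A forbidden vertex has `f x = 0`, so it could not have met the average of the nonempty `P`.
      x∉L : x ∉ L
      x∉L x∈L with x ∈? L in eq
      ... | no x∉L = x∉L x∈L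
      ... | yes _ = <⇒≱ P>0 (≤-trans x-good (≤-reflexive (trans (cong (4 * q *_) f≡0) (*-zeroʳ (4 * q)))))
        where
        f≡0 : f x ≡ 0
        f≡0 = trans (∑ᵛ-cong m λ v → trans (cong (λ z → ind (P v) * (ind (not ⌊ z ⌋) * ind (T (x ∷ v)))) eq) (*-zeroʳ (ind (P v))))
                    (trans (∑ᵛ-const m 0) (*-zeroʳ (n ^ m)))

    -- `P` shrinks to the tuples extended by every vertex chosen so far. Richness passes to subsets,
    -- so `pick` applies again, at the cost of a factor `4q` in density. Chosen vertices join `L`,
    -- which is what makes `g` injective.
    picks : ∀ t P L K → Rich P → 4 * q * (t + length L) ≤ n → n ^ m ≤ K * count P →
            Σ (Fin t → Fin n) λ g → Σ (Vec (Fin n) m → Bool) λ P′ →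
            (∀ a b → g a ≡ g b → a ≡ b) × (∀ a → g a ∉ L) ×
            n ^ m ≤ (4 * q) ^ t * K * count P′ ×
            (∀ v → P′ v ≡ true → P v ≡ true × ∀ a → T (g a ∷ v) ≡ true)
    picks zero P L K _ _ dense = (λ ()) , P , (λ ()) , (λ ()) ,
      subst (λ z → n ^ m ≤ z * count P) (sym (+-identityʳ K)) dense , λ _ p → p , λ ()
    picks (suc t) P L K richP small dense with pick P L richP (≤-trans (*-monoʳ-≤ (4 * q) (m≤n+m (length L) (suc t))) small) P>0
      where
      P>0 : 0 < count P
      P>0 = positive-factorʳ {K} (≤-trans (m^n>0 n {{>-nonZero n>0}} m) dense)
    ... | x , x∉L , le with picks t P′ (x ∷ L) (4 * q * K) (λ v p → richP v (proj₁ (P′-P v p)))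
                              (≤-trans (≤-reflexive (cong (4 * q *_) (+-suc t (length L)))) small) dense′
      where
      open ≤-Reasoning
      P′ : Vec (Fin n) m → Bool
      P′ v = P v ∧ T (x ∷ v)

      P′-P : ∀ v → P′ v ≡ true → P v ≡ true × T (x ∷ v) ≡ true
      P′-P v eq with P v | T (x ∷ v)
      ... | true | true = refl , refl

      dense′ : n ^ m ≤ 4 * q * K * count P′
      dense′ = begin
        n ^ m ≤⟨ dense ⟩
        K * count P ≤⟨ *-monoʳ-≤ K le ⟩
        K * (4 * q * count P′) ≡⟨ regroup K (4 * q) (count P′) ⟩
        4 * q * K * count P′ ∎
        where
        regroup : ∀ K a c → K * (a * c) ≡ a * K * c
        regroup = solve-∀
    ... | g , P″ , inj , avoid , dense″ , complete =
      g′ , P″ , inj′ , avoid′ , subst (λ z → n ^ m ≤ z * count P″) (regroup (4 * q) ((4 * q) ^ t) K) dense″ , complete′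
      where
      regroup : ∀ a b K → b * (a * K) ≡ a * b * K
      regroup = solve-∀

      g′ : Fin (suc t) → Fin n
      g′ zero = x
      g′ (suc a) = g a

      inj′ : ∀ a b → g′ a ≡ g′ b → a ≡ b
      inj′ zero zero _ = refl
      inj′ zero (suc b) eq = ⊥-elim (avoid b (here (sym eq)))
      inj′ (suc a) zero eq = ⊥-elim (avoid a (here eq))
      inj′ (suc a) (suc b) eq = cong suc (inj a b eq)

      avoid′ : ∀ a → g′ a ∉ L
      avoid′ zero = x∉L
      avoid′ (suc a) = avoid a ∘ there

      complete′ : ∀ v → P″ v ≡ true → P v ≡ true × ∀ a → T (g′ a ∷ v) ≡ true
      complete′ v p with complete v p
      ... | p′ , all with P v | T (x ∷ v) in eq
      ... | true | true = refl , λ { zero → eq ; (suc a) → all a }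

-- Erdős' theorem on complete m-partite subgraphs of dense m-uniform hypergraphs.
box : ∀ m q l t → ∃[ N ] ∀ n → N ≤ n → (T : Vec (Fin n) m → Bool) →
      n ^ m ≤ q * ∑ᵛ m (ind ∘ T) → (L : List (Fin n)) → length L ≤ l →
      Σ (Fin m → Fin t → Fin n) λ g →
      (∀ i j a b → g i a ≡ g j b → i ≡ j × a ≡ b) × (∀ i a → g i a ∉ L) ×
      (∀ (s : _ → Fin t) → T (tabulate λ i → g i (s i)) ≡ true)
-- For `m = 0` the density hypothesis says that the empty tuple lies in `T`.
box zero q l t = 0 , λ n _ T dense L _ → (λ ()) , (λ ()) , (λ ()) , λ _ →
  ind-positive (positive-factorʳ {q} dense)
-- `2q` is the loss in passing to rich tuples and `4q` the loss for each of the `t` vertices of the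
-- first part. These vertices are forbidden to the later parts, hence `t + l`.
box (suc m) q l t with box m ((4 * q) ^ t * (2 * q)) (t + l) t
... | N , rec = suc (N + 4 * q * (t + l)) , λ n n≥ T dense L L≤l → step n n≥ T dense L L≤l
  where
  step : ∀ n → N + 4 * q * (t + l) < n → (T : Vec (Fin n) (suc m) → Bool) →
         n ^ suc m ≤ q * ∑ᵛ (suc m) (ind ∘ T) → (L : List (Fin n)) → length L ≤ l →
         Σ (Fin (suc m) → Fin t → Fin n) λ g →
         (∀ i j a b → g i a ≡ g j b → i ≡ j × a ≡ b) × (∀ i a → g i a ∉ L) ×
         (∀ (s : _ → Fin t) → T (tabulate λ i → g i (s i)) ≡ true)
  step n n≥ T dense L L≤l
    with picks T q n>0 t (rich T q n>0) L (2 * q) (rich-degree T q n>0)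
           (≤-trans (*-monoʳ-≤ (4 * q) (+-monoʳ-≤ t L≤l)) (≤-trans (m≤n+m _ N) (<⇒≤ n≥)))
           (many-rich T q n>0 dense)
    where
    n>0 = ≤-<-trans z≤n n≥
  ... | g₀ , P , injective₀ , avoid₀ , denseP , complete
    with rec n (≤-trans (m≤m+n N _) (<⇒≤ n≥)) P denseP (List.tabulate g₀ ++ L)
           (≤-trans (≤-reflexive (trans (List.length-++ (List.tabulate g₀)) (cong (_+ length L) (List.length-tabulate g₀)))) (+-monoʳ-≤ t L≤l))
  ... | g₁ , injective₁ , avoid₁ , transversal = g , inj , avoid , λ s → proj₂ (complete _ (transversal (s ∘ suc))) (s zero)
    where
    g : Fin (suc m) → Fin t → Fin n
    g zero = g₀
    g (suc i) = g₁ i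

    inj : ∀ i j a b → g i a ≡ g j b → i ≡ j × a ≡ b
    inj zero zero a b eq = refl , injective₀ a b eq
    inj zero (suc j) a b eq = ⊥-elim (avoid₁ j b (∈-++⁺ˡ (subst (_∈ List.tabulate g₀) eq (∈-tabulate⁺ a))))
    inj (suc i) zero a b eq = ⊥-elim (avoid₁ i a (∈-++⁺ˡ (subst (_∈ List.tabulate g₀) (sym eq) (∈-tabulate⁺ b))))
    inj (suc i) (suc j) a b eq = let p , q = injective₁ i j a b eq in cong suc p , q

    avoid : ∀ i a → g i a ∉ L
    avoid zero = avoid₀
    avoid (suc i) a = avoid₁ i a ∘ ∈-++⁺ʳ (List.tabulate g₀)

-- Homomorphisms

∨-swap : ∀ a b c → a ∨ (b ∨ c) ≡ b ∨ (a ∨ c)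
∨-swap false b c = refl
∨-swap true false c = refl
∨-swap true true c = refl

∧-true : ∀ {a b} → a ∧ b ≡ true → a ≡ true × b ≡ true
∧-true {true} p = refl , p

∨-true : ∀ {a b} → a ∨ b ≡ true → a ≡ true ⊎ b ≡ true
∨-true {true} _ = inj₁ refl
∨-true {false} p = inj₂ p

not⌊⌋-≢ : ∀ {n} {x y : Fin n} → not ⌊ x ≟ y ⌋ ≡ true → x ≢ y
not⌊⌋-≢ {x = x} {y} p with x ≟ y
... | no x≢y = x≢y

≢-not⌊⌋ : ∀ {n} {x y : Fin n} → x ≢ y → not ⌊ x ≟ y ⌋ ≡ true
≢-not⌊⌋ {x = x} {y} x≢y with x ≟ y
... | yes x≡y = ⊥-elim (x≢y x≡y)
... | no _ = refl

orderings : ∀ {A : Set} → Ternary A → Ternary A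
orderings H x y z = H x y z ∨ H x z y ∨ H y x z ∨ H y z x ∨ H z x y ∨ H z y x

module _ {n : ℕ} (H : Graph3 n) where

  edge-intro : ∀ x y z → x ≢ y → y ≢ z → x ≢ z → orderings H x y z ≡ true → edge H x y z ≡ true
  edge-intro x y z x≢y y≢z x≢z h rewrite ≢-not⌊⌋ x≢y | ≢-not⌊⌋ y≢z | ≢-not⌊⌋ x≢z = h

  edge-elim : ∀ x y z → edge H x y z ≡ true → x ≢ y × y ≢ z × x ≢ z × orderings H x y z ≡ true
  edge-elim x y z e =
    let p , e₁ = ∧-true {not ⌊ x ≟ y ⌋} e
        q , e₂ = ∧-true {not ⌊ y ≟ z ⌋} e₁
        r , h = ∧-true {not ⌊ x ≟ z ⌋} e₂
    in not⌊⌋-≢ p , not⌊⌋-≢ q , not⌊⌋-≢ r , h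

  edge-loopless3 : IsLoopless3 (edge H)
  edge-loopless3 = record
    { swap₁₂ = λ {x} {y} {z} e → let p , q , r , h = edge-elim x y z e in
        edge-intro y x z (p ∘ sym) r q (trans (sym (or₁₂ (H x y z) (H x z y) (H y x z) (H y z x) (H z x y) (H z y x))) h)
    ; swap₂₃ = λ {x} {y} {z} e → let p , q , r , h = edge-elim x y z e in
        edge-intro x z y r (q ∘ sym) p (trans (sym (or₂₃ (H x y z) (H x z y) (H y x z) (H y z x) (H z x y) (H z y x))) h)
    ; loopless = λ {x} {z} e → proj₁ (edge-elim x x z e) refl
    }
    where
    or₁₂ : ∀ a b c d e f → a ∨ b ∨ c ∨ d ∨ e ∨ f ≡ c ∨ d ∨ a ∨ b ∨ f ∨ e
    or₁₂ a b c d e f = begin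
      a ∨ b ∨ c ∨ d ∨ e ∨ f ≡⟨ cong (a ∨_) (∨-swap b c _) ⟩
      a ∨ c ∨ b ∨ d ∨ e ∨ f ≡⟨ ∨-swap a c _ ⟩
      c ∨ a ∨ b ∨ d ∨ e ∨ f ≡⟨ cong (λ z → c ∨ a ∨ z) (∨-swap b d _) ⟩
      c ∨ a ∨ d ∨ b ∨ e ∨ f ≡⟨ cong (c ∨_) (∨-swap a d _) ⟩
      c ∨ d ∨ a ∨ b ∨ e ∨ f ≡⟨ cong (λ z → c ∨ d ∨ a ∨ b ∨ z) (Bool.∨-comm e f) ⟩
      c ∨ d ∨ a ∨ b ∨ f ∨ e ∎
      where open ≡-Reasoning
    or₂₃ : ∀ a b c d e f → a ∨ b ∨ c ∨ d ∨ e ∨ f ≡ b ∨ a ∨ e ∨ f ∨ c ∨ d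
    or₂₃ a b c d e f = begin
      a ∨ b ∨ c ∨ d ∨ e ∨ f ≡⟨ ∨-swap a b _ ⟩
      b ∨ a ∨ c ∨ d ∨ e ∨ f ≡⟨ cong (λ z → b ∨ a ∨ c ∨ z) (∨-swap d e f) ⟩
      b ∨ a ∨ c ∨ e ∨ d ∨ f ≡⟨ cong (λ z → b ∨ a ∨ z) (∨-swap c e _) ⟩
      b ∨ a ∨ e ∨ c ∨ d ∨ f ≡⟨ cong (λ z → b ∨ a ∨ e ∨ c ∨ z) (Bool.∨-comm d f) ⟩
      b ∨ a ∨ e ∨ c ∨ f ∨ d ≡⟨ cong (λ z → b ∨ a ∨ e ∨ z) (∨-swap c f d) ⟩
      b ∨ a ∨ e ∨ f ∨ c ∨ d ∎
      where open ≡-Reasoning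

module _ {A : Set} {E : Ternary A} (E-3 : IsLoopless3 E) where
  open IsLoopless3 E-3

  edge-hom : ∀ {n} (G : Graph3 n) (χ : Fin n → A) →
    (∀ x y z → G x y z ≡ true → E (χ x) (χ y) (χ z) ≡ true) →
    ∀ x y z → edge G x y z ≡ true → E (χ x) (χ y) (χ z) ≡ true
  edge-hom G χ h x y z e with proj₂ (proj₂ (proj₂ (edge-elim G x y z e)))
  ... | o with ∨-true {G x y z} o
  ... | inj₁ p = h x y z p
  ... | inj₂ o with ∨-true {G x z y} o
  ... | inj₁ p = swap₂₃ (h x z y p)
  ... | inj₂ o with ∨-true {G y x z} o
  ... | inj₁ p = swap₁₂ (h y x z p)
  ... | inj₂ o with ∨-true {G y z x} o
  ... | inj₁ p = swap₁₂ (swap₂₃ (h y z x p))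
  ... | inj₂ o with ∨-true {G z x y} o
  ... | inj₁ p = cycle (h z x y p)
  ... | inj₂ p = swap₁₃ (h z y x p)

listed-elim : ∀ {m} (Q : Fin m → Fin m → Fin m → Set) ts →
  All (λ (a , b , c) → ∃[ i ] ∃[ j ] ∃[ l ] toℕ {m} i ≡ a × toℕ {m} j ≡ b × toℕ {m} l ≡ c × Q i j l) ts →
  ∀ x y z → listed ts x y z ≡ true → Q x y z
listed-elim Q ((a , b , c) ∷ ts) ((i , j , l , i≡ , j≡ , l≡ , q) ∷ qs) x y z h
  with ∨-true {(toℕ x ≡ᵇ a) ∧ (toℕ y ≡ᵇ b) ∧ (toℕ z ≡ᵇ c)} h
... | inj₂ h′ = listed-elim Q ts qs x y z h′
... | inj₁ h′ with ∧-true {toℕ x ≡ᵇ a} h′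
... | px , h″ with ∧-true {toℕ y ≡ᵇ b} h″
... | py , pz with same {x = x} i≡ px | same {x = y} j≡ py | same {x = z} l≡ pz
  where
  same : ∀ {m a} {i x : Fin m} → toℕ i ≡ a → (toℕ x ≡ᵇ a) ≡ true → i ≡ x
  same {a = a} {x = x} i≡ p = Fin.toℕ-injective (trans i≡ (sym (≡ᵇ⇒≡ (toℕ x) a (subst T (sym p) _))))
... | refl | refl | refl = q

Hom : ∀ {B A : Set} → Ternary B → Ternary A → (B → A) → Set
Hom R E χ = ∀ u v w → R u v w ≡ true → E (χ u) (χ v) (χ w) ≡ true

module _ {A : Set} {E : Ternary A} (E-3 : IsLoopless3 E) where

  FHom-from-K4m : HomK4m E → ∃[ χ ] Hom edgeF E χ
  FHom-from-K4m (a , b , c , d , e₁ , e₂ , e₃) = χ ∘ proj₁ , λ u v w e →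
    edge-hom E-3 K4m χ (listed-elim (λ x y z → E (χ x) (χ y) (χ z) ≡ true) _
      ((# 0 , # 1 , # 2 , refl , refl , refl , e₁) ∷
       (# 0 , # 1 , # 3 , refl , refl , refl , e₂) ∷
       (# 0 , # 2 , # 3 , refl , refl , refl , e₃) ∷ []))
      (proj₁ u) (proj₁ v) (proj₁ w) (proj₁ (∧-true {edge K4m (proj₁ u) (proj₁ v) (proj₁ w)} e))
    where
    χ : Fin 4 → A
    χ = lookup (a ∷ b ∷ c ∷ d ∷ [])

  FHom-from-Fstar : HomFstar E → ∃[ χ ] Hom edgeF E χ
  FHom-from-Fstar (v₁ , v₂ , v₃ , v₄ , v₅ , v₆ , v₇ , e₁ , e₂ , e₃ , e₄ , e₅) = χ ∘ proj₂ , λ u v w e →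
    edge-hom E-3 Fstar χ (listed-elim (λ x y z → E (χ x) (χ y) (χ z) ≡ true) _
      ((# 0 , # 1 , # 2 , refl , refl , refl , e₁) ∷
       (# 0 , # 1 , # 3 , refl , refl , refl , e₂) ∷
       (# 2 , # 3 , # 4 , refl , refl , refl , e₃) ∷
       (# 0 , # 4 , # 5 , refl , refl , refl , e₄) ∷
       (# 1 , # 4 , # 6 , refl , refl , refl , e₅) ∷ []))
      (proj₂ u) (proj₂ v) (proj₂ w) (proj₂ (∧-true {edge K4m (proj₁ u) (proj₁ v) (proj₁ w)} e))
    where
    χ : Fin 7 → A
    χ = lookup (v₁ ∷ v₂ ∷ v₃ ∷ v₄ ∷ v₅ ∷ v₆ ∷ v₇ ∷ [])

-- Supersaturation

∑³ : ∀ {n} → (Fin n → Fin n → Fin n → ℕ) → ℕ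
∑³ f = ∑ λ x → ∑ λ y → ∑ λ z → f x y z

∑³-cong : ∀ {n} {f g : Fin n → Fin n → Fin n → ℕ} → (∀ x y z → f x y z ≡ g x y z) → ∑³ f ≡ ∑³ g
∑³-cong h = ∑-cong λ x → ∑-cong λ y → ∑-cong λ z → h x y z

∑³-mono : ∀ {n} {f g : Fin n → Fin n → Fin n → ℕ} → (∀ x y z → f x y z ≤ g x y z) → ∑³ f ≤ ∑³ g
∑³-mono h = ∑-mono λ x → ∑-mono λ y → ∑-mono λ z → h x y z

∑³-+ : ∀ {n} (f g : Fin n → Fin n → Fin n → ℕ) → ∑³ (λ x y z → f x y z + g x y z) ≡ ∑³ f + ∑³ g
∑³-+ f g = trans (∑-cong λ x → trans (∑-cong λ y → ∑-+ (f x y) (g x y)) (∑-+ (λ y → ∑ (f x y)) (λ y → ∑ (g x y))))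
  (∑-+ (λ x → ∑ λ y → ∑ (f x y)) (λ x → ∑ λ y → ∑ (g x y)))

∑³-*ˡ : ∀ {n} c (f : Fin n → Fin n → Fin n → ℕ) → ∑³ (λ x y z → c * f x y z) ≡ c * ∑³ f
∑³-*ˡ c f = trans (∑-cong λ x → trans (∑-cong λ y → ∑-*ˡ c (f x y)) (∑-*ˡ c (λ y → ∑ (f x y))))
  (∑-*ˡ c (λ x → ∑ λ y → ∑ (f x y)))

∑³-const : ∀ n c → ∑³ {n} (λ _ _ _ → c) ≡ n ^ 3 * c
∑³-const n c = trans (trans (∑-cong {n} λ _ → trans (∑-cong {n} λ _ → ∑-const n c) (∑-const n (n * c))) (∑-const n (n * (n * c)))) (assoc n c)
  where
  assoc : ∀ n c → n * (n * (n * c)) ≡ n * (n * (n * 1)) * c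
  assoc = solve-∀

∑ᵛ-∑³-comm : ∀ {n k} m (f : Vec (Fin n) m → Fin k → Fin k → Fin k → ℕ) →
             ∑ᵛ m (λ v → ∑³ (f v)) ≡ ∑³ λ x y z → ∑ᵛ m λ v → f v x y z
∑ᵛ-∑³-comm m f = trans (∑ᵛ-∑-comm m λ v x → ∑ λ y → ∑ (f v x y))
  (∑-cong λ x → trans (∑ᵛ-∑-comm m λ v y → ∑ (f v x y)) (∑-cong λ y → ∑ᵛ-∑-comm m λ v z → f v x y z))

edges : ∀ {A : Set} {n} → Ternary A → (Fin n → A) → ℕ
edges E f = ∑³ λ i j l → ind (E (f i) (f j) (f l))

pullback-loopless3 : ∀ {A B : Set} {E : Ternary A} (f : B → A) → IsLoopless3 E → IsLoopless3 λ x y z → E (f x) (f y) (f z)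
pullback-loopless3 f E-3 = record { swap₁₂ = swap₁₂ ; swap₂₃ = swap₂₃ ; loopless = loopless }
  where open IsLoopless3 E-3

cong₃ : ∀ {A B C D : Set} (f : A → B → C → D) {a a′ b b′ c c′} → a ≡ a′ → b ≡ b′ → c ≡ c′ → f a b c ≡ f a′ b′ c′
cong₃ f refl refl refl = refl

lookup-insertAt-punchOut : ∀ {A : Set} {m} (v : Vec A m) {i j : Fin (suc m)} (i≢j : i ≢ j) x →
                           lookup (insertAt v i x) j ≡ lookup v (punchOut i≢j)
lookup-insertAt-punchOut v {i} i≢j x = trans (cong (lookup (insertAt v i x)) (sym (punchIn-punchOut i≢j)))
  (Vec.insertAt-punchIn v i x (punchOut i≢j))

-- The coordinates `i`, `j`, `l` are split off one after the other, `punchOut` giving the places of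
-- those still to come; the remaining `m` coordinates are free and contribute `n ^ m`.
marginal : ∀ {n m} (f : Fin n → Fin n → Fin n → ℕ) {i j l : Fin (3 + m)} → i ≢ j → j ≢ l → i ≢ l →
           ∑ᵛ (3 + m) (λ v → f (lookup v i) (lookup v j) (lookup v l)) ≡ n ^ m * ∑³ f
marginal {n} {m} f {i} {j} {l} i≢j j≢l i≢l = begin
  ∑ᵛ (3 + m) (λ v → f (lookup v i) (lookup v j) (lookup v l))
    ≡⟨ ∑ᵛ-insertAt (2 + m) i (λ v → f (lookup v i) (lookup v j) (lookup v l)) ⟩
  ∑ (λ x → ∑ᵛ (2 + m) λ v → f (lookup (insertAt v i x) i) (lookup (insertAt v i x) j) (lookup (insertAt v i x) l))
    ≡⟨ ∑-cong (λ x → ∑ᵛ-cong (2 + m) λ v → cong₂ (λ f y → f y) (cong₂ f (Vec.insertAt-lookup v i x) (lookup-insertAt-punchOut v i≢j x))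
         (lookup-insertAt-punchOut v i≢l x)) ⟩
  ∑ (λ x → ∑ᵛ (2 + m) λ v → f x (lookup v j′) (lookup v l′))
    ≡⟨ ∑-cong (λ x → trans (∑ᵛ-insertAt (1 + m) j′ λ v → f x (lookup v j′) (lookup v l′)) (∑-cong λ y → ∑ᵛ-cong (1 + m) λ v →
         cong₂ (f x) (Vec.insertAt-lookup v j′ y) (lookup-insertAt-punchOut v j′≢l′ y))) ⟩
  ∑ (λ x → ∑ λ y → ∑ᵛ (1 + m) λ v → f x y (lookup v l″))
    ≡⟨ ∑-cong (λ x → ∑-cong λ y → trans (∑ᵛ-insertAt m l″ λ v → f x y (lookup v l″)) (∑-cong λ z →
         trans (∑ᵛ-cong m λ v → cong (f x y) (Vec.insertAt-lookup v l″ z)) (∑ᵛ-const m (f x y z)))) ⟩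
  ∑³ (λ x y z → n ^ m * f x y z)
    ≡⟨ ∑³-*ˡ (n ^ m) f ⟩
  n ^ m * ∑³ f ∎
  where
  open ≡-Reasoning
  j′ = punchOut i≢j
  l′ = punchOut i≢l
  j′≢l′ : j′ ≢ l′
  j′≢l′ eq = j≢l (Fin.punchOut-injective i≢j i≢l eq)
  l″ = punchOut j′≢l′

-- Vertices are sampled with repetition. Index triples with distinct entries see the exact edge
-- density by `marginal`; at most `3m²` triples have a coincidence, and each is charged the trivial
-- bound.
edges-average : ∀ {n} m → 3 ≤ m → (E : Ternary (Fin n)) →
  m ^ 3 * (n ^ m * edges E id) ≤
  n ^ 3 * ∑ᵛ m (λ v → edges E (lookup v)) + 3 * (m * m) * (n ^ m * n ^ 3)
edges-average {n} m@(suc (suc (suc m′))) (s≤s (s≤s (s≤s z≤n))) E = begin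
  m ^ 3 * (n ^ m * O) ≡⟨ ∑³-const m (n ^ m * O) ⟨
  ∑³ {m} (λ _ _ _ → n ^ m * O) ≤⟨ ∑³-mono pointwise ⟩
  ∑³ (λ i j l → n ^ 3 * ∑ᵛ m (λ v → ind (E (lookup v i) (lookup v j) (lookup v l))) + B * (δ i j + δ j l + δ i l))
    ≡⟨ trans (∑³-+ _ _) (cong₂ _+_ (∑³-*ˡ (n ^ 3) _) (trans (∑³-*ˡ B _) (cong (B *_) coincidences))) ⟩
  n ^ 3 * ∑³ (λ i j l → ∑ᵛ m (λ v → ind (E (lookup v i) (lookup v j) (lookup v l)))) + B * (3 * (m * m))
    ≡⟨ cong₂ (λ x y → n ^ 3 * x + y) (sym (∑ᵛ-∑³-comm m λ v i j l → ind (E (lookup v i) (lookup v j) (lookup v l)))) (*-comm B (3 * (m * m))) ⟩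
  n ^ 3 * ∑ᵛ m (λ v → edges E (lookup v)) + 3 * (m * m) * B ∎
  where
  open ≤-Reasoning
  O = edges E id
  B = n ^ m * n ^ 3
  O≤ : O ≤ n ^ 3
  O≤ = ≤-trans (∑³-mono λ x y z → ind≤1 (E x y z)) (≤-reflexive (trans (∑³-const n 1) (*-identityʳ _)))

  row : ∀ i → ∑ (δ i) ≡ 1
  row i = trans (∑-cong λ j → sym (*-identityʳ (δ i j))) (∑-δ i λ _ → 1)

  coincidences : ∑³ (λ i j l → δ i j + δ j l + δ i l) ≡ 3 * (m * m)
  coincidences = trans (∑³-+ _ _) (trans (cong₂ _+_ (trans (∑³-+ _ _) (cong₂ _+_ first second)) third) (sum3 (m * m)))
    where
    sum3 : ∀ a → a + a + a ≡ 3 * a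
    sum3 = solve-∀
    first : ∑³ {m} (λ i j l → δ i j) ≡ m * m
    first = trans (∑-cong λ i → trans (∑-cong λ j → ∑-const m (δ i j)) (trans (∑-*ˡ m (δ i)) (trans (cong (m *_) (row i)) (*-identityʳ m))))
      (∑-const m m)
    second : ∑³ {m} (λ i j l → δ j l) ≡ m * m
    second = trans (∑-cong {m} λ i → trans (∑-cong λ j → row j) (trans (∑-const m 1) (*-identityʳ m))) (∑-const m m)
    third : ∑³ {m} (λ i j l → δ i l) ≡ m * m
    third = trans (∑-cong λ i → trans (∑-cong {m} λ j → row i) (trans (∑-const m 1) (*-identityʳ m))) (∑-const m m)

  degenerate : ∀ a d → 1 ≤ d → n ^ m * O ≤ a + B * d
  degenerate a d 1≤d = ≤-trans (*-monoʳ-≤ (n ^ m) O≤) (≤-trans (≤-trans (≤-reflexive (sym (*-identityʳ B))) (*-monoʳ-≤ B 1≤d)) (m≤n+m _ a))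

  pointwise : ∀ i j l → n ^ m * O ≤
    n ^ 3 * ∑ᵛ m (λ v → ind (E (lookup v i) (lookup v j) (lookup v l))) + B * (δ i j + δ j l + δ i l)
  pointwise i j l with i ≟ j | j ≟ l | i ≟ l
  ... | yes _ | _ | _ = degenerate _ _ (s≤s z≤n)
  ... | no _ | yes _ | _ = degenerate _ _ (s≤s z≤n)
  ... | no _ | no _ | yes _ = degenerate _ _ (s≤s z≤n)
  ... | no i≢j | no j≢l | no i≢l = ≤-trans (≤-reflexive (begin-equality
    n ^ (3 + m′) * O ≡⟨ cong (_* O) (^-distribˡ-+-* n 3 m′) ⟩
    n ^ 3 * n ^ m′ * O ≡⟨ *-assoc (n ^ 3) (n ^ m′) O ⟩
    n ^ 3 * (n ^ m′ * O) ≡⟨ cong (n ^ 3 *_) (marginal (λ x y z → ind (E x y z)) i≢j j≢l i≢l) ⟨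
    n ^ 3 * ∑ᵛ (3 + m′) (λ v → ind (E (lookup v i) (lookup v j) (lookup v l))) ∎)) (m≤m+n _ _)

-- Here `A = n^m` counts the samples, `X = n³`, `O` counts ordered edges, `S` sums the edges over
-- all samples and `C` counts pairs of a sample and a homomorphism into it. An edge density of
-- `2/9 + 8/(9k)` leaves a surplus of `8MA` over what samples without homomorphisms could carry; the
-- lower order terms use up at most `3MA` of it.
dense-homs : ∀ k m A X O S C → 0 < X → 0 < m → 12 * k ≤ m →
  m ^ 3 * (A * O) ≤ X * S + 3 * (m * m) * (A * X) →
  9 * S ≤ A * (m * suc m * suc (2 * m)) + 9 * (m ^ 3 * C) →
  (2 * k + 8) * X ≤ 9 * k * O →
  A ≤ 9 * k * C
dense-homs k m A X O S C X>0 m>0 12k≤m average-O upper-S dense =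
  *-cancelˡ-≤ M {{>-nonZero M>0}} (≤-trans (≤-trans (m≤m+n (M * A) (4 * (M * A))) (≤-reflexive (five (M * A)))) (+-cancelˡ-≤ (3 * (M * A)) _ _ final))
  where
  open ≤-Reasoning
  M = m ^ 3
  M>0 : 0 < M
  M>0 = m^n>0 m {{>-nonZero m>0}} 3

  five : ∀ a → a + 4 * a ≡ 5 * a
  five = solve-∀

  without-X : (2 * k + 8) * (M * A) ≤ 9 * k * S + 27 * k * (m * m * A)
  without-X = *-cancelˡ-≤ X {{>-nonZero X>0}} (begin
    X * ((2 * k + 8) * (M * A)) ≡⟨ e₁ X (2 * k + 8) (M * A) ⟩
    M * A * ((2 * k + 8) * X) ≤⟨ *-monoʳ-≤ (M * A) dense ⟩
    M * A * (9 * k * O) ≡⟨ e₂ M A k O ⟩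
    9 * k * (M * (A * O)) ≤⟨ *-monoʳ-≤ (9 * k) average-O ⟩
    9 * k * (X * S + 3 * (m * m) * (A * X)) ≡⟨ e₃ k X S (m * m) A ⟩
    X * (9 * k * S + 27 * k * (m * m * A)) ∎)
    where
    e₁ : ∀ X b a → X * (b * a) ≡ a * (b * X)
    e₁ = solve-∀
    e₂ : ∀ M A k O → M * A * (9 * k * O) ≡ 9 * k * (M * (A * O))
    e₂ = solve-∀
    e₃ : ∀ k X S m A → 9 * k * (X * S + 3 * m * (A * X)) ≡ X * (9 * k * S + 27 * k * (m * A))
    e₃ = solve-∀

  cubic≤ : m * suc m * suc (2 * m) ≤ 2 * M + 4 * (m * m)
  cubic≤ = begin
    m * suc m * suc (2 * m) ≡⟨ e m ⟩
    2 * M + 3 * (m * m) + m * 1 ≤⟨ +-monoʳ-≤ (2 * M + 3 * (m * m)) (*-monoʳ-≤ m m>0) ⟩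
    2 * M + 3 * (m * m) + m * m ≡⟨ e′ M (m * m) ⟩
    2 * M + 4 * (m * m) ∎
    where
    e : ∀ m → m * suc m * suc (2 * m) ≡ 2 * (m * (m * (m * 1))) + 3 * (m * m) + m * 1
    e = solve-∀
    e′ : ∀ a b → 2 * a + 3 * b + b ≡ 2 * a + 4 * b
    e′ = solve-∀

  -- `31 = 27 + 4`: the first part comes from coincidences in the sampling, the second from the
  -- lower order terms of the Lagrangian bound.
  without-S : 8 * (M * A) ≤ 31 * k * (m * m * A) + 9 * k * (M * C)
  without-S = +-cancelˡ-≤ (2 * k * (M * A)) _ _ (begin
    2 * k * (M * A) + 8 * (M * A) ≡⟨ *-distribʳ-+ (M * A) (2 * k) 8 ⟨
    (2 * k + 8) * (M * A) ≤⟨ without-X ⟩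
    9 * k * S + 27 * k * (m * m * A) ≡⟨ cong (_+ 27 * k * (m * m * A)) (e₁ k S) ⟩
    k * (9 * S) + 27 * k * (m * m * A)
      ≤⟨ +-monoˡ-≤ (27 * k * (m * m * A)) (*-monoʳ-≤ k (≤-trans upper-S (+-monoˡ-≤ (9 * (M * C)) (*-monoʳ-≤ A cubic≤)))) ⟩
    k * (A * (2 * M + 4 * (m * m)) + 9 * (M * C)) + 27 * k * (m * m * A) ≡⟨ e₂ k A M (m * m) C ⟩
    2 * k * (M * A) + (31 * k * (m * m * A) + 9 * k * (M * C)) ∎)
    where
    e₁ : ∀ k S → 9 * k * S ≡ k * (9 * S)
    e₁ = solve-∀
    e₂ : ∀ k A M m C → k * (A * (2 * M + 4 * m) + 9 * (M * C)) + 27 * k * (m * A) ≡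
                       2 * k * (M * A) + (31 * k * (m * A) + 9 * k * (M * C))
    e₂ = solve-∀

  -- `31k` is rounded up to `36k`, so that `12k ≤ m` turns `36k * m²` into `3m³`.
  final : 3 * (M * A) + 5 * (M * A) ≤ 3 * (M * A) + M * (9 * k * C)
  final = begin
    3 * (M * A) + 5 * (M * A) ≡⟨ *-distribʳ-+ (M * A) 3 5 ⟨
    8 * (M * A) ≤⟨ without-S ⟩
    31 * k * (m * m * A) + 9 * k * (M * C) ≤⟨ +-monoˡ-≤ (9 * k * (M * C)) (m≤m+n _ (5 * k * (m * m * A))) ⟩
    31 * k * (m * m * A) + 5 * k * (m * m * A) + 9 * k * (M * C) ≡⟨ e₁ k m A M C ⟩
    3 * (12 * k * (m * m * A)) + M * (9 * k * C) ≤⟨ +-monoˡ-≤ _ (*-monoʳ-≤ 3 (*-monoˡ-≤ (m * m * A) 12k≤m)) ⟩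
    3 * (m * (m * m * A)) + M * (9 * k * C) ≡⟨ cong (λ z → 3 * z + M * (9 * k * C)) (e₂ m A) ⟩
    3 * (M * A) + M * (9 * k * C) ∎
    where
    e₁ : ∀ k m A M C → 31 * k * (m * m * A) + 5 * k * (m * m * A) + 9 * k * (M * C) ≡ 3 * (12 * k * (m * m * A)) + M * (9 * k * C)
    e₁ = solve-∀
    e₂ : ∀ m A → m * (m * m * A) ≡ m * (m * (m * 1)) * A
    e₂ = solve-∀

module Supersaturation {r : ℕ} (R : Ternary (Fin r))
  (edges-without-hom : ∀ {k} {E : Ternary (Fin k)} → IsLoopless3 E → (∀ χ → ¬ Hom R E χ) →
                       9 * edges E id ≤ k * suc k * suc (2 * k)) where

  Contains : ∀ {n} → Ternary (Fin n) → Set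
  Contains {n} E = Σ (Fin r → Fin n) λ φ → Injective _≡_ _≡_ φ × Hom R E φ

  module _ {n m : ℕ} (E : Ternary (Fin n)) where

    Eᵥ : Vec (Fin n) m → Ternary (Fin m)
    Eᵥ v i j l = E (lookup v i) (lookup v j) (lookup v l)

    Hom? : (ψ : Vec (Fin m) r) (v : Vec (Fin n) m) → Dec (Hom R (Eᵥ v) (lookup ψ))
    Hom? ψ v = all? λ a → all? λ b → all? λ c →
      (R a b c Bool.≟ true) →-dec (Eᵥ v (lookup ψ a) (lookup ψ b) (lookup ψ c) Bool.≟ true)

    hom : Vec (Fin m) r → Vec (Fin n) m → Bool
    hom ψ v = ⌊ Hom? ψ v ⌋

    hom-sound : ∀ ψ v → hom ψ v ≡ true → Hom R (Eᵥ v) (lookup ψ)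
    hom-sound ψ v eq with Hom? ψ v
    ... | yes h = h

    hom-complete : ∀ ψ v → Hom R (Eᵥ v) (lookup ψ) → hom ψ v ≡ true
    hom-complete ψ v h with Hom? ψ v
    ... | yes _ = refl
    ... | no ¬h = ⊥-elim (¬h h)

  -- The samples on which a fixed `ψ` is a homomorphism form a dense set of `m`-tuples. The box
  -- theorem gives parts of size `r`, one private vertex for each vertex of `R`. So `u` can go to
  -- the copy numbered `u` in part `ψ u`, and the homomorphism becomes injective.
  blow-up : ∀ m q → ∃[ N ] ∀ n → N ≤ n → (E : Ternary (Fin n)) → IsLoopless3 E → (ψ : Vec (Fin m) r) →
            n ^ m ≤ q * ∑ᵛ m (λ v → ind (hom E ψ v)) → Contains E
  blow-up m q with box m q 0 r
  ... | N , b = N , λ n n≥N E E-3 ψ dense → contains n E E-3 ψ (b n n≥N (hom E ψ) dense [] z≤n)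
    where
    contains : ∀ n (E : Ternary (Fin n)) → IsLoopless3 E → (ψ : Vec (Fin m) r) → (Σ (Fin m → Fin r → Fin n) λ g →
      (∀ i j a b → g i a ≡ g j b → i ≡ j × a ≡ b) × (∀ i a → g i a ∉ []) ×
      (∀ s → hom E ψ (tabulate λ i → g i (s i)) ≡ true)) → Contains E
    contains n E E-3 ψ (g , injective , _ , transversal) =
      φ , (λ {u} {v} eq → proj₂ (injective (lookup ψ u) (lookup ψ v) u v eq)) , φ-hom
      where
      φ : Fin r → Fin n
      φ u = g (lookup ψ u) u

      transversal-hom : ∀ s → Hom R (λ i j l → E (g i (s i)) (g j (s j)) (g l (s l))) (lookup ψ)
      transversal-hom s u v w e = trans
        (cong₃ E (sym (entry (lookup ψ u))) (sym (entry (lookup ψ v))) (sym (entry (lookup ψ w))))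
        (hom-sound E ψ (tabulate λ i → g i (s i)) (transversal s) u v w e)
        where
        entry : ∀ i → lookup (tabulate λ i → g i (s i)) i ≡ g i (s i)
        entry = Vec.lookup∘tabulate λ i → g i (s i)

      φ-hom : Hom R E φ
      φ-hom u v w e = trans
        (cong₃ E (cong (g (lookup ψ u)) (sym s-u)) (cong (g (lookup ψ v)) (sym s-v)) (cong (g (lookup ψ w)) (sym s-w)))
        (transversal-hom s u v w e)
        where
        -- A single transversal must pass through the images of `u`, `v` and `w`, so these have to
        -- lie in different parts. The constant transversal shows this: it maps the edge `u v w` to
        -- an edge, whose ends are distinct.
        module E₀ = IsLoopless3 (pullback-loopless3 (λ i → g i u) E-3)
        e₀ = transversal-hom (λ _ → u) u v w e

        s : Fin m → Fin r
        s i = if ⌊ i ≟ lookup ψ u ⌋ then u else if ⌊ i ≟ lookup ψ v ⌋ then v else w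

        s-u : s (lookup ψ u) ≡ u
        s-u with lookup ψ u ≟ lookup ψ u
        ... | yes _ = refl
        ... | no ne = ⊥-elim (ne refl)

        s-v : s (lookup ψ v) ≡ v
        s-v with lookup ψ v ≟ lookup ψ u | lookup ψ v ≟ lookup ψ v
        ... | yes eq | _ = ⊥-elim (E₀.≢₁₂ {_} {_} {lookup ψ w} e₀ (sym eq))
        ... | no _ | yes _ = refl
        ... | no _ | no ne = ⊥-elim (ne refl)

        s-w : s (lookup ψ w) ≡ w
        s-w with lookup ψ w ≟ lookup ψ u | lookup ψ w ≟ lookup ψ v
        ... | yes eq | _ = ⊥-elim (E₀.≢₁₃ {_} {lookup ψ v} {_} e₀ (sym eq))
        ... | no _ | yes eq = ⊥-elim (E₀.≢₂₃ {lookup ψ u} {_} {_} e₀ (sym eq))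
        ... | no _ | no _ = refl

  Eᵥ-loopless3 : ∀ {n m} (E : Ternary (Fin n)) → IsLoopless3 E → (v : Vec (Fin n) m) → IsLoopless3 (Eᵥ E v)
  Eᵥ-loopless3 E E-3 v = pullback-loopless3 (lookup v) E-3

  homs : ∀ {n m} (E : Ternary (Fin n)) → Vec (Fin n) m → ℕ
  homs E v = ∑ᵛ r λ ψ → ind (hom E ψ v)

  -- A sample that receives no homomorphism obeys the Lagrangian bound. Any other sample has
  -- `homs E v` at least 1, and the trivial bound `m³` is charged to it.
  edges-homs : ∀ {n m} (E : Ternary (Fin n)) → IsLoopless3 E → (v : Vec (Fin n) m) →
               9 * edges E (lookup v) ≤ m * suc m * suc (2 * m) + 9 * (m ^ 3 * homs E v)
  edges-homs {m = m} E E-3 v with homs E v in eq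
  ... | suc h = ≤-trans (*-monoʳ-≤ 9 (begin
      edges E (lookup v) ≤⟨ ∑³-mono (λ i j l → ind≤1 (Eᵥ E v i j l)) ⟩
      ∑³ {m} (λ _ _ _ → 1) ≡⟨ ∑³-const m 1 ⟩
      m ^ 3 * 1 ≤⟨ *-monoʳ-≤ (m ^ 3) (s≤s z≤n) ⟩
      m ^ 3 * suc h ∎)) (m≤n+m (9 * (m ^ 3 * suc h)) (m * suc m * suc (2 * m)))
    where open ≤-Reasoning
  ... | zero = ≤-trans (edges-without-hom (Eᵥ-loopless3 E E-3 v) none) (m≤m+n (m * suc m * suc (2 * m)) (9 * (m ^ 3 * 0)))
    where
    none : ∀ χ → ¬ Hom R (Eᵥ E v) χ
    none χ h = <⇒≱ (s≤s z≤n) (begin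
      1 ≡⟨ cong ind (hom-complete E ψ v h′) ⟨
      ind (hom E ψ v) ≤⟨ termᵛ≤∑ᵛ r (λ ψ → ind (hom E ψ v)) ψ ⟩
      homs E v ≡⟨ eq ⟩
      0 ∎)
      where
      open ≤-Reasoning
      ψ : Vec (Fin m) r
      ψ = tabulate χ
      h′ : Hom R (Eᵥ E v) (lookup ψ)
      h′ a b c e = trans (cong₃ (Eᵥ E v) (Vec.lookup∘tabulate χ a) (Vec.lookup∘tabulate χ b) (Vec.lookup∘tabulate χ c)) (h a b c e)

  -- There are `m ^ r` candidate maps `ψ`, so some `ψ` is a homomorphism into at least a
  -- `1/(m^r * 9k)` fraction of the samples, and `blow-up` applies to it.
  contains-of-dense : ∀ k m → 3 ≤ m → 12 * k ≤ m → ∃[ N ] ∀ n → N ≤ n → (E : Ternary (Fin n)) → IsLoopless3 E →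
                      (2 * k + 8) * n ^ 3 ≤ 9 * k * edges E id → Contains E
  contains-of-dense k m 3≤m 12k≤m with blow-up m (m ^ r * (9 * k))
  ... | N , embed = suc N , λ n N<n E E-3 dense → result n N<n E E-3 dense
    where
    m>0 : 0 < m
    m>0 = ≤-trans (s≤s z≤n) 3≤m

    copies : ∀ {n} → Ternary (Fin n) → Vec (Fin m) r → ℕ
    copies E ψ = ∑ᵛ m λ v → ind (hom E ψ v)

    sampled : ∀ {n} → Ternary (Fin n) → Vec (Fin n) m → ℕ
    sampled E v = edges E (lookup v)

    upper : ∀ n (E : Ternary (Fin n)) → IsLoopless3 E →
            9 * ∑ᵛ m (sampled E) ≤ n ^ m * (m * suc m * suc (2 * m)) + 9 * (m ^ 3 * ∑ᵛ r (copies E))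
    upper n E E-3 = begin
      9 * ∑ᵛ m (sampled E) ≡⟨ ∑ᵛ-*ˡ m 9 (sampled E) ⟨
      ∑ᵛ m (λ v → 9 * sampled E v) ≤⟨ ∑ᵛ-mono m (edges-homs E E-3) ⟩
      ∑ᵛ m (λ v → c + 9 * (m ^ 3 * homs E v)) ≡⟨ ∑ᵛ-+ m (λ _ → c) (λ v → 9 * (m ^ 3 * homs E v)) ⟩
      ∑ᵛ m (λ _ → c) + ∑ᵛ m (λ v → 9 * (m ^ 3 * homs E v)) ≡⟨ cong₂ _+_ (∑ᵛ-const m c) step ⟩
      n ^ m * c + 9 * (m ^ 3 * ∑ᵛ r (copies E)) ∎
      where
      open ≤-Reasoning
      c = m * suc m * suc (2 * m)
      step : ∑ᵛ m (λ v → 9 * (m ^ 3 * homs E v)) ≡ 9 * (m ^ 3 * ∑ᵛ r (copies E))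
      step = trans (∑ᵛ-*ˡ m 9 λ v → m ^ 3 * homs E v) (cong (9 *_) (trans (∑ᵛ-*ˡ m (m ^ 3) (homs E))
        (cong (m ^ 3 *_) (∑ᵛ-comm m r λ v ψ → ind (hom E ψ v)))))

    result : ∀ n → N < n → (E : Ternary (Fin n)) → IsLoopless3 E → (2 * k + 8) * n ^ 3 ≤ 9 * k * edges E id → Contains E
    result n N<n E E-3 dense = embed n (<⇒≤ N<n) E E-3 (proj₁ popular) (proj₂ popular)
      where
      open ≤-Reasoning
      total : n ^ m ≤ 9 * k * ∑ᵛ r (copies E)
      total = dense-homs k m (n ^ m) (n ^ 3) (edges E id) (∑ᵛ m (sampled E)) (∑ᵛ r (copies E))
        (m^n>0 n {{>-nonZero (≤-<-trans z≤n N<n)}} 3) m>0 12k≤m (edges-average m 3≤m E) (upper n E E-3) dense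

      popular : ∃[ ψ ] n ^ m ≤ m ^ r * (9 * k) * copies E ψ
      popular = averageᵛ r (λ ψ → m ^ r * (9 * k) * copies E ψ) (n ^ m) m>0 (begin
        m ^ r * n ^ m ≤⟨ *-monoʳ-≤ (m ^ r) total ⟩
        m ^ r * (9 * k * ∑ᵛ r (copies E)) ≡⟨ *-assoc (m ^ r) (9 * k) (∑ᵛ r (copies E)) ⟨
        m ^ r * (9 * k) * ∑ᵛ r (copies E) ≡⟨ ∑ᵛ-*ˡ r (m ^ r * (9 * k)) (copies E) ⟨
        ∑ᵛ r (λ ψ → m ^ r * (9 * k) * copies E ψ) ∎)

-- The pattern Γ

loopless-edge : ∀ {n} (E : Graph3 n) → IsLoopless3 E → ∀ x y z → edge E x y z ≡ E x y z
loopless-edge E E-3 x y z = ≡true-cong (edge-hom E-3 E id (λ _ _ _ → id) x y z) λ e →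
  edge-intro E x y z (≢₁₂ {x} {y} {z} e) (≢₂₃ {x} {y} {z} e) (≢₁₃ {x} {y} {z} e) (cong (_∨ (E x z y ∨ E y x z ∨ E y z x ∨ E z x y ∨ E z y x)) e)
  where open IsLoopless3 E-3

-- The classes 0, 1, 2, 3 are the two-bit numbers; 4 is joined to the pairs that differ in the low bit,
-- 5 to the pairs that differ in the high bit.
Γ : Graph3 6
Γ = listed ((0 , 1 , 4) ∷ (0 , 3 , 4) ∷ (1 , 2 , 4) ∷ (2 , 3 , 4) ∷
            (0 , 2 , 5) ∷ (0 , 3 , 5) ∷ (1 , 2 , 5) ∷ (1 , 3 , 5) ∷ [])

record Link {k : ℕ} (u : VF) (us : Vec VF k) : Set where
  constructor link
  field
    i j : Fin k
    isEdge : edgeF u (lookup us i) (lookup us j) ≡ true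

-- An order of some vertices of F, each with its edges back to the vertices before it, the most
-- recent at the head of `us`. These edges are found once, so that the search below evaluates only Γ
-- and never `edgeF`.
data Schedule : ∀ {k} → Vec VF k → Set where
  [] : ∀ {k} {us : Vec VF k} → Schedule us
  _∷_ : ∀ {k} {us : Vec VF k} {u} → List (Link u us) → Schedule (u ∷ us) → Schedule us

links : ∀ {k} u (us : Vec VF k) → List (Link u us)
links {k} u us = List.concatMap (λ i → List.mapMaybe (λ j → try i j) (allFin k)) (allFin k)
  where
  try : ∀ i j → Maybe (Link u us)
  try i j with i Fin.<? j | edgeF u (lookup us i) (lookup us j) in eq
  ... | yes _ | true = just (link i j eq)
  ... | _ | _ = nothing

schedule : List VF → ∀ {k} (us : Vec VF k) → Schedule us
schedule [] us = []
schedule (v ∷ vs) us = links v us ∷ schedule vs (v ∷ us)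

violates : ∀ {k} {u} {us : Vec VF k} → List (Link u us) → Fin 6 → Vec (Fin 6) k → Bool
violates ls x c = any (λ l → not (edge Γ x (lookup c (Link.i l)) (lookup c (Link.j l)))) ls

-- Backtracking over the colours of the scheduled vertices: every colour must break an edge at once
-- or lead to a dead end later. Reaching the end of the schedule means that a colouring has
-- survived, hence `false`.
refute : ∀ {k} {us : Vec VF k} → Schedule us → Vec (Fin 6) k → Bool
refute [] c = false
refute (ls ∷ s) c = all (λ x → violates ls x c ∨ refute s (x ∷ c)) (allFin 6)

violates-sound : ∀ {k u} {us : Vec VF k} (χ : VF → Fin 6) (ls : List (Link u us)) → Hom edgeF (edge Γ) χ →
                 violates ls (χ u) (Vec.map χ us) ≡ true → ⊥
violates-sound {u = u} {us} χ (link i j isEdge ∷ ls) hom v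
  rewrite Vec.lookup-map i χ us | Vec.lookup-map j χ us | hom u (lookup us i) (lookup us j) isEdge
  = violates-sound χ ls hom v

all-sound : ∀ {A : Set} (p : A → Bool) xs → all p xs ≡ true → ∀ {x} → x ∈ xs → p x ≡ true
all-sound p (x ∷ xs) h (here refl) = proj₁ (∧-true h)
all-sound p (x ∷ xs) h (there x∈) = all-sound p xs (proj₂ (∧-true {p x} h)) x∈

refute-sound : ∀ {k} {us : Vec VF k} (s : Schedule us) (χ : VF → Fin 6) → refute s (Vec.map χ us) ≡ true → ¬ Hom edgeF (edge Γ) χ
refute-sound {us = us} (_∷_ {u = u} ls s) χ h hom
  with ∨-true {violates ls (χ u) (Vec.map χ us)}
         (all-sound (λ x → violates ls x (Vec.map χ us) ∨ refute s (x ∷ Vec.map χ us)) (allFin 6) h (∈-allFin (χ u)))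
... | inj₁ v = violates-sound χ ls hom v
... | inj₂ r = refute-sound s χ r hom

-- These 13 vertices of F already admit no homomorphism to Γ.
no-FHom-Γ : ∀ χ → ¬ Hom edgeF (edge Γ) χ
no-FHom-Γ χ = refute-sound (schedule order []) χ refl
  where
  order : List VF
  order = (# 0 , # 0) ∷ (# 1 , # 3) ∷ (# 0 , # 4) ∷ (# 2 , # 2) ∷ (# 3 , # 1) ∷ (# 2 , # 6) ∷ (# 0 , # 3) ∷
          (# 3 , # 4) ∷ (# 0 , # 1) ∷ (# 3 , # 0) ∷ (# 2 , # 0) ∷ (# 0 , # 2) ∷ (# 0 , # 5) ∷ []

-- Unordered triples

∑³-swap₁₂ : ∀ {n} (f : Fin n → Fin n → Fin n → ℕ) → ∑³ (λ x y z → f y x z) ≡ ∑³ f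
∑³-swap₁₂ f = ∑-comm λ x y → ∑ (f y x)

∑³-swap₂₃ : ∀ {n} (f : Fin n → Fin n → Fin n → ℕ) → ∑³ (λ x y z → f x z y) ≡ ∑³ f
∑³-swap₂₃ f = ∑-cong λ x → ∑-comm λ y z → f x z y

⌊<?⌋-true : ∀ {n} {x y : Fin n} → x <ᶠ y → ⌊ x Fin.<? y ⌋ ≡ true
⌊<?⌋-true {x = x} {y} x<y with x Fin.<? y
... | yes _ = refl
... | no x≮y = ⊥-elim (x≮y x<y)

⌊<?⌋-false : ∀ {n} {x y : Fin n} → ¬ x <ᶠ y → ⌊ x Fin.<? y ⌋ ≡ false
⌊<?⌋-false {x = x} {y} x≮y with x Fin.<? y
... | yes x<y = ⊥-elim (x≮y x<y)
... | no _ = refl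

module _ {n : ℕ} (P : Ternary (Fin n)) (P-3 : IsLoopless3 P) where
  open IsLoopless3 P-3

  increasing : Fin n → Fin n → Fin n → ℕ
  increasing x y z = ind (⌊ x Fin.<? y ⌋ ∧ ⌊ y Fin.<? z ⌋ ∧ P x y z)

  countTriples≡∑³ : countTriples P ≡ ∑³ increasing
  countTriples≡∑³ = trans (listSum≡∑ _) (∑-cong λ x → trans (listSum≡∑ _) (∑-cong λ y → listSum≡∑ (increasing x y)))

  -- The entries of an edge are distinct, so exactly one of its six orders is increasing; if there
  -- is no edge, all six terms vanish.
  permutations : ∀ x y z → ind (P x y z) ≡
    increasing x y z + increasing x z y + increasing y x z + increasing y z x + increasing z x y + increasing z y x
  permutations x y z
    rewrite ≡true-cong (swap₂₃ {x} {z} {y}) swap₂₃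
          | ≡true-cong (swap₁₂ {y} {x} {z}) swap₁₂
          | ≡true-cong (swap₁₂ ∘ swap₂₃ {y} {z} {x}) (swap₂₃ ∘ swap₁₂)
          | ≡true-cong (swap₂₃ ∘ swap₁₂ {z} {x} {y}) (swap₁₂ ∘ swap₂₃)
          | ≡true-cong (swap₁₃ {z} {y} {x}) swap₁₃
    with P x y z in eq
  ... | false = sym (vanish ⌊ x Fin.<? y ⌋ ⌊ y Fin.<? z ⌋ ⌊ x Fin.<? z ⌋ ⌊ z Fin.<? y ⌋ ⌊ y Fin.<? x ⌋ ⌊ z Fin.<? x ⌋)
    where
    zero₃ : ∀ a b → ind (a ∧ b ∧ false) ≡ 0
    zero₃ false b = refl
    zero₃ true false = refl
    zero₃ true true = refl
    vanish : ∀ xy yz xz zy yx zx → ind (xy ∧ yz ∧ false) + ind (xz ∧ zy ∧ false) + ind (yx ∧ xz ∧ false) +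
             ind (yz ∧ zx ∧ false) + ind (zx ∧ xy ∧ false) + ind (zy ∧ yx ∧ false) ≡ 0
    vanish xy yz xz zy yx zx rewrite zero₃ xy yz | zero₃ xz zy | zero₃ yx xz | zero₃ yz zx | zero₃ zx xy | zero₃ zy yx = refl
  ... | true with Fin.<-cmp x y | Fin.<-cmp y z | Fin.<-cmp x z
  ... | tri≈ _ x≡y _ | _ | _ = ⊥-elim (≢₁₂ eq x≡y)
  ... | _ | tri≈ _ y≡z _ | _ = ⊥-elim (≢₂₃ eq y≡z)
  ... | _ | _ | tri≈ _ x≡z _ = ⊥-elim (≢₁₃ eq x≡z)
  ... | tri< p _ p′ | tri< q _ q′ | tri> r′ _ r = ⊥-elim (r′ (Fin.<-trans p q))
  ... | tri> p′ _ p | tri> q′ _ q | tri< r _ r′ = ⊥-elim (r′ (Fin.<-trans q p))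
  ... | tri< p _ p′ | tri< q _ q′ | tri< r _ r′
    rewrite ⌊<?⌋-true p | ⌊<?⌋-true q | ⌊<?⌋-true r | ⌊<?⌋-false p′ | ⌊<?⌋-false q′ | ⌊<?⌋-false r′ = refl
  ... | tri< p _ p′ | tri> q′ _ q | tri< r _ r′
    rewrite ⌊<?⌋-true p | ⌊<?⌋-true q | ⌊<?⌋-true r | ⌊<?⌋-false p′ | ⌊<?⌋-false q′ | ⌊<?⌋-false r′ = refl
  ... | tri< p _ p′ | tri> q′ _ q | tri> r′ _ r
    rewrite ⌊<?⌋-true p | ⌊<?⌋-true q | ⌊<?⌋-true r | ⌊<?⌋-false p′ | ⌊<?⌋-false q′ | ⌊<?⌋-false r′ = refl
  ... | tri> p′ _ p | tri< q _ q′ | tri< r _ r′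
    rewrite ⌊<?⌋-true p | ⌊<?⌋-true q | ⌊<?⌋-true r | ⌊<?⌋-false p′ | ⌊<?⌋-false q′ | ⌊<?⌋-false r′ = refl
  ... | tri> p′ _ p | tri< q _ q′ | tri> r′ _ r
    rewrite ⌊<?⌋-true p | ⌊<?⌋-true q | ⌊<?⌋-true r | ⌊<?⌋-false p′ | ⌊<?⌋-false q′ | ⌊<?⌋-false r′ = refl
  ... | tri> p′ _ p | tri> q′ _ q | tri> r′ _ r
    rewrite ⌊<?⌋-true p | ⌊<?⌋-true q | ⌊<?⌋-true r | ⌊<?⌋-false p′ | ⌊<?⌋-false q′ | ⌊<?⌋-false r′ = refl

  six-countTriples : 6 * countTriples P ≡ ∑³ λ x y z → ind (P x y z)
  six-countTriples = sym (begin
    ∑³ (λ x y z → ind (P x y z)) ≡⟨ ∑³-cong permutations ⟩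
    ∑³ (λ x y z → o x y z + o x z y + o y x z + o y z x + o z x y + o z y x)
      ≡⟨ trans (∑³-+ _ _) (cong₂ _+_ (trans (∑³-+ _ _) (cong₂ _+_ (trans (∑³-+ _ _) (cong₂ _+_
           (trans (∑³-+ _ _) (cong₂ _+_ (∑³-+ _ _) refl)) refl)) refl)) refl) ⟩
    ∑³ o + ∑³ (λ x y z → o x z y) + ∑³ (λ x y z → o y x z) + ∑³ (λ x y z → o y z x) +
      ∑³ (λ x y z → o z x y) + ∑³ (λ x y z → o z y x)
      ≡⟨ cong₂ _+_ (cong₂ _+_ (cong₂ _+_ (cong₂ _+_ (cong (∑³ o +_) p₂) p₃) p₄) p₅) p₆ ⟩
    ∑³ o + ∑³ o + ∑³ o + ∑³ o + ∑³ o + ∑³ o ≡⟨ six (∑³ o) ⟩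
    6 * ∑³ o ≡⟨ cong (6 *_) countTriples≡∑³ ⟨
    6 * countTriples P ∎)
    where
    open ≡-Reasoning
    o = increasing
    six : ∀ a → a + a + a + a + a + a ≡ 6 * a
    six = solve-∀
    p₂ = ∑³-swap₂₃ o
    p₃ = ∑³-swap₁₂ o
    p₄ = trans (∑³-swap₁₂ λ x y z → o x z y) p₂
    p₅ = trans (∑³-swap₂₃ λ x y z → o y x z) p₃
    p₆ = trans (∑³-swap₁₂ λ x y z → o z x y) p₅

six-size : ∀ {n} (H : Graph3 n) → 6 * size H ≡ edges (edge H) id
six-size H = six-countTriples (edge H) (edge-loopless3 H)

xor-loopless3 : ∀ {A : Set} {E E′ : Ternary A} → IsLoopless3 E → IsLoopless3 E′ → IsLoopless3 λ x y z → E x y z xor E′ x y z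
xor-loopless3 {E = E} {E′} E-3 E′-3 = record
  { swap₁₂ = λ {x} {y} {z} → trans (sym (cong₂ _xor_ (≡true-cong (E₁.swap₁₂ {x} {y} {z}) E₁.swap₁₂) (≡true-cong (E₂.swap₁₂ {x} {y} {z}) E₂.swap₁₂)))
  ; swap₂₃ = λ {x} {y} {z} → trans (sym (cong₂ _xor_ (≡true-cong (E₁.swap₂₃ {x} {y} {z}) E₁.swap₂₃) (≡true-cong (E₂.swap₂₃ {x} {y} {z}) E₂.swap₂₃)))
  ; loopless = loopless
  }
  where
  module E₁ = IsLoopless3 E-3
  module E₂ = IsLoopless3 E′-3
  loopless : ∀ {x z} → E x x z xor E′ x x z ≡ true → ⊥
  loopless {x} {z} h with E x x z in eq
  ... | true = E₁.loopless eq
  ... | false = E₂.loopless h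

six-dist : ∀ {n} (G H : Graph3 n) → 6 * dist G H ≡ ∑³ λ x y z → ind (edge G x y z xor edge H x y z)
six-dist G H = six-countTriples _ (xor-loopless3 (edge-loopless3 G) (edge-loopless3 H))

two-nC2 : ∀ n → 2 * (n C 2) + n ≡ n * n
two-nC2 zero = refl
two-nC2 (suc n) = begin
  2 * (suc n C 2) + suc n ≡⟨ cong (λ z → 2 * z + suc n) (nCk+nC[k+1]≡[n+1]C[k+1] n 1) ⟨
  2 * (n C 1 + n C 2) + suc n ≡⟨ cong (λ z → 2 * (z + n C 2) + suc n) (nC1≡n n) ⟩
  2 * (n + n C 2) + suc n ≡⟨ e₁ n (n C 2) ⟩
  2 * (n C 2) + n + (2 * n + 1) ≡⟨ cong (_+ (2 * n + 1)) (two-nC2 n) ⟩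
  n * n + (2 * n + 1) ≡⟨ e₂ n ⟩
  suc n * suc n ∎
  where
  open ≡-Reasoning
  e₁ : ∀ n c → 2 * (n + c) + suc n ≡ 2 * c + n + (2 * n + 1)
  e₁ = solve-∀
  e₂ : ∀ n → n * n + (2 * n + 1) ≡ suc n * suc n
  e₂ = solve-∀

-- The expansion of `n(n-1)(n-2)` with the negative term moved to the left, to stay within natural
-- numbers.
six-nC3 : ∀ n → 6 * (n C 3) + 3 * (n * n) ≡ n ^ 3 + 2 * n
six-nC3 zero = refl
six-nC3 (suc n) = begin
  6 * (suc n C 3) + 3 * (suc n * suc n) ≡⟨ cong (λ z → 6 * z + 3 * (suc n * suc n)) (nCk+nC[k+1]≡[n+1]C[k+1] n 2) ⟨
  6 * (n C 2 + n C 3) + 3 * (suc n * suc n) ≡⟨ e₁ n (n C 2) (n C 3) ⟩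
  3 * (2 * (n C 2) + n) + (6 * (n C 3) + 3 * (n * n)) + (3 * n + 3) ≡⟨ cong₂ (λ x y → 3 * x + y + (3 * n + 3)) (two-nC2 n) (six-nC3 n) ⟩
  3 * (n * n) + (n ^ 3 + 2 * n) + (3 * n + 3) ≡⟨ e₂ n ⟩
  suc n ^ 3 + 2 * suc n ∎
  where
  open ≡-Reasoning
  e₁ : ∀ n c d → 6 * (c + d) + 3 * (suc n * suc n) ≡ 3 * (2 * c + n) + (6 * d + 3 * (n * n)) + (3 * n + 3)
  e₁ = solve-∀
  e₂ : ∀ n → 3 * (n * n) + (n * (n * (n * 1)) + 2 * n) + (3 * n + 3) ≡ suc n * (suc n * (suc n * 1)) + 2 * suc n
  e₂ = solve-∀

six-nC3≤ : ∀ n → 6 * (n C 3) ≤ n ^ 3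
six-nC3≤ zero = z≤n
six-nC3≤ n@(suc m) = +-cancelʳ-≤ (3 * (n * n)) _ _ (≤-trans (≤-reflexive (six-nC3 n))
  (+-monoʳ-≤ (n ^ 3) (*-mono-≤ {2} {3} (s≤s (s≤s z≤n)) (m≤m*n n n))))

-- The sum of squared codegrees: Lipschitz in the edit distance and invariant under relabelling

codegree : ∀ {n} → Ternary (Fin n) → Fin n → Fin n → ℕ
codegree E x y = ∑ λ z → ind (E x y z)

codegreeSquares : ∀ {n} → Ternary (Fin n) → ℕ
codegreeSquares E = ∑ λ x → ∑ λ y → codegree E x y * codegree E x y

codegreeSquares-cong : ∀ {n} {E E′ : Ternary (Fin n)} → (∀ x y z → E x y z ≡ E′ x y z) → codegreeSquares E ≡ codegreeSquares E′
codegreeSquares-cong h = ∑-cong λ x → ∑-cong λ y → let eq = ∑-cong (λ z → cong ind (h x y z)) in cong₂ _*_ eq eq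

ind≤ind+xor : ∀ a b → ind a ≤ ind b + ind (a xor b)
ind≤ind+xor true true = s≤s z≤n
ind≤ind+xor true false = s≤s z≤n
ind≤ind+xor false b = z≤n

-- Squaring is `2n`-Lipschitz on numbers up to `n`, and the codegree of a pair changes by at most
-- the number of differing triples through it.
codegreeSquares-lipschitz : ∀ {n} (E E′ : Ternary (Fin n)) →
  codegreeSquares E ≤ codegreeSquares E′ + 2 * n * ∑³ λ x y z → ind (E x y z xor E′ x y z)
codegreeSquares-lipschitz {n} E E′ = begin
  codegreeSquares E ≤⟨ ∑-mono (λ x → ∑-mono λ y → pointwise x y) ⟩
  ∑ (λ x → ∑ λ y → codegree E′ x y * codegree E′ x y + 2 * n * d x y)
    ≡⟨ trans (∑-cong λ x → trans (∑-+ _ _) (cong (∑ (λ y → codegree E′ x y * codegree E′ x y) +_) (∑-*ˡ (2 * n) (d x))))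
         (trans (∑-+ _ _) (cong (codegreeSquares E′ +_) (∑-*ˡ (2 * n) λ x → ∑ (d x)))) ⟩
  codegreeSquares E′ + 2 * n * ∑³ (λ x y z → ind (E x y z xor E′ x y z)) ∎
  where
  open ≤-Reasoning
  d : Fin n → Fin n → ℕ
  d x y = ∑ λ z → ind (E x y z xor E′ x y z)
  bounded : ∀ (E : Ternary (Fin n)) x y → codegree E x y ≤ n
  bounded E x y = ≤-trans (∑-bounded λ z → ind≤1 (E x y z)) (≤-reflexive (*-identityʳ n))
  pointwise : ∀ x y → codegree E x y * codegree E x y ≤ codegree E′ x y * codegree E′ x y + 2 * n * d x y
  pointwise x y = begin
    c * c ≤⟨ *-monoʳ-≤ c c≤ ⟩
    c * (c′ + e) ≡⟨ *-distribˡ-+ c c′ e ⟩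
    c * c′ + c * e ≤⟨ +-mono-≤ (*-monoˡ-≤ c′ c≤) (*-monoˡ-≤ e (bounded E x y)) ⟩
    (c′ + e) * c′ + n * e ≡⟨ arrange c′ e n ⟩
    c′ * c′ + (e * c′ + n * e) ≤⟨ +-monoʳ-≤ (c′ * c′) (+-monoˡ-≤ (n * e) (*-monoʳ-≤ e (bounded E′ x y))) ⟩
    c′ * c′ + (e * n + n * e) ≡⟨ cong (c′ * c′ +_) (double e n) ⟩
    c′ * c′ + 2 * n * e ∎
    where
    c = codegree E x y
    c′ = codegree E′ x y
    e = d x y
    c≤ : c ≤ c′ + e
    c≤ = ≤-trans (∑-mono λ z → ind≤ind+xor (E x y z) (E′ x y z)) (≤-reflexive (∑-+ _ _))
    arrange : ∀ c e n → (c + e) * c + n * e ≡ c * c + (e * c + n * e)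
    arrange = solve-∀
    double : ∀ e n → e * n + n * e ≡ 2 * n * e
    double = solve-∀

-- Each fibre of `σ` has at most one element and the fibres have `n` elements in all, so none is
-- empty and `σ` permutes the terms.
∑-injective : ∀ {n} (σ : Fin n → Fin n) → Injective _≡_ _≡_ σ → (f : Fin n → ℕ) → ∑ (f ∘ σ) ≡ ∑ f
∑-injective {n} σ σ-inj f = begin
  ∑ (f ∘ σ) ≡⟨ ∑-cong (λ x → ∑-δ (σ x) f) ⟨
  ∑ (λ x → ∑ λ y → δ (σ x) y * f y) ≡⟨ ∑-comm (λ x y → δ (σ x) y * f y) ⟩
  ∑ (λ y → ∑ λ x → δ (σ x) y * f y) ≡⟨ ∑-cong (λ y → trans (∑-*ʳ (f y) λ x → δ (σ x) y) (trans (cong (_* f y) (fibre≡1 y)) (*-identityˡ (f y)))) ⟩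
  ∑ f ∎
  where
  open ≡-Reasoning
  fibre : Fin n → ℕ
  fibre y = ∑ λ x → δ (σ x) y

  δ-positive : ∀ {x y : Fin n} → 0 < δ x y → x ≡ y
  δ-positive {x} {y} p with x ≟ y
  ... | yes eq = eq

  fibre≤1 : ∀ y → fibre y ≤ 1
  fibre≤1 y = ∑-unique (λ x → ind≤1 ⌊ σ x ≟ y ⌋) λ x x′ p p′ → σ-inj (trans (δ-positive p) (sym (δ-positive p′)))

  total : ∑ fibre ≡ n
  total = trans (∑-comm λ y x → δ (σ x) y) (trans (∑-cong λ x → trans (∑-cong λ y → sym (*-identityʳ (δ (σ x) y))) (∑-δ (σ x) λ _ → 1))
    (trans (∑-const n 1) (*-identityʳ n)))

  fibre≡1 : ∀ y → fibre y ≡ 1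
  fibre≡1 y with m≤n⇒m<n∨m≡n (fibre≤1 y)
  ... | inj₂ eq = eq
  ... | inj₁ lt = ⊥-elim (<-irrefl (trans total (sym (trans (∑-const n 1) (*-identityʳ n)))) (∑-mono-< fibre≤1 y lt))

edge-relabel : ∀ {n} (σ : Fin n → Fin n) → Injective _≡_ _≡_ σ → (H : Graph3 n) → ∀ x y z →
               edge (relabel σ H) x y z ≡ edge H (σ x) (σ y) (σ z)
edge-relabel σ σ-inj H x y z = ≡true-cong
  (λ e → let p , q , r , h = edge-elim (relabel σ H) x y z e in
    edge-intro H (σ x) (σ y) (σ z) (p ∘ σ-inj) (q ∘ σ-inj) (r ∘ σ-inj) h)
  (λ e → let p , q , r , h = edge-elim H (σ x) (σ y) (σ z) e in
    edge-intro (relabel σ H) x y z (p ∘ cong σ) (q ∘ cong σ) (r ∘ cong σ) h)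

codegreeSquares-relabel : ∀ {n} (σ : Fin n → Fin n) → Injective _≡_ _≡_ σ → (H : Graph3 n) →
                          codegreeSquares (edge (relabel σ H)) ≡ codegreeSquares (edge H)
codegreeSquares-relabel {n} σ σ-inj H = begin
  codegreeSquares (edge (relabel σ H)) ≡⟨ codegreeSquares-cong (edge-relabel σ σ-inj H) ⟩
  ∑ (λ x → ∑ λ y → d (σ x) (σ y) * d (σ x) (σ y)) ≡⟨ ∑-cong (λ x → ∑-injective σ σ-inj λ y → d (σ x) y * d (σ x) y) ⟩
  ∑ (λ x → ∑ λ y → d (σ x) y * d (σ x) y) ≡⟨ ∑-injective σ σ-inj (λ x → ∑ λ y → d x y * d x y) ⟩
  ∑ (λ x → ∑ λ y → d x y * d x y) ≡⟨ ∑-cong (λ x → ∑-cong λ y → cong₂ _*_ (d≡ x y) (d≡ x y)) ⟩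
  codegreeSquares (edge H) ∎
  where
  open ≡-Reasoning
  d : Fin n → Fin n → ℕ
  d x y = ∑ λ z → ind (edge H x y (σ z))
  d≡ : ∀ x y → d x y ≡ codegree (edge H) x y
  d≡ x y = ∑-injective σ σ-inj λ z → ind (edge H x y z)

-- Blow-ups of Γ

∑-split : ∀ a b (h : Fin (a + b) → ℕ) → ∑ h ≡ ∑ (λ x → h (x ↑ˡ b)) + ∑ (λ y → h (a ↑ʳ y))
∑-split zero b h = cong (_+ ∑ h) (sym (∑-empty (λ x → h (x ↑ˡ b))))
∑-split (suc a) b h = begin
  ∑ h ≡⟨ ∑-suc h ⟩
  h zero + ∑ (h ∘ suc) ≡⟨ cong (h zero +_) (∑-split a b (h ∘ suc)) ⟩
  h zero + (∑ (λ x → h (suc (x ↑ˡ b))) + ∑ (λ y → h (suc a ↑ʳ y))) ≡⟨ +-assoc (h zero) _ _ ⟨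
  h zero + ∑ (λ x → h (suc (x ↑ˡ b))) + ∑ (λ y → h (suc a ↑ʳ y)) ≡⟨ cong (_+ ∑ (λ y → h (suc a ↑ʳ y))) (∑-suc λ x → h (x ↑ˡ b)) ⟨
  ∑ (λ x → h (x ↑ˡ b)) + ∑ (λ y → h (suc a ↑ʳ y)) ∎
  where open ≡-Reasoning

-- The class sizes are described through their effect on sums of functions of the colour, the form
-- in which edges and codegrees of a blow-up are computed.
record HasClassSizes {n k : ℕ} (f : Fin n → Fin k) (w : Fin k → ℕ) : Set where
  constructor hasClassSizes
  field
    ∑-classes : ∀ g → ∑ (g ∘ f) ≡ ∑ λ i → w i * g i
open HasClassSizes

colour : ∀ {k} (w : Vec ℕ k) → Fin (Vec.sum w) → Fin k
colour (w ∷ ws) x = [ (λ _ → zero) , suc ∘ colour ws ]′ (splitAt w x)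

colour-sizes : ∀ {k} (w : Vec ℕ k) (g : Fin k → ℕ) → ∑ (g ∘ colour w) ≡ ∑ λ i → lookup w i * g i
colour-sizes [] g = trans (∑-empty _) (sym (∑-empty _))
colour-sizes (w ∷ ws) g = begin
  ∑ (g ∘ colour (w ∷ ws)) ≡⟨ ∑-split w (Vec.sum ws) (g ∘ colour (w ∷ ws)) ⟩
  ∑ (λ x → g (colour (w ∷ ws) (x ↑ˡ Vec.sum ws))) + ∑ (λ y → g (colour (w ∷ ws) (w ↑ʳ y)))
    ≡⟨ cong₂ _+_ (trans (∑-cong left) (∑-const w (g zero))) (trans (∑-cong right) (colour-sizes ws (g ∘ suc))) ⟩
  w * g zero + ∑ (λ i → lookup ws i * g (suc i)) ≡⟨ ∑-suc (λ i → lookup (w ∷ ws) i * g i) ⟨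
  ∑ (λ i → lookup (w ∷ ws) i * g i) ∎
  where
  open ≡-Reasoning
  left : ∀ x → g (colour (w ∷ ws) (x ↑ˡ Vec.sum ws)) ≡ g zero
  left x rewrite Fin.splitAt-↑ˡ w x (Vec.sum ws) = refl
  right : ∀ y → g (colour (w ∷ ws) (w ↑ʳ y)) ≡ g (suc (colour ws y))
  right y rewrite Fin.splitAt-↑ʳ w (Vec.sum ws) y = refl

colouring : ∀ {k} n (w : Vec ℕ k) → Vec.sum w ≡ n → Σ (Fin n → Fin k) λ f → HasClassSizes f (lookup w)
colouring _ w refl = colour w , hasClassSizes (colour-sizes w)

blowUp : ∀ {n} → (Fin n → Fin 6) → Graph3 n
blowUp f x y z = edge Γ (f x) (f y) (f z)

edge-blowUp : ∀ {n} (f : Fin n → Fin 6) x y z → edge (blowUp f) x y z ≡ edge Γ (f x) (f y) (f z)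
edge-blowUp f = loopless-edge (blowUp f) (pullback-loopless3 f (edge-loopless3 Γ))

blowUp-FFree : ∀ {n} (f : Fin n → Fin 6) → FFree (blowUp f)
blowUp-FFree f (φ , _ , hom) = no-FHom-Γ (f ∘ φ) λ u v w e → trans (sym (edge-blowUp f (φ u) (φ v) (φ w))) (hom u v w e)

eΓ : Fin 6 → Fin 6 → Fin 6 → ℕ
eΓ i j l = ind (edge Γ i j l)

module _ {n : ℕ} {f : Fin n → Fin 6} {w : Fin 6 → ℕ} (sizes : HasClassSizes f w) where

  weightedCodegree : Fin 6 → Fin 6 → ℕ
  weightedCodegree i j = ∑ λ l → w l * eΓ i j l

  codegree-blowUp : ∀ x y → codegree (edge (blowUp f)) x y ≡ weightedCodegree (f x) (f y)
  codegree-blowUp x y = trans (∑-cong λ z → cong ind (edge-blowUp f x y z)) (∑-classes sizes (eΓ (f x) (f y)))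

  ∑∑-colour : ∀ (g : Fin 6 → Fin 6 → ℕ) → ∑ (λ x → ∑ λ y → g (f x) (f y)) ≡ ∑ λ i → w i * ∑ λ j → w j * g i j
  ∑∑-colour g = trans (∑-cong λ x → ∑-classes sizes (g (f x))) (∑-classes sizes λ i → ∑ λ j → w j * g i j)

  edges-blowUp : edges (edge (blowUp f)) id ≡ ∑ λ i → w i * ∑ λ j → w j * weightedCodegree i j
  edges-blowUp = trans (∑-cong λ x → ∑-cong λ y → codegree-blowUp x y) (∑∑-colour weightedCodegree)

  codegreeSquares-blowUp : codegreeSquares (edge (blowUp f)) ≡
    ∑ λ i → w i * ∑ λ j → w j * (weightedCodegree i j * weightedCodegree i j)
  codegreeSquares-blowUp = trans (∑-cong λ x → ∑-cong λ y → cong₂ _*_ (codegree-blowUp x y) (codegree-blowUp x y))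
    (∑∑-colour λ i j → weightedCodegree i j * weightedCodegree i j)

coeffᵃ coeffᵇ : Vec ℕ 6
coeffᵃ = 2 ∷ 0 ∷ 0 ∷ 2 ∷ 1 ∷ 1 ∷ []
coeffᵇ = 0 ∷ 2 ∷ 2 ∷ 0 ∷ 1 ∷ 1 ∷ []

-- These class sizes are an optimal weighting of Γ for every ratio a : b.
classSizes : ℕ → ℕ → Vec ℕ 6
classSizes a b = Vec.zipWith (λ p q → p * a + q * b) coeffᵃ coeffᵇ

sum-classSizes : ∀ a b → Vec.sum (classSizes a b) ≡ 6 * (a + b)
sum-classSizes = identity
  where
  identity : ∀ a b → (2 * a + 0 * b) + ((0 * a + 2 * b) + ((0 * a + 2 * b) + ((2 * a + 0 * b) +
             ((1 * a + 1 * b) + ((1 * a + 1 * b) + 0))))) ≡ 6 * (a + b)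
  identity = solve-∀

lookup-classSizes : ∀ a b i → lookup (classSizes a b) i ≡ lookup coeffᵃ i * a + lookup coeffᵇ i * b
lookup-classSizes a b i = Vec.lookup-zipWith (λ p q → p * a + q * b) i coeffᵃ coeffᵇ

opaque
  unfolding ∑

  -- The key coincidence of Γ: the classes completing a given pair weigh as much under `coeffᵃ` as
  -- under `coeffᵇ`. So codegrees in the blow-up depend only on `a + b`, and the ratio `a : b`
  -- affects only how many vertex pairs have each codegree.
  multiplicity : Fin 6 → Fin 6 → ℕ
  multiplicity i j = ∑ λ l → lookup coeffᵃ l * eΓ i j l

  multiplicityᵇ : ∀ i j → ∑ (λ l → lookup coeffᵇ l * eΓ i j l) ≡ multiplicity i j
  multiplicityᵇ = from-yes (all? λ i → all? λ j → ∑ (λ l → lookup coeffᵇ l * eΓ i j l) ≟ℕ multiplicity i j)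

  rowᵃ : ∀ i → ∑ (λ j → lookup coeffᵃ j * multiplicity i j) ≡ 8
  rowᵃ = from-yes (all? λ i → ∑ (λ j → lookup coeffᵃ j * multiplicity i j) ≟ℕ 8)

  rowᵇ : ∀ i → ∑ (λ j → lookup coeffᵇ j * multiplicity i j) ≡ 8
  rowᵇ = from-yes (all? λ i → ∑ (λ j → lookup coeffᵇ j * multiplicity i j) ≟ℕ 8)

  -- Seen from class 0, class 3 has multiplicity 2 while classes 1 and 2 have multiplicity 1 each.
  -- With coefficient 2 on each class, `coeffᵃ` and `coeffᵇ` get the same sum from classes 0 to 3,
  -- but sums of squares 8 and 4. Classes 4 and 5 add 8 to both. This difference is the source of
  -- the term `32ab`.
  squareᵃ squareᵇ : Vec ℕ 6
  squareᵃ = 16 ∷ 12 ∷ 12 ∷ 16 ∷ 16 ∷ 16 ∷ []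
  squareᵇ = 12 ∷ 16 ∷ 16 ∷ 12 ∷ 16 ∷ 16 ∷ []

  squareRowᵃ : ∀ i → ∑ (λ j → lookup coeffᵃ j * (multiplicity i j * multiplicity i j)) ≡ lookup squareᵃ i
  squareRowᵃ = from-yes (all? λ i → ∑ (λ j → lookup coeffᵃ j * (multiplicity i j * multiplicity i j)) ≟ℕ lookup squareᵃ i)

  squareRowᵇ : ∀ i → ∑ (λ j → lookup coeffᵇ j * (multiplicity i j * multiplicity i j)) ≡ lookup squareᵇ i
  squareRowᵇ = from-yes (all? λ i → ∑ (λ j → lookup coeffᵇ j * (multiplicity i j * multiplicity i j)) ≟ℕ lookup squareᵇ i)

  ∑-squares : ∀ a b → ∑ (λ i → (lookup coeffᵃ i * a + lookup coeffᵇ i * b) * (lookup squareᵃ i * a + lookup squareᵇ i * b))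
              + 32 * (a * b) ≡ 96 * ((a + b) * (a + b))
  ∑-squares = identity
    where
    identity : ∀ a b →
      (2 * a + 0 * b) * (16 * a + 12 * b) + ((0 * a + 2 * b) * (12 * a + 16 * b) + ((0 * a + 2 * b) * (12 * a + 16 * b) +
      ((2 * a + 0 * b) * (16 * a + 12 * b) + ((1 * a + 1 * b) * (16 * a + 16 * b) + ((1 * a + 1 * b) * (16 * a + 16 * b) + 0)))))
      + 32 * (a * b) ≡ 96 * ((a + b) * (a + b))
    identity = solve-∀

  ∑-lookup : ∀ {k} (w : Vec ℕ k) → ∑ (lookup w) ≡ Vec.sum w
  ∑-lookup [] = refl
  ∑-lookup (x ∷ w) = cong (x +_) (∑-lookup w)

∑-linear : ∀ {k} (p q g : Fin k → ℕ) a b →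
           ∑ (λ i → (p i * a + q i * b) * g i) ≡ ∑ (λ i → p i * g i) * a + ∑ (λ i → q i * g i) * b
∑-linear p q g a b = begin
  ∑ (λ i → (p i * a + q i * b) * g i) ≡⟨ ∑-cong (λ i → distrib (p i) (q i) (g i) a b) ⟩
  ∑ (λ i → p i * g i * a + q i * g i * b) ≡⟨ ∑-+ (λ i → p i * g i * a) (λ i → q i * g i * b) ⟩
  ∑ (λ i → p i * g i * a) + ∑ (λ i → q i * g i * b) ≡⟨ cong₂ _+_ (∑-*ʳ a λ i → p i * g i) (∑-*ʳ b λ i → q i * g i) ⟩
  ∑ (λ i → p i * g i) * a + ∑ (λ i → q i * g i) * b ∎
  where
  open ≡-Reasoning
  distrib : ∀ p q g a b → (p * a + q * b) * g ≡ p * g * a + q * g * b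
  distrib = solve-∀

module _ (a b : ℕ) where

  private
    w = lookup (classSizes a b)

  ∑-classSizes : ∀ (g : Fin 6 → ℕ) → ∑ (λ i → w i * g i) ≡
                 ∑ (λ i → lookup coeffᵃ i * g i) * a + ∑ (λ i → lookup coeffᵇ i * g i) * b
  ∑-classSizes g = trans (∑-cong λ i → cong (_* g i) (lookup-classSizes a b i)) (∑-linear (lookup coeffᵃ) (lookup coeffᵇ) g a b)

  codegree-classSizes : ∀ i j → ∑ (λ l → w l * eΓ i j l) ≡ (a + b) * multiplicity i j
  codegree-classSizes i j = trans (∑-classSizes (eΓ i j))
    (trans (cong₂ (λ x y → x * a + y * b) first (multiplicityᵇ i j)) (factor (multiplicity i j) a b))
    where
    opaque
      unfolding multiplicity
      first : ∑ (λ l → lookup coeffᵃ l * eΓ i j l) ≡ multiplicity i j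
      first = refl
    factor : ∀ m a b → m * a + m * b ≡ (a + b) * m
    factor = solve-∀

  -- With `n = 6t`, every vertex lies in `8t² = 2n²/9` ordered edges by `rowᵃ` and `rowᵇ`, whatever
  -- the ratio `a : b`; hence density 2/9 for all of them.
  edges-classSizes : ∑ (λ i → w i * ∑ λ j → w j * ∑ λ l → w l * eΓ i j l) ≡ 48 * (a + b) ^ 3
  edges-classSizes = begin
    ∑ (λ i → w i * ∑ λ j → w j * ∑ λ l → w l * eΓ i j l) ≡⟨ ∑-cong (λ i → cong (w i *_) (row i)) ⟩
    ∑ (λ i → w i * (8 * (t * t))) ≡⟨ ∑-*ʳ (8 * (t * t)) w ⟩
    ∑ w * (8 * (t * t)) ≡⟨ cong (_* (8 * (t * t))) (trans (∑-lookup (classSizes a b)) (sum-classSizes a b)) ⟩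
    6 * t * (8 * (t * t)) ≡⟨ collect t ⟩
    48 * t ^ 3 ∎
    where
    open ≡-Reasoning
    t = a + b
    collect : ∀ t → 6 * t * (8 * (t * t)) ≡ 48 * (t * (t * (t * 1)))
    collect = solve-∀
    pull : ∀ w t m → w * (t * m) ≡ w * m * t
    pull = solve-∀
    eight : ∀ a b → (8 * a + 8 * b) * (a + b) ≡ 8 * ((a + b) * (a + b))
    eight = solve-∀
    row : ∀ i → ∑ (λ j → w j * ∑ λ l → w l * eΓ i j l) ≡ 8 * (t * t)
    row i = begin
      ∑ (λ j → w j * ∑ λ l → w l * eΓ i j l)
        ≡⟨ ∑-cong (λ j → trans (cong (w j *_) (codegree-classSizes i j)) (pull (w j) t (multiplicity i j))) ⟩
      ∑ (λ j → w j * multiplicity i j * t) ≡⟨ ∑-*ʳ t (λ j → w j * multiplicity i j) ⟩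
      ∑ (λ j → w j * multiplicity i j) * t ≡⟨ cong (_* t) (trans (∑-classSizes (multiplicity i)) (cong₂ (λ x y → x * a + y * b) (rowᵃ i) (rowᵇ i))) ⟩
      (8 * a + 8 * b) * t ≡⟨ eight a b ⟩
      8 * (t * t) ∎

  codegreeSquares-classSizes :
    ∑ (λ i → w i * ∑ λ j → w j * ((∑ λ l → w l * eΓ i j l) * (∑ λ l → w l * eΓ i j l))) + 32 * (a * b) * ((a + b) * (a + b)) ≡ 96 * (a + b) ^ 4
  codegreeSquares-classSizes = begin
    ∑ (λ i → w i * ∑ λ j → w j * (c i j * c i j)) + 32 * (a * b) * (t * t)
      ≡⟨ cong (_+ 32 * (a * b) * (t * t)) (trans (∑-cong λ i → trans (cong (w i *_) (row i)) (sym (*-assoc (w i) (s i) (t * t))))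
           (∑-*ʳ (t * t) λ i → w i * s i)) ⟩
    ∑ (λ i → w i * s i) * (t * t) + 32 * (a * b) * (t * t) ≡⟨ *-distribʳ-+ (t * t) (∑ λ i → w i * s i) (32 * (a * b)) ⟨
    (∑ (λ i → w i * s i) + 32 * (a * b)) * (t * t)
      ≡⟨ cong (λ z → (z + 32 * (a * b)) * (t * t)) (∑-cong λ i → cong (_* s i) (lookup-classSizes a b i)) ⟩
    (∑ (λ i → (lookup coeffᵃ i * a + lookup coeffᵇ i * b) * s i) + 32 * (a * b)) * (t * t)
      ≡⟨ cong (_* (t * t)) (∑-squares a b) ⟩
    96 * (t * t) * (t * t) ≡⟨ collect t ⟩
    96 * t ^ 4 ∎
    where
    open ≡-Reasoning
    c : Fin 6 → Fin 6 → ℕ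
    c i j = ∑ λ l → w l * eΓ i j l
    t = a + b
    s : Fin 6 → ℕ
    s i = lookup squareᵃ i * a + lookup squareᵇ i * b
    collect : ∀ t → 96 * (t * t) * (t * t) ≡ 96 * (t * (t * (t * (t * 1))))
    collect = solve-∀
    pull : ∀ w t m → w * (t * m * (t * m)) ≡ w * (m * m) * (t * t)
    pull = solve-∀
    row : ∀ i → ∑ (λ j → w j * (c i j * c i j)) ≡ s i * (t * t)
    row i = begin
      ∑ (λ j → w j * (c i j * c i j))
        ≡⟨ ∑-cong (λ j → trans (cong (λ z → w j * (z * z)) (codegree-classSizes i j)) (pull (w j) t (multiplicity i j))) ⟩
      ∑ (λ j → w j * (multiplicity i j * multiplicity i j) * (t * t)) ≡⟨ ∑-*ʳ (t * t) (λ j → w j * (multiplicity i j * multiplicity i j)) ⟩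
      ∑ (λ j → w j * (multiplicity i j * multiplicity i j)) * (t * t)
        ≡⟨ cong (_* (t * t)) (trans (∑-classSizes λ j → multiplicity i j * multiplicity i j)
             (cong₂ (λ x y → x * a + y * b) (squareRowᵃ i) (squareRowᵇ i))) ⟩
      s i * (t * t) ∎

-- Bounds for ex(n, F)

Hom-∘ : ∀ {A B C : Set} {R : Ternary B} {E : Ternary A} {χ : B → A} (f : C → B) →
        Hom R E χ → Hom (λ i j l → R (f i) (f j) (f l)) E (χ ∘ f)
Hom-∘ f hom i j l = hom (f i) (f j) (f l)

Hom-decode : ∀ {A B C : Set} {R : Ternary B} {E : Ternary A} {φ : C → A} (code : B → C) (uncode : C → B) →
             (∀ b → uncode (code b) ≡ b) → Hom (λ i j l → R (uncode i) (uncode j) (uncode l)) E φ → Hom R E (φ ∘ code)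
Hom-decode {R = R} code uncode decode-code hom u v w e =
  hom (code u) (code v) (code w) (trans (cong₃ R (decode-code u) (decode-code v) (decode-code w)) e)

code : VF → Fin 28
code u = combine (proj₁ u) (proj₂ u)

decode : Fin 28 → VF
decode = remQuot 7

decode-code : ∀ u → decode (code u) ≡ u
decode-code u = Fin.remQuot-combine (proj₁ u) (proj₂ u)

code-injective : ∀ u v → code u ≡ code v → u ≡ v
code-injective u v eq = trans (sym (decode-code u)) (trans (cong decode eq) (decode-code v))

edgeF′ : Ternary (Fin 28)
edgeF′ i j l = edgeF (decode i) (decode j) (decode l)

edges-without-F : ∀ {k} {E : Ternary (Fin k)} → IsLoopless3 E → (∀ χ → ¬ Hom edgeF′ E χ) →
                  9 * edges E id ≤ k * suc k * suc (2 * k)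
edges-without-F {k} {E} E-3 none = edges-bound E E-3
  (λ h → image (FHom-from-K4m E-3 h))
  (λ h → image (FHom-from-Fstar E-3 h))
  where
  image : (∃[ χ ] Hom edgeF E χ) → ⊥
  image (χ , hom) = none (χ ∘ decode) (Hom-∘ {R = edgeF} {E = E} {χ = χ} decode hom)

module FSaturation = Supersaturation edgeF′ edges-without-F

containsF : ∀ {n} (H : Graph3 n) → FSaturation.Contains (edge H) → ContainsF H
containsF {n} H (φ , φ-injective , hom) = φ ∘ code ,
  (λ {u} {v} eq → code-injective u v (φ-injective {code u} {code v} eq)) ,
  Hom-decode {R = edgeF} {E = edge H} {φ = φ} code decode decode-code hom

-- Passing from `6 * (n C 3)` to `n³` costs at most `3n²`. The drop from `2k + 9` to `2k + 8` pays
-- for it, since `3(2k+9)n² ≤ n³` for the given `n`.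
dense-of-large : ∀ k n s O c → 6 * c + 3 * (n * n) ≡ n ^ 3 + 2 * n → 6 * s ≡ O → 3 * (2 * k + 9) ≤ n →
                 (2 * k + 9) * c ≤ 9 * k * s → (2 * k + 8) * n ^ 3 ≤ 9 * k * O
dense-of-large k n s O c c≡ O≡ n≥ large = +-cancelʳ-≤ (n ^ 3) _ _ (begin
  (2 * k + 8) * n ^ 3 + n ^ 3 ≡⟨ e₁ k (n ^ 3) ⟩
  (2 * k + 9) * n ^ 3 ≤⟨ *-monoʳ-≤ (2 * k + 9) (≤-trans (m≤m+n (n ^ 3) (2 * n)) (≤-reflexive (sym c≡))) ⟩
  (2 * k + 9) * (6 * c + 3 * (n * n)) ≡⟨ e₂ (2 * k + 9) c (n * n) ⟩
  6 * ((2 * k + 9) * c) + 3 * (2 * k + 9) * (n * n) ≤⟨ +-mono-≤ (*-monoʳ-≤ 6 large) (*-monoˡ-≤ (n * n) n≥) ⟩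
  6 * (9 * k * s) + n * (n * n) ≡⟨ e₃ (9 * k) s n ⟩
  9 * k * (6 * s) + n ^ 3 ≡⟨ cong (λ z → 9 * k * z + n ^ 3) O≡ ⟩
  9 * k * O + n ^ 3 ∎)
  where
  open ≤-Reasoning
  e₁ : ∀ k x → (2 * k + 8) * x + x ≡ (2 * k + 9) * x
  e₁ = solve-∀
  e₂ : ∀ k c x → k * (6 * c + 3 * x) ≡ 6 * (k * c) + 3 * k * x
  e₂ = solve-∀
  e₃ : ∀ k s n → 6 * (k * s) + n * (n * n) ≡ k * (6 * s) + n * (n * (n * 1))
  e₃ = solve-∀

saturation : ∀ k → ∃[ N ] ∀ n → N ≤ n → (E : Ternary (Fin n)) → IsLoopless3 E →
             (2 * k + 8) * n ^ 3 ≤ 9 * k * edges E id → FSaturation.Contains E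
saturation k = FSaturation.contains-of-dense k (3 + 12 * k) (s≤s (s≤s (s≤s z≤n))) (m≤n+m (12 * k) 3)

upper-bound : ∀ k → ∃[ N ] ∀ n → N ≤ n → (H : Graph3 n) → FFree H → 9 * k * size H ≤ (2 * k + 9) * (n C 3)
upper-bound k = N + 3 * (2 * k + 9) , λ n n≥ H free → ≮⇒≥ λ large →
  free (containsF H (proj₂ (saturation k) n (≤-trans (m≤m+n N (3 * (2 * k + 9))) n≥) (edge H) (edge-loopless3 H)
    (dense-of-large k n (size H) (edges (edge H) id) (n C 3) (six-nC3 n) (six-size H)
      (≤-trans (m≤n+m (3 * (2 * k + 9)) N) n≥) (<⇒≤ large))))
  where
  N = proj₁ (saturation k)

size-from-edges : ∀ {n} (H : Graph3 n) t → edges (edge H) id ≡ 48 * t ^ 3 → size H ≡ 8 * t ^ 3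
size-from-edges H t eq = *-cancelˡ-≡ (size H) (8 * t ^ 3) 6 (trans (six-size H) (trans eq (*-assoc 6 8 (t ^ 3))))

cube-bound : ∀ t r → r ≤ 5 → (6 * t + r) ^ 3 ≤ 27 * (8 * t ^ 3) + 15 * ((6 * t + r) * (6 * t + r))
cube-bound t r r≤5 = begin
  n ^ 3 ≤⟨ m≤m+n (n ^ 3) (18 * t * (r * r) + 2 * (r * (r * r))) ⟩
  n ^ 3 + (18 * t * (r * r) + 2 * (r * (r * r))) ≡⟨ expand t r ⟩
  27 * (8 * t ^ 3) + 3 * r * (n * n) ≤⟨ +-monoʳ-≤ (27 * (8 * t ^ 3)) (*-monoˡ-≤ (n * n) (*-monoʳ-≤ 3 r≤5)) ⟩
  27 * (8 * t ^ 3) + 15 * (n * n) ∎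
  where
  open ≤-Reasoning
  n = 6 * t + r
  expand : ∀ t r → (6 * t + r) * ((6 * t + r) * ((6 * t + r) * 1)) + (18 * t * (r * r) + 2 * (r * (r * r))) ≡
           27 * (8 * (t * (t * (t * 1)))) + 3 * r * ((6 * t + r) * (6 * t + r))
  expand = solve-∀

weightedEdges : (Fin 6 → ℕ) → ℕ
weightedEdges w = ∑ λ i → w i * ∑ λ j → w j * ∑ λ l → w l * eΓ i j l

weightedEdges-mono : ∀ {w w′} → (∀ i → w i ≤ w′ i) → weightedEdges w ≤ weightedEdges w′
weightedEdges-mono h = ∑-mono λ i → *-mono-≤ (h i) (∑-mono λ j → *-mono-≤ (h j) (∑-mono λ l → *-monoˡ-≤ (eΓ i j l) (h l)))

size-blowUp≥ : ∀ {n} {f : Fin n → Fin 6} {w} → HasClassSizes f w → ∀ s → 6 * s ≤ weightedEdges w → s ≤ size (blowUp f)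
size-blowUp≥ {f = f} sizes s le = *-cancelˡ-≤ {s} {size (blowUp f)} 6
  (≤-trans le (≤-reflexive (trans (sym (edges-blowUp sizes)) (sym (six-size (blowUp f))))))

module _ (t r : ℕ) where

  -- The weighting of Γ needs `n` divisible by 6. The `r` leftover vertices are thrown into class 0,
  -- which loses no edges; for `r ≤ 5` the resulting deficit is of order `n²`, see `cube-bound`.
  enlarged : Vec ℕ 6
  enlarged = Vec.head (classSizes t 0) + r ∷ Vec.tail (classSizes t 0)

  enlarged≥ : ∀ i → lookup (classSizes t 0) i ≤ lookup enlarged i
  enlarged≥ zero = m≤m+n _ r
  enlarged≥ (suc i) = ≤-refl

  sum-enlarged : Vec.sum enlarged ≡ 6 * t + r
  sum-enlarged = trans (shuffle (Vec.head (classSizes t 0)) r (Vec.sum (Vec.tail (classSizes t 0))))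
    (cong (_+ r) (trans (sum-classSizes t 0) (cong (6 *_) (+-identityʳ t))))
    where
    shuffle : ∀ a r s → a + r + s ≡ a + s + r
    shuffle = solve-∀

  nearly-extremal : Σ (Graph3 (6 * t + r)) λ H → FFree H × 8 * t ^ 3 ≤ size H
  nearly-extremal = let f , sizes = colouring (6 * t + r) enlarged sum-enlarged in
    blowUp f , blowUp-FFree f , size-blowUp≥ sizes (8 * t ^ 3) (≤-trans (≤-reflexive total) (weightedEdges-mono enlarged≥))
    where
    total : 6 * (8 * t ^ 3) ≡ weightedEdges (lookup (classSizes t 0))
    total = trans (sym (*-assoc 6 8 (t ^ 3))) (trans (cong (λ z → 48 * z ^ 3) (sym (+-identityʳ t))) (sym (edges-classSizes t 0)))

-- In the threshold, `30k = 2k * 15` absorbs the error of `cube-bound` and `27 = 9 * 3` the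
-- quadratic term in the expansion of `n C 3`.
size-lower : ∀ k n c s → 6 * c ≤ n ^ 3 → 6 * c + 3 * (n * n) ≡ n ^ 3 + 2 * n → 30 * k + 27 ≤ n →
             n ^ 3 ≤ 27 * s + 15 * (n * n) → 2 * k * c ≤ 9 * k * s + 9 * c
size-lower k n c s c≤ c≡ n≥ le = *-cancelˡ-≤ 6 (+-cancelʳ-≤ (27 * (n * n)) _ _ (begin
  6 * (2 * k * c) + 27 * (n * n) ≡⟨ e₁ k c (n * n) ⟩
  2 * k * (6 * c) + 27 * (n * n) ≤⟨ +-monoˡ-≤ (27 * (n * n)) (*-monoʳ-≤ (2 * k) (≤-trans c≤ le)) ⟩
  2 * k * (27 * s + 15 * (n * n)) + 27 * (n * n) ≡⟨ e₂ k s (n * n) ⟩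
  54 * k * s + (30 * k + 27) * (n * n) ≤⟨ +-monoʳ-≤ (54 * k * s) (*-monoˡ-≤ (n * n) n≥) ⟩
  54 * k * s + n * (n * n) ≤⟨ +-monoʳ-≤ (54 * k * s) (m≤m+n (n * (n * n)) (8 * n ^ 3 + 18 * n)) ⟩
  54 * k * s + (n * (n * n) + (8 * n ^ 3 + 18 * n)) ≡⟨ cong (54 * k * s +_) (e₃ n) ⟩
  54 * k * s + 9 * (n ^ 3 + 2 * n) ≡⟨ cong (λ z → 54 * k * s + 9 * z) c≡ ⟨
  54 * k * s + 9 * (6 * c + 3 * (n * n)) ≡⟨ e₄ k s c (n * n) ⟩
  6 * (9 * k * s + 9 * c) + 27 * (n * n) ∎))
  where
  open ≤-Reasoning
  e₁ : ∀ k c x → 6 * (2 * k * c) + 27 * x ≡ 2 * k * (6 * c) + 27 * x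
  e₁ = solve-∀
  e₂ : ∀ k s x → 2 * k * (27 * s + 15 * x) + 27 * x ≡ 54 * k * s + (30 * k + 27) * x
  e₂ = solve-∀
  e₃ : ∀ n → n * (n * n) + (8 * (n * (n * (n * 1))) + 18 * n) ≡ 9 * (n * (n * (n * 1)) + 2 * n)
  e₃ = solve-∀
  e₄ : ∀ k s c x → 54 * k * s + 9 * (6 * c + 3 * x) ≡ 6 * (9 * k * s + 9 * c) + 27 * x
  e₄ = solve-∀

lower-bound : ∀ k n → 30 * k + 27 ≤ n → Σ (Graph3 n) λ H → FFree H × 2 * k * (n C 3) ≤ 9 * k * size H + 9 * (n C 3)
lower-bound k n n≥ = subst Goal (sym n≡) (go (n div 6) (n mod 6) (s≤s⁻¹ (m%n<n n 6)) (subst (30 * k + 27 ≤_) n≡ n≥))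
  where
  Goal : ℕ → Set
  Goal n = Σ (Graph3 n) λ H → FFree H × 2 * k * (n C 3) ≤ 9 * k * size H + 9 * (n C 3)

  n≡ : n ≡ 6 * (n div 6) + n mod 6
  n≡ = trans (m≡m%n+[m/n]*n n 6) (trans (+-comm (n mod 6) (n div 6 * 6)) (cong (_+ n mod 6) (*-comm (n div 6) 6)))

  go : ∀ t r → r ≤ 5 → 30 * k + 27 ≤ 6 * t + r → Goal (6 * t + r)
  go t r r≤5 n≥ =
    let H , free , le = nearly-extremal t r
        n = 6 * t + r
    in H , free , size-lower k n (n C 3) (size H) (six-nC3≤ n) (six-nC3 n) n≥
         (≤-trans (cube-bound t r r≤5) (+-monoˡ-≤ (15 * (n * n)) (*-monoʳ-≤ 27 le)))

module _ {n : ℕ} (f : Fin n → Fin 6) (a b : ℕ) (sizes : HasClassSizes f (lookup (classSizes a b))) where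

  size-extremal : size (blowUp f) ≡ 8 * (a + b) ^ 3
  size-extremal = size-from-edges (blowUp f) (a + b) (trans (edges-blowUp sizes) (edges-classSizes a b))

  codegreeSquares-extremal : codegreeSquares (edge (blowUp f)) + 32 * (a * b) * ((a + b) * (a + b)) ≡ 96 * (a + b) ^ 4
  codegreeSquares-extremal = trans (cong (_+ 32 * (a * b) * ((a + b) * (a + b))) (codegreeSquares-blowUp sizes))
    (codegreeSquares-classSizes a b)

dist-comm : ∀ {n} (G H : Graph3 n) → dist G H ≡ dist H G
dist-comm G H = *-cancelˡ-≡ (dist G H) (dist H G) 6 (trans (six-dist G H) (trans
  (∑³-cong λ x y z → cong ind (Bool.xor-comm (edge G x y z) (edge H x y z))) (sym (six-dist H G))))

codegreeSquares-dist : ∀ {n} (G H : Graph3 n) → codegreeSquares (edge G) ≤ codegreeSquares (edge H) + 12 * n * dist G H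
codegreeSquares-dist {n} G H = ≤-trans (codegreeSquares-lipschitz (edge G) (edge H))
  (≤-reflexive (cong (codegreeSquares (edge H) +_) (trans (cong (2 * n *_) (sym (six-dist G H))) (collect n (dist G H)))))
  where
  collect : ∀ n d → 2 * n * (6 * d) ≡ 12 * n * d
  collect = solve-∀

-- All extremal graphs have the same number of edges; the number of pairs of edges sharing two
-- vertices tells them apart.
far-apart : ∀ {n} (H₁ H₂ G : Graph3 n) (σ₁ σ₂ : Fin n → Fin n) → Injective _≡_ _≡_ σ₁ → Injective _≡_ _≡_ σ₂ →
  ∀ D M x₁ x₂ → let t = D * M in 0 < t → n ≡ 6 * t → x₁ < x₂ →
  codegreeSquares (edge H₁) + 32 * (x₁ * (M * M)) * (t * t) ≡ 96 * t ^ 4 →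
  codegreeSquares (edge H₂) + 32 * (x₂ * (M * M)) * (t * t) ≡ 96 * t ^ 4 →
  5 * (D * D) * dist (relabel σ₁ H₁) G ≤ t ^ 3 →
  5 * (D * D) * dist (relabel σ₂ H₂) G ≤ t ^ 3 → ⊥
far-apart {n} H₁ H₂ G σ₁ σ₂ σ₁-inj σ₂-inj D M x₁ x₂ t>0 n≡ x₁<x₂ K₁≡ K₂≡ near₁ near₂ =
  <⇒≱ (*-monoˡ-< (t ^ 4) {{>-nonZero (m^n>0 t {{>-nonZero t>0}} 4)}} {144} {160} (m≤m+n 145 15)) too-close
  where
  open ≤-Reasoning
  t = D * M
  d₁ = dist (relabel σ₁ H₁) G
  d₂ = dist (relabel σ₂ H₂) G
  K₁ = codegreeSquares (edge H₁)
  K₂ = codegreeSquares (edge H₂)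
  Z = M * M * (t * t)

  close : K₁ ≤ K₂ + 12 * n * d₂ + 12 * n * d₁
  close = begin
    K₁ ≡⟨ codegreeSquares-relabel σ₁ σ₁-inj H₁ ⟨
    codegreeSquares (edge (relabel σ₁ H₁)) ≤⟨ codegreeSquares-dist (relabel σ₁ H₁) G ⟩
    codegreeSquares (edge G) + 12 * n * d₁ ≤⟨ +-monoˡ-≤ (12 * n * d₁) (codegreeSquares-dist G (relabel σ₂ H₂)) ⟩
    codegreeSquares (edge (relabel σ₂ H₂)) + 12 * n * dist G (relabel σ₂ H₂) + 12 * n * d₁
      ≡⟨ cong₂ (λ x y → x + 12 * n * y + 12 * n * d₁) (codegreeSquares-relabel σ₂ σ₂-inj H₂) (dist-comm G (relabel σ₂ H₂)) ⟩
    K₂ + 12 * n * d₂ + 12 * n * d₁ ∎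

  -- The integers `x₁ < x₂` differ by at least 1, so the correction terms differ by at least
  -- `32 * Z`.
  gap : K₂ + 32 * Z ≤ K₁
  gap = +-cancelʳ-≤ (32 * (x₁ * (M * M)) * (t * t)) _ _ (begin
    K₂ + 32 * Z + 32 * (x₁ * (M * M)) * (t * t) ≡⟨ e K₂ x₁ (M * M) (t * t) ⟩
    K₂ + 32 * (suc x₁ * (M * M)) * (t * t)
      ≤⟨ +-monoʳ-≤ K₂ (*-monoˡ-≤ (t * t) (*-monoʳ-≤ 32 (*-monoˡ-≤ (M * M) x₁<x₂))) ⟩
    K₂ + 32 * (x₂ * (M * M)) * (t * t) ≡⟨ trans K₂≡ (sym K₁≡) ⟩
    K₁ + 32 * (x₁ * (M * M)) * (t * t) ∎)
    where
    e : ∀ K x m t → K + 32 * (m * t) + 32 * (x * m) * t ≡ K + 32 * (suc x * m) * t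
    e = solve-∀

  32Z≤ : 32 * Z ≤ 12 * n * (d₁ + d₂)
  32Z≤ = +-cancelˡ-≤ K₂ _ _ (≤-trans gap (≤-trans close (≤-reflexive (e K₂ n d₁ d₂))))
    where
    e : ∀ K n a b → K + 12 * n * b + 12 * n * a ≡ K + 12 * n * (a + b)
    e = solve-∀

  -- Multiplied by `5D²`, the gap `32 * Z` becomes `160t⁴`, because `D²M² = t²`. Two edit distances
  -- of at most `t³/(5D²)` allow only `12 * 6t * 2t³ = 144t⁴`. The factor 5 is the least integer `c`
  -- with `32c > 144`.
  too-close : 160 * t ^ 4 ≤ 144 * t ^ 4
  too-close = begin
    160 * t ^ 4 ≡⟨ e₁ D M ⟩
    5 * (D * D) * (32 * Z) ≤⟨ *-monoʳ-≤ (5 * (D * D)) 32Z≤ ⟩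
    5 * (D * D) * (12 * n * (d₁ + d₂)) ≡⟨ e₂ (5 * (D * D)) n d₁ d₂ ⟩
    12 * n * (5 * (D * D) * d₁ + 5 * (D * D) * d₂) ≤⟨ *-monoʳ-≤ (12 * n) (+-mono-≤ near₁ near₂) ⟩
    12 * n * (t ^ 3 + t ^ 3) ≡⟨ cong (λ n → 12 * n * (t ^ 3 + t ^ 3)) n≡ ⟩
    12 * (6 * t) * (t ^ 3 + t ^ 3) ≡⟨ e₃ t ⟩
    144 * t ^ 4 ∎
    where
    e₁ : ∀ D M → 160 * ((D * M) * ((D * M) * ((D * M) * ((D * M) * 1)))) ≡ 5 * (D * D) * (32 * (M * M * ((D * M) * (D * M))))
    e₁ = solve-∀
    e₂ : ∀ k n a b → k * (12 * n * (a + b)) ≡ 12 * n * (k * a + k * b)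
    e₂ = solve-∀
    e₃ : ∀ t → 12 * (6 * t) * (t * (t * (t * 1)) + t * (t * (t * 1))) ≡ 144 * (t * (t * (t * (t * 1))))
    e₃ = solve-∀

-- Rational estimates

open import Data.Integer as ℤ using (+_; -[1+_])
import Data.Integer.Properties as ℤ
import Data.Nat.Coprimality as Coprimality
open import Data.Rational as ℚ using (ℚ; mkℚ; 0ℚ; 1ℚ; _/_)
import Data.Rational.Properties as ℚ
open import Data.Rational.Solver using (module +-*-Solver)
import Data.Rational.Unnormalised as ℚᵘ
import Data.Rational.Unnormalised.Properties as ℚᵘ
open +-*-Solver using (solve; _:=_; _:+_; _:*_; _:-_; :-_)

ℕtoℚ≡ : ∀ k → ℕtoℚ k ≡ mkℚ (+ k) 0 (Coprimality.sym (Coprimality.1-coprimeTo k))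
ℕtoℚ≡ k = ℚ.↥p/↧p≡p (mkℚ (+ k) 0 _)

ℕtoℚ-+ : ∀ a b → ℕtoℚ (a + b) ≡ ℕtoℚ a ℚ.+ ℕtoℚ b
ℕtoℚ-+ a b = sym (trans (cong₂ ℚ._+_ (ℕtoℚ≡ a) (ℕtoℚ≡ b))
  (cong (ℚ._/ 1) (cong₂ ℤ._+_ (ℤ.*-identityʳ (+ a)) (ℤ.*-identityʳ (+ b)))))

ℕtoℚ-* : ∀ a b → ℕtoℚ (a * b) ≡ ℕtoℚ a ℚ.* ℕtoℚ b
ℕtoℚ-* a b = sym (trans (cong₂ ℚ._*_ (ℕtoℚ≡ a) (ℕtoℚ≡ b)) (cong (ℚ._/ 1) (sym (ℤ.pos-* a b))))

ℕtoℚ-mono-≤ : ∀ {a b} → a ≤ b → ℕtoℚ a ℚ.≤ ℕtoℚ b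
ℕtoℚ-mono-≤ {a} {b} a≤b rewrite ℕtoℚ≡ a | ℕtoℚ≡ b =
  ℚ.*≤* (ℤ.*-monoʳ-≤-nonNeg (+ 1) (ℤ.+≤+ a≤b))

ℕtoℚ-mono-< : ∀ {a b} → a < b → ℕtoℚ a ℚ.< ℕtoℚ b
ℕtoℚ-mono-< {a} {b} a<b rewrite ℕtoℚ≡ a | ℕtoℚ≡ b =
  ℚ.*<* (ℤ.*-monoʳ-<-pos (+ 1) (ℤ.+<+ a<b))

ℕtoℚ-cancel-≤ : ∀ {a b} → ℕtoℚ a ℚ.≤ ℕtoℚ b → a ≤ b
ℕtoℚ-cancel-≤ {a} {b} h = ≮⇒≥ λ b<a → ℚ.<-irrefl refl (ℚ.<-≤-trans (ℕtoℚ-mono-< b<a) h)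

ℕtoℚ-nonNeg : ∀ k → ℚ.NonNegative (ℕtoℚ k)
ℕtoℚ-nonNeg k = ℚ.nonNegative (ℕtoℚ-mono-≤ {0} {k} z≤n)

ℕtoℚ-pos : ∀ {k} → 0 < k → ℚ.Positive (ℕtoℚ k)
ℕtoℚ-pos {k} k>0 = ℚ.positive (ℕtoℚ-mono-< {0} {k} k>0)

archimedean : ∀ ε → 0ℚ ℚ.< ε → ∃[ k ] 0 < k × 1ℚ ℚ.≤ ℕtoℚ k ℚ.* ε
-- The denominator serves as `k`: the product `k * ε` is then the numerator, which is at least 1.
archimedean ε@(mkℚ (+ suc a) d _) ε>0 = suc d , s≤s z≤n , subst (λ z → 1ℚ ℚ.≤ z ℚ.* ε) (sym (ℕtoℚ≡ (suc d)))
  (ℚ.toℚᵘ-cancel-≤ (ℚᵘ.≤-respʳ-≃ (ℚᵘ.≃-sym (ℚ.toℚᵘ-homo-* k ε)) (ℚᵘ.*≤* (ℤ.+≤+ (begin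
    1 * (1 * suc d) ≡⟨ trans (*-identityˡ (1 * suc d)) (*-identityˡ (suc d)) ⟩
    suc d ≤⟨ m≤m*n (suc d) (suc a) ⟩
    suc d * suc a ≡⟨ *-identityʳ (suc d * suc a) ⟨
    suc d * suc a * 1 ∎)))))
  where
  open ≤-Reasoning
  k = mkℚ (+ suc d) 0 (Coprimality.sym (Coprimality.1-coprimeTo (suc d)))
archimedean (mkℚ (+ zero) d _) ε>0 = ⊥-elim (ℤ.<-irrefl refl (ℚ.drop-*<* ε>0))
archimedean (mkℚ -[1+ a ] d _) ε>0 with () ← ℚ.drop-*<* ε>0

difference-≤ : ∀ p q s → p ℚ.≤ q ℚ.+ s → p ℚ.- q ℚ.≤ s
difference-≤ p q s h = subst (p ℚ.- q ℚ.≤_) (cancel q s) (ℚ.+-monoˡ-≤ (ℚ.- q) h)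
  where
  cancel : ∀ q s → q ℚ.+ s ℚ.- q ≡ s
  cancel = solve 2 (λ q s → q :+ s :- q := s) refl

∣∣-≤ : ∀ x y → x ℚ.≤ y → ℚ.- x ℚ.≤ y → ℚ.∣ x ∣ ℚ.≤ y
∣∣-≤ x y h h′ with ℚ.∣p∣≡p∨∣p∣≡-p x
... | inj₁ eq = subst (ℚ._≤ y) (sym eq) h
... | inj₂ eq = subst (ℚ._≤ y) (sym eq) h′

-- The density 2/9 enters as a variable `r` with `nine * r = two`, which turns the estimates into
-- polynomial identities for the ring solver.
module _ (e c k ε r two nine : ℚ) (k>0 : ℚ.Positive k) (nine>0 : ℚ.Positive nine) (c≥0 : ℚ.NonNegative c)
         (r≡ : nine ℚ.* r ≡ two) (large : 1ℚ ℚ.≤ k ℚ.* ε) where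

  private
    nine*k>0 : ℚ.Positive (nine ℚ.* k)
    nine*k>0 = ℚ.pos*pos⇒pos nine {{nine>0}} k {{k>0}}

    9c≤ : nine ℚ.* c ℚ.≤ nine ℚ.* k ℚ.* (ε ℚ.* c)
    9c≤ = subst₂ ℚ._≤_ (ℚ.*-identityˡ (nine ℚ.* c)) (arrange k ε nine c)
      (ℚ.*-monoʳ-≤-nonNeg (nine ℚ.* c) {{ℚ.nonNeg*nonNeg⇒nonNeg nine {{ℚ.pos⇒nonNeg nine {{nine>0}}}} c {{c≥0}}}} large)
      where
      arrange : ∀ k ε nine c → k ℚ.* ε ℚ.* (nine ℚ.* c) ≡ nine ℚ.* k ℚ.* (ε ℚ.* c)
      arrange = solve 4 (λ k ε nine c → k :* ε :* (nine :* c) := nine :* k :* (ε :* c)) refl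

  approx-above : nine ℚ.* (k ℚ.* e) ℚ.≤ two ℚ.* (k ℚ.* c) ℚ.+ nine ℚ.* c → e ℚ.- r ℚ.* c ℚ.≤ ε ℚ.* c
  approx-above h = ℚ.*-cancelˡ-≤-pos (nine ℚ.* k) {{nine*k>0}} (ℚ.≤-trans
    (subst (ℚ._≤ nine ℚ.* c) (trans (cong (λ z → nine ℚ.* (k ℚ.* e) ℚ.- z ℚ.* (k ℚ.* c)) (sym r≡)) (expand e c k r nine))
      (difference-≤ (nine ℚ.* (k ℚ.* e)) (two ℚ.* (k ℚ.* c)) (nine ℚ.* c) h)) 9c≤)
    where
    expand : ∀ e c k r nine → nine ℚ.* (k ℚ.* e) ℚ.- nine ℚ.* r ℚ.* (k ℚ.* c) ≡ nine ℚ.* k ℚ.* (e ℚ.- r ℚ.* c)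
    expand = solve 5 (λ e c k r nine → nine :* (k :* e) :- nine :* r :* (k :* c) := nine :* k :* (e :- r :* c)) refl

  approx-below : two ℚ.* (k ℚ.* c) ℚ.≤ nine ℚ.* (k ℚ.* e) ℚ.+ nine ℚ.* c → ℚ.- (e ℚ.- r ℚ.* c) ℚ.≤ ε ℚ.* c
  approx-below h = ℚ.*-cancelˡ-≤-pos (nine ℚ.* k) {{nine*k>0}} (ℚ.≤-trans
    (subst (ℚ._≤ nine ℚ.* c) (trans (cong (λ z → z ℚ.* (k ℚ.* c) ℚ.- nine ℚ.* (k ℚ.* e)) (sym r≡)) (expand e c k r nine))
      (difference-≤ (two ℚ.* (k ℚ.* c)) (nine ℚ.* (k ℚ.* e)) (nine ℚ.* c) h)) 9c≤)
    where
    expand : ∀ e c k r nine → nine ℚ.* r ℚ.* (k ℚ.* c) ℚ.- nine ℚ.* (k ℚ.* e) ≡ nine ℚ.* k ℚ.* (ℚ.- (e ℚ.- r ℚ.* c))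
    expand = solve 5 (λ e c k r nine → nine :* r :* (k :* c) :- nine :* (k :* e) := nine :* k :* (:- (e :- r :* c))) refl

turán-density : TuranDensityIs (+ 2 / 9)
turán-density ε ε>0 with archimedean ε ε>0
... | k , k>0 , large = N , close
  where
  N₁ = proj₁ (upper-bound k)
  N = N₁ + (30 * k + 27)

  close : ∀ n → N ≤ n → ∀ e → IsEx n e → ℚ.∣ ℕtoℚ e ℚ.- + 2 / 9 ℚ.* ℕtoℚ (n C 3) ∣ ℚ.≤ ε ℚ.* ℕtoℚ (n C 3)
  close n n≥ e ((H , H-free , size≡e) , maximal) = ∣∣-≤ _ _
    (approx-above (ℕtoℚ e) (ℕtoℚ c) (ℕtoℚ k) ε (+ 2 / 9) (ℕtoℚ 2) (ℕtoℚ 9) (ℕtoℚ-pos k>0) _ (ℕtoℚ-nonNeg c) refl large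
      (subst₂ ℚ._≤_ 9ke 2kc+9c (ℕtoℚ-mono-≤ above)))
    (approx-below (ℕtoℚ e) (ℕtoℚ c) (ℕtoℚ k) ε (+ 2 / 9) (ℕtoℚ 2) (ℕtoℚ 9) (ℕtoℚ-pos k>0) _ (ℕtoℚ-nonNeg c) refl large
      (subst₂ ℚ._≤_ 2kc 9ke+9c (ℕtoℚ-mono-≤ below)))
    where
    open ≤-Reasoning
    c = n C 3
    dense = lower-bound k n (≤-trans (m≤n+m (30 * k + 27) N₁) n≥)

    above : 9 * (k * e) ≤ 2 * (k * c) + 9 * c
    above = begin
      9 * (k * e) ≡⟨ cong (λ z → 9 * (k * z)) size≡e ⟨
      9 * (k * size H) ≡⟨ *-assoc 9 k (size H) ⟨
      9 * k * size H ≤⟨ proj₂ (upper-bound k) n (≤-trans (m≤m+n N₁ (30 * k + 27)) n≥) H H-free ⟩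
      (2 * k + 9) * c ≡⟨ trans (*-distribʳ-+ c (2 * k) 9) (cong (_+ 9 * c) (*-assoc 2 k c)) ⟩
      2 * (k * c) + 9 * c ∎

    below : 2 * (k * c) ≤ 9 * (k * e) + 9 * c
    below = begin
      2 * (k * c) ≡⟨ *-assoc 2 k c ⟨
      2 * k * c ≤⟨ proj₂ (proj₂ dense) ⟩
      9 * k * size (proj₁ dense) + 9 * c ≤⟨ +-monoˡ-≤ (9 * c) (*-monoʳ-≤ (9 * k) (maximal (proj₁ dense) (proj₁ (proj₂ dense)))) ⟩
      9 * k * e + 9 * c ≡⟨ cong (_+ 9 * c) (*-assoc 9 k e) ⟩
      9 * (k * e) + 9 * c ∎

    triple : ∀ a b d → ℕtoℚ (a * (b * d)) ≡ ℕtoℚ a ℚ.* (ℕtoℚ b ℚ.* ℕtoℚ d)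
    triple a b d = trans (ℕtoℚ-* a (b * d)) (cong (ℕtoℚ a ℚ.*_) (ℕtoℚ-* b d))

    9ke = triple 9 k e
    2kc = triple 2 k c
    2kc+9c = trans (ℕtoℚ-+ (2 * (k * c)) (9 * c)) (cong₂ ℚ._+_ 2kc (ℕtoℚ-* 9 c))
    9ke+9c = trans (ℕtoℚ-+ (9 * (k * e)) (9 * c)) (cong₂ ℚ._+_ 9ke (ℕtoℚ-* 9 c))

-- Instability: many asymptotically extremal graphs, pairwise far apart

record Extremal (D M i : ℕ) : Set where
  field
    graph : Graph3 (6 * (D * M))
    free : FFree graph
    graph-size : size graph ≡ 8 * (D * M) ^ 3
    graph-squares : codegreeSquares (edge graph) + 32 * (i * (D ∸ i) * (M * M)) * (D * M * (D * M)) ≡ 96 * (D * M) ^ 4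

-- The blow-up with `a = iM` and `b = (D - i)M`. As `a + b = DM` is the same for all `i`, so are the
-- vertex and edge counts; only `ab = i(D - i)M²` varies.
extremal : ∀ D M i → i ≤ D → Extremal D M i
extremal D M i i≤D = record
  { graph = blowUp f
  ; free = blowUp-FFree f
  ; graph-size = trans (size-extremal f a b sizes) (cong (λ t → 8 * t ^ 3) a+b≡)
  ; graph-squares = trans (cong₂ (λ x t → codegreeSquares (edge (blowUp f)) + 32 * x * (t * t)) (sym ab≡) (sym a+b≡))
                     (trans (codegreeSquares-extremal f a b sizes) (cong (λ t → 96 * t ^ 4) a+b≡))
  }
  where
  a = i * M
  b = (D ∸ i) * M

  a+b≡ : a + b ≡ D * M
  a+b≡ = trans (sym (*-distribʳ-+ M i (D ∸ i))) (cong (_* M) (m+[n∸m]≡n i≤D))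

  ab≡ : a * b ≡ i * (D ∸ i) * (M * M)
  ab≡ = regroup i (D ∸ i) M
    where
    regroup : ∀ i j M → i * M * (j * M) ≡ i * j * (M * M)
    regroup = solve-∀

  coloured : Σ (Fin (6 * (D * M)) → Fin 6) λ f → HasClassSizes f (lookup (classSizes a b))
  coloured = colouring (6 * (D * M)) (classSizes a b) (trans (sum-classSizes a b) (cong (6 *_) a+b≡))

  f = proj₁ coloured
  sizes = proj₂ coloured

-- The hypotheses give `e ≤ (1 + 1/(2k)) s`. If `(1 - 1/k) e ≥ s` held as well, then `2e ≤ s`, and
-- with `s + e/k ≤ e` this forces `ks = 0`.
below-extremal : ∀ k e c s → 0 < k → 0 < s → 2 * c ≤ 9 * s → 9 * (9 * k) * e ≤ (2 * (9 * k) + 9) * c → k * e < k * s + e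
below-extremal k e c s k>0 s>0 2c≤9s bound = ≰⇒> λ small →
  let 2e≤s : 2 * e ≤ s
      2e≤s = +-cancelˡ-≤ (2 * (k * s)) _ _ (begin
        2 * (k * s) + 2 * e ≡⟨ *-distribˡ-+ 2 (k * s) e ⟨
        2 * (k * s + e) ≤⟨ *-monoʳ-≤ 2 small ⟩
        2 * (k * e) ≤⟨ 2ke≤ ⟩
        2 * (k * s) + s ∎)
      ks≤0 : k * s ≤ 0
      ks≤0 = +-cancelˡ-≤ (k * s) _ _ (begin
        k * s + k * s ≤⟨ m≤m+n (k * s + k * s) (2 * e) ⟩
        k * s + k * s + 2 * e ≡⟨ e₁ (k * s) e ⟩
        2 * (k * s + e) ≤⟨ *-monoʳ-≤ 2 small ⟩
        2 * (k * e) ≡⟨ e₂ k e ⟩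
        k * (2 * e) ≤⟨ *-monoʳ-≤ k 2e≤s ⟩
        k * s ≡⟨ +-identityʳ (k * s) ⟨
        k * s + 0 ∎)
  in <⇒≱ (*-mono-< k>0 s>0) ks≤0
  where
  open ≤-Reasoning
  e₁ : ∀ x e → x + x + 2 * e ≡ 2 * (x + e)
  e₁ = solve-∀
  e₂ : ∀ k e → 2 * (k * e) ≡ k * (2 * e)
  e₂ = solve-∀
  2ke≤ : 2 * (k * e) ≤ 2 * (k * s) + s
  2ke≤ = *-cancelˡ-≤ 81 (begin
    81 * (2 * (k * e)) ≡⟨ e₃ k e ⟩
    2 * (9 * (9 * k) * e) ≤⟨ *-monoʳ-≤ 2 bound ⟩
    2 * ((2 * (9 * k) + 9) * c) ≡⟨ e₄ k c ⟩
    (2 * (9 * k) + 9) * (2 * c) ≤⟨ *-monoʳ-≤ (2 * (9 * k) + 9) 2c≤9s ⟩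
    (2 * (9 * k) + 9) * (9 * s) ≡⟨ e₅ k s ⟩
    81 * (2 * (k * s) + s) ∎)
    where
    e₃ : ∀ k e → 81 * (2 * (k * e)) ≡ 2 * (9 * (9 * k) * e)
    e₃ = solve-∀
    e₄ : ∀ k c → 2 * ((2 * (9 * k) + 9) * c) ≡ (2 * (9 * k) + 9) * (2 * c)
    e₄ = solve-∀
    e₅ : ∀ k s → (2 * (9 * k) + 9) * (9 * s) ≡ 81 * (2 * (k * s) + s)
    e₅ = solve-∀

shrink-< : ∀ k e s ε → 1ℚ ℚ.≤ ℕtoℚ k ℚ.* ε → k * e < k * s + e → (1ℚ ℚ.- ε) ℚ.* ℕtoℚ e ℚ.< ℕtoℚ s
shrink-< k e s ε large lt = ℚ.*-cancelˡ-<-nonNeg k′ {{ℕtoℚ-nonNeg k}} (begin-strict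
  k′ ℚ.* ((1ℚ ℚ.- ε) ℚ.* e′) ≡⟨ expand k′ e′ ε ⟩
  k′ ℚ.* e′ ℚ.- k′ ℚ.* ε ℚ.* e′
    ≤⟨ ℚ.+-monoʳ-≤ (k′ ℚ.* e′) (ℚ.neg-antimono-≤ (ℚ.*-monoʳ-≤-nonNeg e′ {{ℕtoℚ-nonNeg e}} large)) ⟩
  k′ ℚ.* e′ ℚ.- 1ℚ ℚ.* e′ <⟨ ℚ.+-monoˡ-< (ℚ.- (1ℚ ℚ.* e′)) lt′ ⟩
  k′ ℚ.* s′ ℚ.+ e′ ℚ.- 1ℚ ℚ.* e′ ≡⟨ trans (cong (λ z → k′ ℚ.* s′ ℚ.+ e′ ℚ.- z) (ℚ.*-identityˡ e′)) (cancel (k′ ℚ.* s′) e′) ⟩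
  k′ ℚ.* s′ ∎)
  where
  open ℚ.≤-Reasoning
  k′ = ℕtoℚ k
  e′ = ℕtoℚ e
  s′ = ℕtoℚ s
  lt′ : k′ ℚ.* e′ ℚ.< k′ ℚ.* s′ ℚ.+ e′
  lt′ = subst₂ ℚ._<_ (ℕtoℚ-* k e) (trans (ℕtoℚ-+ (k * s) e) (cong (ℚ._+ e′) (ℕtoℚ-* k s))) (ℕtoℚ-mono-< lt)
  expand : ∀ k e ε → k ℚ.* ((1ℚ ℚ.- ε) ℚ.* e) ≡ k ℚ.* e ℚ.- k ℚ.* ε ℚ.* e
  expand k e ε = trans (general k e ε 1ℚ) (cong (λ z → k ℚ.* z ℚ.- k ℚ.* ε ℚ.* e) (ℚ.*-identityˡ e))
    where
    general : ∀ k e ε o → k ℚ.* ((o ℚ.- ε) ℚ.* e) ≡ k ℚ.* (o ℚ.* e) ℚ.- k ℚ.* ε ℚ.* e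
    general = solve 4 (λ k e ε o → k :* ((o :- ε) :* e) := k :* (o :* e) :- k :* ε :* e) refl
  cancel : ∀ x e → x ℚ.+ e ℚ.- e ≡ x
  cancel = solve 2 (λ x e → x :+ e :- e := x) refl

reciprocal : ∀ q → 0 < q → ∃[ r ] 0ℚ ℚ.< r × ∀ d m → ℕtoℚ d ℚ.≤ r ℚ.* ℕtoℚ m → q * d ≤ m
reciprocal q q>0 = r , ℚ.positive⁻¹ r {{ℚ.1/pos⇒pos q′}} , λ d m le → ℕtoℚ-cancel-≤ (begin
  ℕtoℚ (q * d) ≡⟨ ℕtoℚ-* q d ⟩
  q′ ℚ.* ℕtoℚ d ≤⟨ ℚ.*-monoˡ-≤-nonNeg q′ {{ℕtoℚ-nonNeg q}} le ⟩
  q′ ℚ.* (r ℚ.* ℕtoℚ m) ≡⟨ ℚ.*-assoc q′ r (ℕtoℚ m) ⟨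
  q′ ℚ.* r ℚ.* ℕtoℚ m ≡⟨ trans (cong (ℚ._* ℕtoℚ m) (ℚ.*-inverseʳ q′)) (ℚ.*-identityˡ (ℕtoℚ m)) ⟩
  ℕtoℚ m ∎)
  where
  open ℚ.≤-Reasoning
  q′ = ℕtoℚ q
  instance
    q′-pos : ℚ.Positive q′
    q′-pos = ℕtoℚ-pos q>0
    q′-nonZero : ℚ.NonZero q′
    q′-nonZero = ℚ.pos⇒nonZero q′
  r = ℚ.1/ q′

cancel-cube : ∀ s t q d → 0 < s → s ^ 3 * q * d ≤ (s * t) ^ 3 → q * d ≤ t ^ 3
cancel-cube s t q d s>0 le = *-cancelˡ-≤ (s ^ 3) {{>-nonZero (m^n>0 s {{>-nonZero s>0}} 3)}} (begin
  s ^ 3 * (q * d) ≡⟨ *-assoc (s ^ 3) q d ⟨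
  s ^ 3 * q * d ≤⟨ le ⟩
  (s * t) ^ 3 ≡⟨ expand s t ⟩
  s ^ 3 * t ^ 3 ∎)
  where
  open ≤-Reasoning
  expand : ∀ s t → s * t * (s * t * (s * t * 1)) ≡ s * (s * (s * 1)) * (t * (t * (t * 1)))
  expand = solve-∀

-- With `u = j - i` and `v = D - j`, the difference of the two sides is `u * (v - i)`, and
-- `i + j < D` says that `i < v`: both points are taken before the parabola repeats a value.
parabola-< : ∀ D i j → i < j → i + j < D → i * (D ∸ i) < j * (D ∸ j)
parabola-< D i j i<j i+j<D = subst₂ _<_ (cong (i *_) D∸i≡) (cong (_* v) j≡) (begin-strict
  i * (u + v) ≡⟨ *-distribˡ-+ i u v ⟩
  i * u + i * v ≡⟨ +-comm (i * u) (i * v) ⟩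
  i * v + i * u <⟨ +-monoʳ-< (i * v) (*-monoˡ-< u {{>-nonZero (m<n⇒0<n∸m i<j)}} i<v) ⟩
  i * v + v * u ≡⟨ cong (λ z → i * v + z) (*-comm v u) ⟩
  i * v + u * v ≡⟨ *-distribʳ-+ v i u ⟨
  (i + u) * v ∎)
  where
  open ≤-Reasoning
  u = j ∸ i
  v = D ∸ j
  i<v : i < v
  i<v = m+n≤o⇒m≤o∸n (suc i) i+j<D
  j≡ : i + u ≡ j
  j≡ = m+[n∸m]≡n (<⇒≤ i<j)
  j≤D : j ≤ D
  j≤D = ≤-trans (m≤n+m j i) (<⇒≤ i+j<D)
  D∸i≡ : u + v ≡ D ∸ i
  D∸i≡ = trans (sym (m+n∸m≡n i (u + v))) (cong (_∸ i) (trans (sym (+-assoc i u v)) (trans (cong (_+ v) j≡) (m+[n∸m]≡n j≤D))))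

double-nC3≤ : ∀ t → 2 * ((6 * t) C 3) ≤ 9 * (8 * t ^ 3)
double-nC3≤ t = *-cancelˡ-≤ 3 (begin
  3 * (2 * ((6 * t) C 3)) ≡⟨ *-assoc 3 2 ((6 * t) C 3) ⟨
  6 * ((6 * t) C 3) ≤⟨ six-nC3≤ (6 * t) ⟩
  (6 * t) ^ 3 ≡⟨ expand t ⟩
  3 * (9 * (8 * t ^ 3)) ∎)
  where
  open ≤-Reasoning
  expand : ∀ t → 6 * t * (6 * t * (6 * t * 1)) ≡ 3 * (9 * (8 * (t * (t * (t * 1)))))
  expand = solve-∀

Approximated : ∀ {n T} → ℕ → ℕ → (Fin T → Graph3 n) → Graph3 n → Set
Approximated {n} q b G H = ∃[ x ] Σ (Fin n → Fin n) λ σ → Injective _≡_ _≡_ σ × q * dist (relabel σ H) (G x) ≤ b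

not-both-approximated : ∀ {n T} (G : Fin T → Graph3 n) (H₁ H₂ : Graph3 n) D M x₁ x₂ → 0 < D * M → n ≡ 6 * (D * M) → x₁ < x₂ →
  codegreeSquares (edge H₁) + 32 * (x₁ * (M * M)) * (D * M * (D * M)) ≡ 96 * (D * M) ^ 4 →
  codegreeSquares (edge H₂) + 32 * (x₂ * (M * M)) * (D * M * (D * M)) ≡ 96 * (D * M) ^ 4 →
  (A₁ : Approximated (5 * (D * D)) ((D * M) ^ 3) G H₁) (A₂ : Approximated (5 * (D * D)) ((D * M) ^ 3) G H₂) →
  proj₁ A₁ ≢ proj₁ A₂
not-both-approximated G H₁ H₂ D M x₁ x₂ t>0 n≡ x₁<x₂ K₁ K₂ (x , σ₁ , σ₁-inj , near₁) (_ , σ₂ , σ₂-inj , near₂) refl =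
  far-apart H₁ H₂ (G x) σ₁ σ₂ σ₁-inj σ₂-inj D M x₁ x₂ t>0 n≡ x₁<x₂ K₁ K₂ near₁ near₂

-- The `T + 1` graphs for `i = 0, ..., T` meet only `T` proposed graphs, so two of them are
-- approximated by the same one. Their indices satisfy `i + j ≤ 2T < D`, so `parabola-<` separates
-- their products and `far-apart` their sums of squared codegrees.
not-all-approximated : ∀ {T} D M → T + T < D → 0 < D * M → (G : Fin T → Graph3 (6 * (D * M))) →
  (∀ i → (E : Extremal D M i) → Approximated (5 * (D * D)) ((D * M) ^ 3) G (Extremal.graph E)) → ⊥
not-all-approximated {T} D M 2T<D t>0 G approximated = clash (pigeonhole (n<1+n T) (λ i → proj₁ (approx i)))
  where
  open Extremal

  family : (i : Fin (suc T)) → Extremal D M (toℕ i)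
  family i = extremal D M (toℕ i) (≤-trans (Fin.toℕ≤pred[n] i) (≤-trans (m≤m+n T T) (<⇒≤ 2T<D)))

  approx : ∀ i → Approximated (5 * (D * D)) ((D * M) ^ 3) G (graph (family i))
  approx i = approximated (toℕ i) (family i)

  clash : (∃[ i ] ∃[ j ] toℕ {suc T} i < toℕ {suc T} j × proj₁ (approx i) ≡ proj₁ (approx j)) → ⊥
  clash (i , j , i<j , same) = not-both-approximated G (graph (family i)) (graph (family j))
    D M (toℕ i * (D ∸ toℕ i)) (toℕ j * (D ∸ toℕ j)) t>0 refl
    (parabola-< D (toℕ i) (toℕ j) i<j (≤-<-trans (+-mono-≤ (Fin.toℕ≤pred[n] i) (Fin.toℕ≤pred[n] j)) 2T<D))
    (graph-squares (family i)) (graph-squares (family j)) (approx i) (approx j) same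

-- The upper bound is used with `9k` in place of `k`. Then the extremal number is at most
-- `(2/9 + 1/(9k))` times the binomial coefficient, that is, at most `(1 + 1/(2k))` times `8t³`,
-- which is fine enough for `below-extremal`.
almost-maximal : ∀ k ε → 0 < k → 1ℚ ℚ.≤ ℕtoℚ k ℚ.* ε → ∃[ N ] ∀ t → N ≤ 6 * t → 0 < t → (H : Graph3 (6 * t)) →
                 size H ≡ 8 * t ^ 3 → ∀ e → IsEx (6 * t) e → (1ℚ ℚ.- ε) ℚ.* ℕtoℚ e ℚ.< ℕtoℚ (size H)
almost-maximal k ε k>0 large = proj₁ (upper-bound (9 * k)) , λ t n≥ t>0 H size≡ e ((H′ , H′-free , size′≡) , _) →
  shrink-< k e (size H) ε large
    (below-extremal k e ((6 * t) C 3) (size H) k>0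
      (subst (0 <_) (sym size≡) (*-mono-< {0} {8} (s≤s z≤n) (m^n>0 t {{>-nonZero t>0}} 3)))
      (subst (λ z → 2 * ((6 * t) C 3) ≤ 9 * z) (sym size≡) (double-nC3≤ t))
      (subst (λ z → 9 * (9 * k) * z ≤ (2 * (9 * k) + 9) * ((6 * t) C 3)) size′≡
        (proj₂ (upper-bound (9 * k)) (6 * t) n≥ H′ H′-free)))

unstable : StabilityInfinite
unstable T (G , stable) = not-all-approximated D M ≤-refl t>0 (G (6 * (D * M))) λ i E →
  let x , σ , σ-inj , near = proj₂ (proj₂ (proj₂ stability)) (6 * (D * M)) N₀≤ (Extremal.graph E) (Extremal.free E)
        (proj₂ maximal (D * M) N₁≤ t>0 (Extremal.graph E) (Extremal.graph-size E))
  in x , σ , σ-inj , cancel-cube 6 (D * M) (5 * (D * D)) (dist (relabel σ (Extremal.graph E)) (G (6 * (D * M)) x)) (s≤s z≤n)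
       (proj₂ (proj₂ inverse) (dist (relabel σ (Extremal.graph E)) (G (6 * (D * M)) x)) ((6 * (D * M)) ^ 3) near)
  where
  -- The least `D` above `2T`, as required for `T + 1` distinct values of `i * (D - i)`.
  D = suc (T + T)
  -- The tolerance is the reciprocal of `6³ * 5D²`. The factor `6³` converts `n³` into `t³` for
  -- `n = 6t`, and `5D²` is the closeness that `far-apart` demands.
  inverse = reciprocal (6 ^ 3 * (5 * (D * D))) (*-mono-< {0} {6 ^ 3} (m^n>0 6 3) (*-mono-< {0} {5} (s≤s z≤n) (*-mono-< {0} {D} (s≤s z≤n) (s≤s z≤n))))
  stability = stable (proj₁ inverse) (proj₁ (proj₂ inverse))
  ε = proj₁ stability
  N₀ = proj₁ (proj₂ (proj₂ stability))
  arch = archimedean ε (proj₁ (proj₂ stability))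
  maximal = almost-maximal (proj₁ arch) ε (proj₁ (proj₂ arch)) (proj₂ (proj₂ arch))
  M = suc (N₀ + proj₁ maximal)

  t>0 : 0 < D * M
  t>0 = *-mono-< {0} {D} {0} {M} (s≤s z≤n) (s≤s z≤n)

  M≤n : M ≤ 6 * (D * M)
  M≤n = ≤-trans (m≤n*m M D) (m≤n*m (D * M) 6)

  N₀≤ : N₀ ≤ 6 * (D * M)
  N₀≤ = ≤-trans (m≤n⇒m≤1+n (m≤m+n N₀ (proj₁ maximal))) M≤n

  N₁≤ : proj₁ maximal ≤ 6 * (D * M)
  N₁≤ = ≤-trans (m≤n⇒m≤1+n (m≤n+m (proj₁ maximal) N₀)) M≤n

theorem1p2 : TuranDensityIs (+ 2 / 9) × StabilityInfinite
theorem1p2 = turán-density , unstable
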